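{- Let $G$ be a snake graph, coloured so that all its turns are black, and let $w$ be any Kasteleyn weighting of $G$ with weighted adjacency matrix $A$ and weighted bipartite adjacency matrix $B$. Let $B_1$ (resp. $B_2$) be the principal submatrix of $BB^T$ on the black vertices of the upper (resp. lower) boundary. Then $\chi_A(t)=\chi_{B_1}(t^2)\chi_{B_2}(t^2)$. Moreover, if $1,2,\dots,k$ are the black vertices of the upper boundary in the order they occur along it, $e_l$ is the number of neighbours of vertex $l$ in $G$, and $c_l(x)=x-e_l$, then $\chi_{B_1}(x)=p(x)$, where $$[[c_1(x),\dots,c_k(x)]]=c_1(x)-\cfrac{1}{c_2(x)-\cfrac{1}{\ddots-\cfrac{1}{c_k(x)}}}=\frac{p(x)}{q(x)}$$ with $p,q\in\mathbb{Q}[x]$ coprime and $p$ monic. The polynomial $\chi_{B_2}(x)$ is obtained in the same way from the black vertices of the lower boundary.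
   Context: A snake graph is a plane graph formed by a finite sequence of unit square tiles $T_1,\dots,T_N$ in the plane, each $T_{i+1}$ placed immediately to the right of or immediately on top of $T_i$, consecutive tiles sharing exactly one edge. It is bipartite; vertices are coloured black and white with adjacent vertices of different colours. A vertex is a turn if it has exactly $2$ or exactly $4$ neighbours and is neither the lower-right, lower-left nor upper-left vertex of $T_1$, nor the upper-left, upper-right or lower-right vertex of $T_N$. Upper and lower boundary: for $N\geq2$, the start edge is the edge of $T_1$ joining the two vertices of $T_1$ not in any other tile, and the end edge is defined analogously for $T_N$; the edges bounding the unbounded face form a cycle, and removing the start and end edges leaves two disjoint paths; the one containing the lower-left vertex of $T_1$ is the upper boundary if $T_2$ lies above $T_1$ and the lower boundary otherwise, the other path being the other boundary. For $N=1$ the upper boundary is the top edge and the lower boundary is the bottom edge. A weighting $w:E\to\{\pm1\}$ is Kasteleyn if every face (including the unbounded face) bounded by a $k$-cycle has an odd number of edges of weight $-1$ when $k\equiv0\bmod4$ and an even number when $k\equiv2\bmod4$. The weighted adjacency matrix $A$ is indexed by all vertices with entry $w(e)$ for vertices joined by edge $e$ and $0$ otherwise; $B$ is its submatrix with rows the black and columns the white vertices. $\chi_M(x)=\det(xI-M)$. -}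

module Defs where

open import Data.Bool using (Bool; true; false; if_then_else_; _∧_; _∨_; not; T)
open import Data.Nat as ℕ using (ℕ; zero; suc; _<_; _%_; _≡ᵇ_)
open import Data.Nat.Properties using () renaming (_≟_ to _≟ℕ_)
open import Data.Product using (Σ; _×_; _,_; proj₁; proj₂; ∃)
open import Data.Product.Properties using (≡-dec)
open import Data.Sum using (_⊎_)
open import Data.List using (List; []; _∷_; length; filter; filterᵇ; deduplicate; map;
  concatMap; foldr; head; last; lookup; reverse)
open import Data.List.Membership.Propositional using (_∈_; _∉_)
open import Data.List.Relation.Unary.Unique.Propositional using (Unique)
open import Data.Bool.ListAction using (any)
open import Data.Maybe using (Maybe; just; nothing)
open import Data.Fin using (Fin; zero; suc; punchIn)
open import Data.Sign using (Sign; +; -)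
open import Data.Rational using (ℚ; 0ℚ; 1ℚ) renaming (-_ to negℚ; _/_ to _/ℚ_)
open import Data.Rational using () renaming (_+_ to _+ℚ_; _*_ to _*ℚ_)
open import Data.Integer using () renaming (+_ to ℤpos)
open import Relation.Binary.PropositionalEquality using (_≡_; _≢_; refl)
open import Relation.Binary.Definitions using (DecidableEquality)
open import Relation.Nullary using (does; yes; no; ¬_)

-- Polynomials over ℚ: coefficient lists, lowest degree first.
-- Two polynomials are equal iff all their coefficients agree
-- (so trailing zero coefficients are irrelevant).

Poly : Set
Poly = List ℚ

coeff : Poly → ℕ → ℚ
coeff []       _       = 0ℚ
coeff (a ∷ p)  zero    = a
coeff (a ∷ p)  (suc n) = coeff p n

infix 4 _≈P_
_≈P_ : Poly → Poly → Set
p ≈P q = ∀ n → coeff p n ≡ coeff q n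

infixl 6 _+P_ _-P_
infixl 7 _*P_ _·P_

_+P_ : Poly → Poly → Poly
[]      +P q       = q
(a ∷ p) +P []      = a ∷ p
(a ∷ p) +P (b ∷ q) = (a +ℚ b) ∷ (p +P q)

_·P_ : ℚ → Poly → Poly
a ·P p = map (a *ℚ_) p

negP : Poly → Poly
negP p = map negℚ p

_-P_ : Poly → Poly → Poly
p -P q = p +P negP q

_*P_ : Poly → Poly → Poly
[]      *P q = []
(a ∷ p) *P q = (a ·P q) +P (0ℚ ∷ (p *P q))

constP : ℚ → Poly
constP a = a ∷ []

0P 1P X : Poly
0P = []
1P = constP 1ℚ
X  = 0ℚ ∷ 1ℚ ∷ []

compose : Poly → Poly → Poly
compose p q = foldr (λ a acc → constP a +P (q *P acc)) 0P p

infix 4 _∣P_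
_∣P_ : Poly → Poly → Set
d ∣P p = Σ Poly (λ e → d *P e ≈P p)

CoprimeP : Poly → Poly → Set
CoprimeP p q = ∀ d → d ∣P p → d ∣P q → d ∣P 1P

Monic : Poly → Set
Monic p = Σ ℕ (λ n → coeff p n ≡ 1ℚ × (∀ m → n < m → coeff p m ≡ 0ℚ))

Matrix : Set → ℕ → Set
Matrix A n = Fin n → Fin n → A

det : ∀ {n} → Matrix Poly n → Poly
det {zero}  M = 1P
det {suc n} M = go (suc n) (λ j → j) 1ℚ
  where
  minor : Fin (suc n) → Matrix Poly n
  minor j i k = M (suc i) (punchIn j k)
  go : (m : ℕ) → (Fin m → Fin (suc n)) → ℚ → Poly
  go zero    col s = 0P
  go (suc m) col s =
    (s ·P (M zero (col zero) *P det (minor (col zero)))) +P go m (λ k → col (suc k)) (negℚ s)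

δ : ∀ {n} → Fin n → Fin n → Bool
δ zero    zero    = true
δ zero    (suc j) = false
δ (suc i) zero    = false
δ (suc i) (suc j) = δ i j

charPoly : ∀ {n} → Matrix ℚ n → Poly
charPoly M = det (λ i j → (if δ i j then X else 0P) -P constP (M i j))

-- Continued fractions  [[c₁,…,c_k]] = c₁ - 1/(c₂ - 1/(⋯ - 1/c_k)),
-- computed as a formal fraction (numerator , denominator) in ℚ(x):
--   [[c]] = c / 1,   [[c , rest]] = c - 1/(n/d) = (c n - d) / n.

contFrac : List Poly → Poly × Poly
contFrac []            = (1P , 0P)   -- never used (k ≥ 1 always)
contFrac (c ∷ [])      = (c , 1P)
contFrac (c ∷ c' ∷ cs) with contFrac (c' ∷ cs)
... | (n , d) = ((c *P n) -P d , n)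

-- "[[cs]] = p / q" as an identity of rational functions
CFEquals : List Poly → Poly → Poly → Set
CFEquals cs p q = p *P proj₂ (contFrac cs) ≈P q *P proj₁ (contFrac cs)

-- Snake graphs.  Tile T₁ has lower-left corner (0,0); a snake graph with
-- N tiles is given by the list of N-1 steps (R: next tile to the right,
-- U: next tile on top).

Point : Set
Point = ℕ × ℕ

_≟P_ : DecidableEquality Point
_≟P_ = ≡-dec _≟ℕ_ _≟ℕ_

_==P_ : Point → Point → Bool
p ==P q = does (p ≟P q)

data Step : Set where
  R U : Step

tilesFrom : Point → List Step → List Point
tilesFrom p []               = p ∷ []
tilesFrom (a , b) (R ∷ ss)   = (a , b) ∷ tilesFrom (suc a , b) ss
tilesFrom (a , b) (U ∷ ss)   = (a , b) ∷ tilesFrom (a , suc b) ss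

tiles : List Step → List Point
tiles = tilesFrom (0 , 0)

lastTile : List Step → Point
lastTile ss with last (tiles ss)
... | just t  = t
... | nothing = (0 , 0)

otherThanFirst otherThanLast : List Step → List Point
otherThanFirst ss with tiles ss
... | []     = []
... | _ ∷ ts = ts
otherThanLast ss = reverse (otherThanFirst' (reverse (tiles ss)))
  where otherThanFirst' : List Point → List Point
        otherThanFirst' []       = []
        otherThanFirst' (_ ∷ ts) = ts

corners : Point → List Point
corners (a , b) = (a , b) ∷ (suc a , b) ∷ (a , suc b) ∷ (suc a , suc b) ∷ []

-- edges: unit segments, hor p = p — p+(1,0), ver p = p — p+(0,1)
data Edge : Set where
  hor ver : Point → Edge

_==E_ : Edge → Edge → Bool
hor p ==E hor q = p ==P q
ver p ==E ver q = p ==P q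
_     ==E _     = false

_≟E_ : DecidableEquality Edge
hor p ≟E hor q with p ≟P q
... | yes refl = yes refl
... | no  ne   = no λ { refl → ne refl }
ver p ≟E ver q with p ≟P q
... | yes refl = yes refl
... | no  ne   = no λ { refl → ne refl }
hor p ≟E ver q = no λ ()
ver p ≟E hor q = no λ ()

endpoints : Edge → Point × Point
endpoints (hor (a , b)) = ((a , b) , (suc a , b))
endpoints (ver (a , b)) = ((a , b) , (a , suc b))

sides : Point → List Edge
sides (a , b) = hor (a , b) ∷ hor (a , suc b) ∷ ver (a , b) ∷ ver (suc a , b) ∷ []

memP : Point → List Point → Bool
memP p = any (p ==P_)

memE : Edge → List Edge → Bool
memE e = any (e ==E_)

vertices : List Step → List Point
vertices ss = deduplicate _≟P_ (concatMap corners (tiles ss))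

edges : List Step → List Edge
edges ss = deduplicate _≟E_ (concatMap sides (tiles ss))

joins : Edge → Point → Point → Bool
joins e u v with endpoints e
... | (x , y) = ((x ==P u) ∧ (y ==P v)) ∨ ((x ==P v) ∧ (y ==P u))

edgeBetween : List Step → Point → Point → Maybe Edge
edgeBetween ss u v = Data.List.find (λ e → Data.Bool._≟_ (joins e u v) true) (edges ss)

adjacent : List Step → Point → Point → Bool
adjacent ss u v with edgeBetween ss u v
... | just _  = true
... | nothing = false

degree : List Step → Point → ℕ
degree ss v = length (filterᵇ (λ u → adjacent ss u v) (vertices ss))

excluded : List Step → List Point
excluded ss with lastTile ss
... | (a , b) = (1 , 0) ∷ (0 , 0) ∷ (0 , 1) ∷ (a , suc b) ∷ (suc a , suc b) ∷ (suc a , b) ∷ []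

IsTurn : List Step → Point → Set
IsTurn ss v = (degree ss v ≡ 2 ⊎ degree ss v ≡ 4) × T (not (memP v (excluded ss)))

-- colourings (true = black)
Colouring : Set
Colouring = Point → Bool

ProperColouring : List Step → Colouring → Set
ProperColouring ss col = ∀ e → e ∈ edges ss →
  col (proj₁ (endpoints e)) ≢ col (proj₂ (endpoints e))

TurnsBlack : List Step → Colouring → Set
TurnsBlack ss col = ∀ v → v ∈ vertices ss → IsTurn ss v → col v ≡ true

tileCount : List Step → Edge → ℕ
tileCount ss e = length (filterᵇ (λ t → memE e (sides t)) (tiles ss))

-- edges bounding the unbounded face (sides of exactly one tile)
boundaryEdges : List Step → List Edge
boundaryEdges ss = filterᵇ (λ e → tileCount ss e ≡ᵇ 1) (edges ss)

Weighting : Set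
Weighting = Edge → Sign

negCount : Weighting → List Edge → ℕ
negCount w es = length (filterᵇ (λ e → isNeg (w e)) es)
  where isNeg : Sign → Bool
        isNeg - = true
        isNeg + = false

Odd Even : ℕ → Set
Odd n  = n % 2 ≡ 1
Even n = n % 2 ≡ 0

-- Kasteleyn condition for a face bounded by a k-cycle with m edges of weight -1
KastFace : ℕ → ℕ → Set
KastFace k m = (k % 4 ≡ 0 → Odd m) × (k % 4 ≡ 2 → Even m)

-- bounded faces are the tiles (4-cycles); plus the unbounded face
Kasteleyn : List Step → Weighting → Set
Kasteleyn ss w =
  (∀ t → t ∈ tiles ss → KastFace 4 (negCount w (sides t))) ×
  KastFace (length (boundaryEdges ss)) (negCount w (boundaryEdges ss))

signℚ : Sign → ℚ
signℚ + = 1ℚ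
signℚ - = negℚ 1ℚ

adjW : List Step → Weighting → Point → Point → ℚ
adjW ss w u v with edgeBetween ss u v
... | just e  = signℚ (w e)
... | nothing = 0ℚ

adjMatrix : (ss : List Step) → Weighting → Matrix ℚ (length (vertices ss))
adjMatrix ss w i j = adjW ss w (lookup (vertices ss) i) (lookup (vertices ss) j)

blackVs whiteVs : List Step → Colouring → List Point
blackVs ss col = filterᵇ col (vertices ss)
whiteVs ss col = filterᵇ (λ v → not (col v)) (vertices ss)

bipMatrix : (ss : List Step) (col : Colouring) → Weighting →
  Fin (length (blackVs ss col)) → Fin (length (whiteVs ss col)) → ℚ
bipMatrix ss col w i j = adjW ss w (lookup (blackVs ss col) i) (lookup (whiteVs ss col) j)

sumFin : ∀ {n} → (Fin n → ℚ) → ℚ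
sumFin {zero}  f = 0ℚ
sumFin {suc n} f = f zero +ℚ sumFin (λ k → f (suc k))

BBtAt : (ss : List Step) (col : Colouring) → Weighting → Point → Point → ℚ
BBtAt ss col w u v = sumFin (λ k → adjW ss w u (lookup (whiteVs ss col) k) *ℚ
                                   adjW ss w v (lookup (whiteVs ss col) k))

privateCorners : Point → List Point → List Point
privateCorners t others =
  filterᵇ (λ v → not (any (λ t' → memP v (corners t')) others)) (corners t)

IsStartEdge : List Step → Edge → Set
IsStartEdge ss e = e ∈ sides (0 , 0) ×
  T (memP (proj₁ (endpoints e)) (privateCorners (0 , 0) (otherThanFirst ss))) ×
  T (memP (proj₂ (endpoints e)) (privateCorners (0 , 0) (otherThanFirst ss)))

IsEndEdge : List Step → Edge → Set
IsEndEdge ss e = e ∈ sides (lastTile ss) ×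
  T (memP (proj₁ (endpoints e)) (privateCorners (lastTile ss) (otherThanLast ss))) ×
  T (memP (proj₂ (endpoints e)) (privateCorners (lastTile ss) (otherThanLast ss)))

IsBoundaryPathEdge : List Step → Edge → Set
IsBoundaryPathEdge ss e = e ∈ boundaryEdges ss × ¬ IsStartEdge ss e × ¬ IsEndEdge ss e

data ConsecJoined (E : Edge → Set) : List Point → Set where
  []  : ConsecJoined E []
  [_] : ∀ v → ConsecJoined E (v ∷ [])
  _∷_ : ∀ {u v vs} → Σ Edge (λ e → E e × T (joins e u v)) →
        ConsecJoined E (v ∷ vs) → ConsecJoined E (u ∷ v ∷ vs)

IsEndpointOf : (Edge → Set) → Point → Set
IsEndpointOf E v = Σ Edge (λ e → E e × (v ≡ proj₁ (endpoints e) ⊎ v ≡ proj₂ (endpoints e)))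

-- P is a traversal (in one of the two directions) of one of the two
-- paths obtained by deleting start and end edge from the outer cycle
IsBoundaryTraversal : List Step → List Point → Set
IsBoundaryTraversal ss P =
  Unique P × ConsecJoined (IsBoundaryPathEdge ss) P ×
  Σ Point (λ s → Σ Point (λ f → head P ≡ just s × last P ≡ just f ×
     ((IsEndpointOf (IsStartEdge ss) s × IsEndpointOf (IsEndEdge ss) f) ⊎
      (IsEndpointOf (IsEndEdge ss) s × IsEndpointOf (IsStartEdge ss) f))))

-- "the path containing the lower-left vertex of T₁ is the upper boundary
-- iff T₂ lies above T₁"
IsUpperBoundary IsLowerBoundary : List Step → List Point → Set
IsUpperBoundary []       P = P ≡ (0 , 1) ∷ (1 , 1) ∷ [] ⊎ P ≡ (1 , 1) ∷ (0 , 1) ∷ []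
IsUpperBoundary (R ∷ ss) P = IsBoundaryTraversal (R ∷ ss) P × (0 , 0) ∉ P
IsUpperBoundary (U ∷ ss) P = IsBoundaryTraversal (U ∷ ss) P × (0 , 0) ∈ P
IsLowerBoundary []       P = P ≡ (0 , 0) ∷ (1 , 0) ∷ [] ⊎ P ≡ (1 , 0) ∷ (0 , 0) ∷ []
IsLowerBoundary (R ∷ ss) P = IsBoundaryTraversal (R ∷ ss) P × (0 , 0) ∈ P
IsLowerBoundary (U ∷ ss) P = IsBoundaryTraversal (U ∷ ss) P × (0 , 0) ∉ P

blackOn : Colouring → List Point → List Point
blackOn col P = filterᵇ col P

boundaryMatrix : List Step → (col : Colouring) → Weighting → (P : List Point) →
  Matrix ℚ (length (blackOn col P))
boundaryMatrix ss col w P i j = BBtAt ss col w (lookup (blackOn col P) i) (lookup (blackOn col P) j)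

cPoly : List Step → Point → Poly
cPoly ss v = X -P constP (ℤpos (degree ss v) /ℚ 1)

ContFracClaim : List Step → Colouring → Weighting → List Point → Set
ContFracClaim ss col w P = Σ Poly λ p → Σ Poly λ q →
  CFEquals (map (cPoly ss) (blackOn col P)) p q × ¬ (q ≈P 0P) ×
  CoprimeP p q × Monic p × charPoly (boundaryMatrix ss col w P) ≈P p

{-# OPTIONS --safe #-}
module Submission where

-- Order the vertices as black, then white.  Multiplying the black rows of t I - A by t and adding multiples of the white
-- rows gives χ_A(t) = χ_{BBᵀ}(t²), because a snake graph has as many black as white vertices.  Growing the snake one
-- tile at a time shows that BBᵀ is block diagonal: two black vertices in one tile have two common white neighbours,
-- whose contributions cancel by the Kasteleyn condition, and since all turns are black the only other black vertices
-- with a common neighbour are consecutive on a boundary path, with a single one.  So each block is tridiagonal with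
-- off-diagonal entries ±1 and the degrees on the diagonal, and expanding its characteristic polynomial along the first
-- row is the recursion for the numerator of the continued fraction.

open import Defs
open import Algebra.Bundles using (CommutativeRing)
import Algebra.Properties.CommutativeSemigroup as CSP
import Algebra.Properties.Ring as RingProperties
open import Data.Bool as Bool using (Bool; true; false; if_then_else_; _∧_; _∨_; not; T)
open import Data.Bool.ListAction using (any)
open import Data.Bool.Properties using (∨-comm; T-≡)
open import Data.Empty using (⊥; ⊥-elim)
open import Data.Fin using (Fin; zero; suc; punchIn)
open import Data.Integer as ℤ using () renaming (+_ to ℤpos)
import Data.Integer.Properties as ℤP
open import Data.List using (List; []; _∷_; map; _++_; length; lookup; tabulate; filterᵇ; find; concatMap; reverse; head; last)
open import Data.List.Membership.Propositional using (_∈_; _∉_; lose)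
open import Data.List.Membership.Propositional.Properties
  using (∈-filter⁺; ∈-filter⁻; ∈-concatMap⁺; ∈-concatMap⁻; ∈-deduplicate⁺; ∈-deduplicate⁻; ∈-++⁺ˡ; ∈-++⁺ʳ; ∈-++⁻)
open import Data.List.Membership.Propositional.Properties.WithK using (unique∧set⇒bag)
open import Data.List.Properties
  using (map-tabulate; tabulate-lookup; map-++; length-map; length-++; length-reverse;
    filter-++; unfold-reverse; reverse-++; reverse-involutive; ++-assoc; ++-identityʳ)
open import Data.List.Relation.Binary.BagAndSetEquality using (∼bag⇒↭)
open import Data.List.Relation.Binary.Permutation.Propositional using (_↭_; refl; prep; swap; trans)
open import Data.List.Relation.Binary.Permutation.Propositional.Properties using (↭-length)
open import Data.List.Relation.Binary.Subset.Propositional using (_⊆_)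
open import Data.List.Relation.Unary.All as All using (All; []; _∷_)
open import Data.List.Relation.Unary.AllPairs using (AllPairs; []; _∷_)
open import Data.List.Relation.Unary.Any using (Any; here; there)
open import Data.List.Relation.Unary.Any.Properties using (reverse⁺; reverse⁻)
open import Data.List.Relation.Unary.Unique.DecPropositional.Properties _≟P_ using (deduplicate-!)
open import Data.List.Relation.Unary.Unique.Propositional using (Unique)
import Data.List.Relation.Unary.Unique.Propositional.Properties as Unique
open import Data.Maybe using (just; nothing)
open import Data.Maybe.Properties using (just-injective)
open import Data.Nat as ℕ using (ℕ; zero; suc; _<_; _≤_; s≤s; z≤n)
import Data.Nat.Properties as ℕP
open import Data.Product using (Σ; _×_; _,_; proj₁; proj₂)
open import Data.Rational using (ℚ; 0ℚ; 1ℚ; toℚᵘ; fromℚᵘ) renaming (_+_ to _+ℚ_; _*_ to _*ℚ_; -_ to negℚ; _/_ to _/ℚ_)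
import Data.Rational.Properties as ℚP
import Data.Rational.Unnormalised as ℚᵘ
import Data.Rational.Unnormalised.Properties as ℚᵘP
open import Data.Sign as Sign using (Sign)
import Data.Sign.Properties as SignP
open import Data.Sum as Sum using (_⊎_; inj₁; inj₂)
open import Function using (_∘_; Equivalence; mk⇔)
open import Level using (Level)
open import Relation.Binary.Bundles using (Setoid)
open import Relation.Binary.PropositionalEquality as ≡ using (_≡_; _≢_; refl; cong; cong₂)
import Relation.Binary.Reasoning.Setoid as SetoidReasoning
open import Relation.Binary.Structures using (IsEquivalence)
open import Relation.Nullary using (¬_; yes; no)

-- Determinants

-- Blackness of the turns keeps the two boundary paths apart. A turning tile has a corner of degree
-- 2, and the opposite corner, the pivot, has its colour. A white pivot would be the only common
-- neighbour of a black vertex just before the turn on its own path and a black vertex of the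
-- turning tile on the other path, leaving an entry of BBᵀ that nothing cancels. Two features of the
-- statement shape the rest. The vertex list comes from deduplication, in an order unrelated to
-- colours or boundaries, so determinants are taken over lists of points, where permuting rows and
-- columns together is harmless. And a boundary is any list satisfying a predicate, so every
-- traversal has to be identified with one of two constructed paths or its reversal. The snake is
-- built backwards from its end edge, because recursion on the steps peels off the first tile; a new
-- tile then touches the rest along a single edge.

module ListDeterminant {c ℓ : Level} (ring₀ : CommutativeRing c ℓ) (I : Set) where

  open CommutativeRing ring₀ renaming (refl to ≈-refl; sym to ≈-sym; trans to ≈-trans)
  open RingProperties ring
  open SetoidReasoning setoid
  open CSP *-commutativeSemigroup using () renaming (x∙yz≈y∙xz to x*yz≈y*xz; interchange to *-interchange)
  open CSP +-commutativeSemigroup using () renaming (interchange to +-interchange)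

  -- lapl g [c₀, c₁, …] K = Σⱼ (-1)ʲ g cⱼ · K [c₀, …, cⱼ₋₁, cⱼ₊₁, …]: functions of column lists play the role of
  -- exterior powers, lapl g that of the exterior product with g (it anticommutes with lapl h), and the determinant D of
  -- a list of rows that of their product.
  lapl : (I → Carrier) → List I → (List I → Carrier) → Carrier
  lapl g []       K = 0#
  lapl g (c ∷ cs) K = g c * K cs - lapl g cs (λ ds → K (c ∷ ds))

  D : List (I → Carrier) → List I → Carrier
  D []       []       = 1#
  D []       (_ ∷ _)  = 0#
  D (r ∷ rs) cs       = lapl r cs (D rs)

  -‿zero : ∀ {a b} → a ≈ 0# → b ≈ 0# → a - b ≈ 0#
  -‿zero {a} {b} p q = ≈-trans (+-cong p (≈-trans (-‿cong q) -0#≈0#)) (+-identityˡ 0#)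

  *-zero′ : ∀ {a b} → b ≈ 0# → a * b ≈ 0#
  *-zero′ {a} p = ≈-trans (*-congˡ p) (zeroʳ a)

  *-zero″ : ∀ {a b} → a ≈ 0# → a * b ≈ 0#
  *-zero″ {a} {b} p = ≈-trans (*-congʳ p) (zeroˡ b)

  -‿interchange : ∀ a b x y → (a + b) - (x + y) ≈ (a - x) + (b - y)
  -‿interchange a b x y = ≈-trans (+-congˡ (≈-sym (-‿+-comm x y))) (+-interchange a b (- x) (- y))

  *-distribˡ-minus : ∀ a x y → a * (x - y) ≈ a * x - a * y
  *-distribˡ-minus a x y = ≈-trans (distribˡ a x (- y)) (+-congˡ (≈-sym (-‿distribʳ-* a y)))

  *-distribʳ-minus : ∀ a x y → (x - y) * a ≈ x * a - y * a
  *-distribʳ-minus a x y = ≈-trans (distribʳ a x (- y)) (+-congˡ (≈-sym (-‿distribˡ-* y a)))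

  neg-unique : ∀ {a b} → a + b ≈ 0# → a ≈ - b
  neg-unique {a} {b} e = +-inverseˡ-unique a b e

  lapl-cong-∈ : ∀ {g h} cs {K L} → (∀ {i} → i ∈ cs → g i ≈ h i) → (∀ ds → K ds ≈ L ds) →
    lapl g cs K ≈ lapl h cs L
  lapl-cong-∈ []       e f = ≈-refl
  lapl-cong-∈ (c ∷ cs) e f = +-cong (*-cong (e (here ≡.refl)) (f cs))
    (-‿cong (lapl-cong-∈ cs (λ i → e (there i)) (λ ds → f (c ∷ ds))))

  lapl-congʳ : ∀ g cs {K L} → (∀ ds → K ds ≈ L ds) → lapl g cs K ≈ lapl g cs L
  lapl-congʳ g cs = lapl-cong-∈ cs (λ _ → ≈-refl)

  lapl-zeroˡ : ∀ {g} cs {K} → (∀ {i} → i ∈ cs → g i ≈ 0#) → lapl g cs K ≈ 0#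
  lapl-zeroˡ []       e = ≈-refl
  lapl-zeroˡ (c ∷ cs) e = -‿zero (*-zero″ (e (here ≡.refl))) (lapl-zeroˡ cs (λ i → e (there i)))

  lapl-zeroʳ : ∀ g cs {K} → (∀ ds → K ds ≈ 0#) → lapl g cs K ≈ 0#
  lapl-zeroʳ g []       e = ≈-refl
  lapl-zeroʳ g (c ∷ cs) e = -‿zero (*-zero′ (e cs)) (lapl-zeroʳ g cs (λ ds → e (c ∷ ds)))

  lapl-+ˡ : ∀ g h cs K → lapl (λ i → g i + h i) cs K ≈ lapl g cs K + lapl h cs K
  lapl-+ˡ g h []       K = ≈-sym (+-identityˡ 0#)
  lapl-+ˡ g h (c ∷ cs) K = ≈-trans
    (+-cong (distribʳ (K cs) (g c) (h c)) (-‿cong (lapl-+ˡ g h cs (λ ds → K (c ∷ ds)))))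
    (-‿interchange _ _ _ _)

  lapl-*ˡ : ∀ a g cs K → lapl (λ i → a * g i) cs K ≈ a * lapl g cs K
  lapl-*ˡ a g []       K = ≈-sym (zeroʳ a)
  lapl-*ˡ a g (c ∷ cs) K = ≈-trans
    (+-cong (*-assoc a (g c) (K cs)) (-‿cong (lapl-*ˡ a g cs (λ ds → K (c ∷ ds)))))
    (≈-sym (*-distribˡ-minus a _ _))

  lapl-*ʳ : ∀ a g cs K → lapl g cs (λ ds → a * K ds) ≈ a * lapl g cs K
  lapl-*ʳ a g []       K = ≈-sym (zeroʳ a)
  lapl-*ʳ a g (c ∷ cs) K = ≈-trans
    (+-cong (x*yz≈y*xz (g c) a (K cs)) (-‿cong (lapl-*ʳ a g cs (λ ds → K (c ∷ ds)))))
    (≈-sym (*-distribˡ-minus a _ _))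

  lapl-+ʳ : ∀ g cs K L → lapl g cs (λ ds → K ds + L ds) ≈ lapl g cs K + lapl g cs L
  lapl-+ʳ g []       K L = ≈-sym (+-identityˡ 0#)
  lapl-+ʳ g (c ∷ cs) K L = ≈-trans
    (+-cong (distribˡ (g c) (K cs) (L cs)) (-‿cong (lapl-+ʳ g cs (λ ds → K (c ∷ ds)) (λ ds → L (c ∷ ds)))))
    (-‿interchange _ _ _ _)

  lapl-negʳ : ∀ g cs K → lapl g cs (λ ds → - K ds) ≈ - lapl g cs K
  lapl-negʳ g []       K = ≈-sym -0#≈0#
  lapl-negʳ g (c ∷ cs) K = ≈-trans
    (+-cong (≈-sym (-‿distribʳ-* (g c) (K cs))) (-‿cong (lapl-negʳ g cs (λ ds → K (c ∷ ds)))))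
    (-‿+-comm _ _)

  lapl-minusʳ : ∀ g cs K L → lapl g cs (λ ds → K ds - L ds) ≈ lapl g cs K - lapl g cs L
  lapl-minusʳ g cs K L = ≈-trans (lapl-+ʳ g cs K (λ ds → - L ds)) (+-congˡ (lapl-negʳ g cs L))

  -- Sorts the terms by the fate of the column `c`: taken by `g`, taken by `h`, or left for `K`. The
  -- first two carry opposite signs, which is the source of the anticommutation.
  lapl-lapl-∷ : ∀ g h c cs K → lapl g (c ∷ cs) (λ ds → lapl h ds K) ≈
    (g c * lapl h cs (λ ds → K ds) - h c * lapl g cs K)
      + lapl g cs (λ ds → lapl h ds (λ es → K (c ∷ es)))
  lapl-lapl-∷ g h c cs K = begin
    g c * lapl h cs K - lapl g cs (λ ds → h c * K ds - lapl h ds (λ es → K (c ∷ es)))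
      ≈⟨ +-congˡ (-‿cong (≈-trans (lapl-minusʳ g cs _ _) (+-congʳ (lapl-*ʳ (h c) g cs K)))) ⟩
    g c * lapl h cs K - (h c * lapl g cs K - W)
      ≈⟨ +-congˡ (≈-sym (-‿+-comm _ _)) ⟩
    g c * lapl h cs K + (- (h c * lapl g cs K) + - - W)
      ≈⟨ +-congˡ (+-congˡ (-‿involutive W)) ⟩
    g c * lapl h cs K + (- (h c * lapl g cs K) + W)
      ≈⟨ ≈-sym (+-assoc _ _ _) ⟩
    (g c * lapl h cs K - h c * lapl g cs K) + W ∎
    where W = lapl g cs (λ ds → lapl h ds (λ es → K (c ∷ es)))

  -‿antisym : ∀ a b → (a - b) + (b - a) ≈ 0#
  -‿antisym a b = begin
    (a - b) + (b - a)     ≈⟨ +-congˡ (+-comm b (- a)) ⟩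
    (a - b) + (- a + b)   ≈⟨ +-interchange a (- b) (- a) b ⟩
    (a - a) + (- b + b)   ≈⟨ +-cong (-‿inverseʳ a) (-‿inverseˡ b) ⟩
    0# + 0#               ≈⟨ +-identityˡ 0# ⟩
    0# ∎

  lapl-antisym : ∀ g h cs K →
    lapl g cs (λ ds → lapl h ds K) + lapl h cs (λ ds → lapl g ds K) ≈ 0#
  lapl-antisym g h []       K = +-identityˡ 0#
  lapl-antisym g h (c ∷ cs) K = begin
    lapl g (c ∷ cs) (λ ds → lapl h ds K) + lapl h (c ∷ cs) (λ ds → lapl g ds K)
      ≈⟨ +-cong (lapl-lapl-∷ g h c cs K) (lapl-lapl-∷ h g c cs K) ⟩
    _ ≈⟨ +-interchange _ _ _ _ ⟩
    _ ≈⟨ +-cong (-‿antisym _ _) (lapl-antisym g h cs (λ ds → K (c ∷ ds))) ⟩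
    0# + 0#
      ≈⟨ +-identityˡ 0# ⟩
    0# ∎

  lapl-swap : ∀ g h cs K → lapl g cs (λ ds → lapl h ds K) ≈ - lapl h cs (λ ds → lapl g ds K)
  lapl-swap g h cs K = neg-unique (lapl-antisym g h cs K)

  sgn : ∀ {A : Set} {xs ys : List A} → xs ↭ ys → Carrier
  sgn refl         = 1#
  sgn (prep x p)   = sgn p
  sgn (swap x y p) = - sgn p
  sgn (trans p q)  = sgn p * sgn q

  sgn² : ∀ {A : Set} {xs ys : List A} (p : xs ↭ ys) → sgn p * sgn p ≈ 1#
  sgn² refl         = *-identityˡ 1#
  sgn² (prep x p)   = sgn² p
  sgn² (swap x y p) = begin
    - sgn p * - sgn p      ≈⟨ ≈-sym (-‿distribˡ-* (sgn p) (- sgn p)) ⟩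
    - (sgn p * - sgn p)    ≈⟨ -‿cong (≈-sym (-‿distribʳ-* (sgn p) (sgn p))) ⟩
    - - (sgn p * sgn p)    ≈⟨ -‿involutive _ ⟩
    sgn p * sgn p          ≈⟨ sgn² p ⟩
    1# ∎
  sgn² (trans p q)  = begin
    (sgn p * sgn q) * (sgn p * sgn q)  ≈⟨ *-interchange _ _ _ _ ⟩
    (sgn p * sgn p) * (sgn q * sgn q)  ≈⟨ *-cong (sgn² p) (sgn² q) ⟩
    1# * 1#                            ≈⟨ *-identityˡ 1# ⟩
    1# ∎

  Alternating : (List I → Carrier) → Set _
  Alternating K = ∀ {cs ds} (p : cs ↭ ds) → K cs ≈ sgn p * K ds

  *-neg-swap : ∀ s a b → s * (a - b) ≈ - s * (b - a)
  *-neg-swap s a b = begin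
    s * (a - b)         ≈⟨ *-congˡ (neg-unique (-‿antisym a b)) ⟩
    s * - (b - a)       ≈⟨ ≈-sym (-‿distribʳ-* s _) ⟩
    - (s * (b - a))     ≈⟨ -‿distribˡ-* s _ ⟩
    - s * (b - a) ∎

  -- The induction is on the derivation for all `K`, since passing a column `c` replaces `K` by
  -- `K (c ∷ _)`. In the swap case the terms that delete `x` or `y` trade places, and the remaining
  -- ones inherit the sign from `K`.
  lapl-alternating : ∀ g {K} → Alternating K → Alternating (λ cs → lapl g cs K)
  lapl-alternating g alt refl = ≈-sym (*-identityˡ _)
  lapl-alternating g {K} alt {c ∷ cs} {c ∷ ds} (prep c p) = begin
    g c * K cs - lapl g cs (λ es → K (c ∷ es))
      ≈⟨ +-cong (≈-trans (*-congˡ (alt p)) (x*yz≈y*xz (g c) (sgn p) (K ds)))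
                (-‿cong (lapl-alternating g (λ q → alt (prep c q)) p)) ⟩
    sgn p * (g c * K ds) - sgn p * lapl g ds (λ es → K (c ∷ es))
      ≈⟨ ≈-sym (*-distribˡ-minus (sgn p) _ _) ⟩
    sgn p * (g c * K ds - lapl g ds (λ es → K (c ∷ es))) ∎
  lapl-alternating g {K} alt {x ∷ y ∷ cs} {y ∷ x ∷ ds} (swap x y p) = begin
    g x * K (y ∷ cs) - (g y * K (x ∷ cs) - W cs x y)
      ≈⟨ rearrange (g x * K (y ∷ cs)) (g y * K (x ∷ cs)) (W cs x y) ⟩
    (g x * K (y ∷ cs) - g y * K (x ∷ cs)) + W cs x y
      ≈⟨ +-cong (+-cong (pull (g x) (prep y p)) (-‿cong (pull (g y) (prep x p)))) W-swap ⟩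
    (sgn p * (g x * K (y ∷ ds)) - sgn p * (g y * K (x ∷ ds))) + - sgn p * W ds y x
      ≈⟨ +-congʳ (≈-trans (≈-sym (*-distribˡ-minus (sgn p) _ _)) (*-neg-swap (sgn p) _ _)) ⟩
    - sgn p * (g y * K (x ∷ ds) - g x * K (y ∷ ds)) + - sgn p * W ds y x
      ≈⟨ ≈-sym (distribˡ (- sgn p) _ _) ⟩
    - sgn p * ((g y * K (x ∷ ds) - g x * K (y ∷ ds)) + W ds y x)
      ≈⟨ *-congˡ (≈-sym (rearrange (g y * K (x ∷ ds)) (g x * K (y ∷ ds)) (W ds y x))) ⟩
    - sgn p * (g y * K (x ∷ ds) - (g x * K (y ∷ ds) - W ds y x)) ∎
    where
    W : List I → I → I → Carrier
    W es u v = lapl g es (λ fs → K (u ∷ v ∷ fs))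
    rearrange : ∀ a b w → a - (b - w) ≈ (a - b) + w
    rearrange a b w = begin
      a - (b - w)         ≈⟨ +-congˡ (≈-sym (-‿+-comm b (- w))) ⟩
      a + (- b + - - w)   ≈⟨ +-congˡ (+-congˡ (-‿involutive w)) ⟩
      a + (- b + w)       ≈⟨ ≈-sym (+-assoc a (- b) w) ⟩
      (a - b) + w ∎
    pull : ∀ a {es fs} (q : es ↭ fs) → a * K es ≈ sgn q * (a * K fs)
    pull a {fs = fs} q = ≈-trans (*-congˡ (alt q)) (x*yz≈y*xz a (sgn q) (K fs))
    W-swap : W cs x y ≈ - sgn p * W ds y x
    W-swap = begin
      lapl g cs (λ fs → K (x ∷ y ∷ fs))
        ≈⟨ lapl-alternating g (λ q → alt (prep x (prep y q))) p ⟩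
      sgn p * lapl g ds (λ fs → K (x ∷ y ∷ fs))
        ≈⟨ *-congˡ (lapl-congʳ g ds (λ fs → ≈-trans (alt (swap x y refl))
             (≈-trans (≈-sym (-‿distribˡ-* 1# _)) (-‿cong (*-identityˡ _))))) ⟩
      sgn p * lapl g ds (λ fs → - K (y ∷ x ∷ fs))
        ≈⟨ *-congˡ (lapl-negʳ g ds _) ⟩
      sgn p * - W ds y x
        ≈⟨ ≈-trans (≈-sym (-‿distribʳ-* (sgn p) _)) (-‿distribˡ-* (sgn p) _) ⟩
      - sgn p * W ds y x ∎
  lapl-alternating g alt (trans p q) = ≈-trans (lapl-alternating g alt p)
    (≈-trans (*-congˡ (lapl-alternating g alt q)) (≈-sym (*-assoc _ _ _)))

  D-alternating : ∀ rs → Alternating (D rs)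
  D-alternating []       refl         = ≈-sym (*-identityˡ _)
  D-alternating []       (prep x p)   = ≈-sym (zeroʳ _)
  D-alternating []       (swap x y p) = ≈-sym (zeroʳ _)
  D-alternating []       (trans p q)  = ≈-trans (D-alternating [] p)
    (≈-trans (*-congˡ (D-alternating [] q)) (≈-sym (*-assoc _ _ _)))
  D-alternating (r ∷ rs) p            = lapl-alternating r (D-alternating rs) p

  D-rows : ∀ (f : I → I → Carrier) {xs ys} (p : xs ↭ ys) cs → D (map f xs) cs ≈ sgn p * D (map f ys) cs
  D-rows f refl cs = ≈-sym (*-identityˡ _)
  D-rows f {x ∷ xs} {x ∷ ys} (prep x p) cs =
    ≈-trans (lapl-congʳ (f x) cs (D-rows f p)) (lapl-*ʳ (sgn p) (f x) cs (D (map f ys)))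
  D-rows f {x ∷ y ∷ xs} {y ∷ x ∷ ys} (swap x y p) cs = begin
    lapl (f x) cs (λ ds → lapl (f y) ds (D (map f xs)))
      ≈⟨ lapl-congʳ (f x) cs (λ ds → ≈-trans (lapl-congʳ (f y) ds (D-rows f p)) (lapl-*ʳ (sgn p) (f y) ds _)) ⟩
    lapl (f x) cs (λ ds → sgn p * lapl (f y) ds (D (map f ys)))
      ≈⟨ lapl-*ʳ (sgn p) (f x) cs _ ⟩
    sgn p * lapl (f x) cs (λ ds → lapl (f y) ds (D (map f ys)))
      ≈⟨ *-congˡ (lapl-swap (f x) (f y) cs _) ⟩
    sgn p * - lapl (f y) cs (λ ds → lapl (f x) ds (D (map f ys)))
      ≈⟨ ≈-trans (≈-sym (-‿distribʳ-* (sgn p) _)) (-‿distribˡ-* (sgn p) _) ⟩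
    - sgn p * lapl (f y) cs (λ ds → lapl (f x) ds (D (map f ys))) ∎
  D-rows f (trans p q) cs = ≈-trans (D-rows f p cs)
    (≈-trans (*-congˡ (D-rows f q cs)) (≈-sym (*-assoc _ _ _)))

  D-↭ : ∀ (f : I → I → Carrier) {xs ys} → xs ↭ ys → D (map f xs) xs ≈ D (map f ys) ys
  D-↭ f {xs} {ys} p = begin
    D (map f xs) xs                      ≈⟨ D-rows f p xs ⟩
    sgn p * D (map f ys) xs              ≈⟨ *-congˡ (D-alternating (map f ys) p) ⟩
    sgn p * (sgn p * D (map f ys) ys)    ≈⟨ ≈-sym (*-assoc _ _ _) ⟩
    (sgn p * sgn p) * D (map f ys) ys    ≈⟨ *-congʳ (sgn² p) ⟩
    1# * D (map f ys) ys                 ≈⟨ *-identityˡ _ ⟩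
    D (map f ys) ys ∎

  -- `K` is only ever evaluated on sublists of `cs`; this lets `D-cong` compare entries at the
  -- listed rows and columns alone.
  lapl-cong-⊆ : ∀ {g h} cs {K L} → (∀ {i} → i ∈ cs → g i ≈ h i) → (∀ ds → ds ⊆ cs → K ds ≈ L ds) →
    lapl g cs K ≈ lapl h cs L
  lapl-cong-⊆ []       e f = ≈-refl
  lapl-cong-⊆ (c ∷ cs) e f = +-cong (*-cong (e (here ≡.refl)) (f cs there))
    (-‿cong (lapl-cong-⊆ cs (λ i → e (there i))
      (λ ds sub → f (c ∷ ds) (λ { (here p) → here p ; (there i) → there (sub i) }))))

  D-cong : ∀ {f g : I → I → Carrier} xs cs → (∀ {x c} → x ∈ xs → c ∈ cs → f x c ≈ g x c) →
    D (map f xs) cs ≈ D (map g xs) cs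
  D-cong []       []      e = ≈-refl
  D-cong []       (_ ∷ _) e = ≈-refl
  D-cong (x ∷ xs) cs      e = lapl-cong-⊆ cs (e (here ≡.refl))
    (λ ds sub → D-cong xs ds (λ i j → e (there i) (sub j)))

  -- Since `g` vanishes on `cs₂`, every surviving term deletes a column of `cs₁`. The factorisation
  -- of `K` is assumed only for the length `n` left after one deletion, because it comes from a
  -- square block.
  lapl-block : ∀ n g cs₁ cs₂ {K K₁ z} → (∀ {i} → i ∈ cs₂ → g i ≈ 0#) → length cs₁ ≡ suc n →
    (∀ ds → length ds ≡ n → K (ds ++ cs₂) ≈ K₁ ds * z) → lapl g (cs₁ ++ cs₂) K ≈ lapl g cs₁ K₁ * z
  lapl-block zero g (c ∷ []) cs₂ {K} {K₁} {z} g0 len e = begin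
    g c * K cs₂ - lapl g cs₂ _
      ≈⟨ +-cong (≈-trans (*-congˡ (e [] ≡.refl)) (≈-sym (*-assoc (g c) (K₁ []) z)))
                (-‿cong (≈-trans (lapl-zeroˡ cs₂ g0) (≈-sym (zeroˡ z)))) ⟩
    (g c * K₁ []) * z - 0# * z   ≈⟨ ≈-sym (*-distribʳ-minus z _ _) ⟩
    (g c * K₁ [] - 0#) * z       ∎
  lapl-block (suc n) g (c ∷ cs₁) cs₂ {K} {K₁} {z} g0 len e = begin
    g c * K (cs₁ ++ cs₂) - lapl g (cs₁ ++ cs₂) (λ ds → K (c ∷ ds))
      ≈⟨ +-cong (≈-trans (*-congˡ (e cs₁ (ℕP.suc-injective len))) (≈-sym (*-assoc (g c) (K₁ cs₁) z)))
                (-‿cong (lapl-block n g cs₁ cs₂ {λ ds → K (c ∷ ds)} g0 (ℕP.suc-injective len)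
                          (λ ds l → e (c ∷ ds) (≡.cong suc l)))) ⟩
    (g c * K₁ cs₁) * z - lapl g cs₁ (λ ds → K₁ (c ∷ ds)) * z  ≈⟨ ≈-sym (*-distribʳ-minus z _ _) ⟩
    (g c * K₁ cs₁ - lapl g cs₁ (λ ds → K₁ (c ∷ ds))) * z      ∎

  D-block : ∀ rs₁ rs₂ cs₁ cs₂ → length rs₁ ≡ length cs₁ →
    (∀ {r} → r ∈ rs₁ → ∀ {i} → i ∈ cs₂ → r i ≈ 0#) →
    D (rs₁ ++ rs₂) (cs₁ ++ cs₂) ≈ D rs₁ cs₁ * D rs₂ cs₂
  D-block []        rs₂ []  cs₂ len z = ≈-sym (*-identityˡ _)
  D-block (r ∷ rs₁) rs₂ cs₁ cs₂ len z = lapl-block (length rs₁) r cs₁ cs₂ (z (here ≡.refl)) (≡.sym len)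
    (λ ds l → D-block rs₁ rs₂ ds cs₂ (≡.sym l) (λ i → z (there i)))

  pow : Carrier → ℕ → Carrier
  pow t zero    = 1#
  pow t (suc n) = t * pow t n

  sumL : ∀ {A : Set} → (A → Carrier) → List A → Carrier
  sumL f []       = 0#
  sumL f (x ∷ xs) = f x + sumL f xs

  sumL-cong : ∀ {A : Set} {f g : A → Carrier} xs → (∀ {x} → x ∈ xs → f x ≈ g x) → sumL f xs ≈ sumL g xs
  sumL-cong []       e = ≈-refl
  sumL-cong (x ∷ xs) e = +-cong (e (here ≡.refl)) (sumL-cong xs (λ i → e (there i)))

  -- In exterior terms `g ∧ K = 0`: adding a multiple of `g` to a row placed in front of `K` changes
  -- nothing.
  Kills : (I → Carrier) → (List I → Carrier) → Set _
  Kills g K = ∀ cs → lapl g cs K ≈ 0#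

  kills-lapl : ∀ g h {K} → Kills g K → Kills g (λ cs → lapl h cs K)
  kills-lapl g h {K} k cs = begin
    lapl g cs (λ ds → lapl h ds K)     ≈⟨ lapl-swap g h cs K ⟩
    - lapl h cs (λ ds → lapl g ds K)   ≈⟨ -‿cong (lapl-zeroʳ h cs k) ⟩
    - 0#                               ≈⟨ -0#≈0# ⟩
    0# ∎

  -- Antisymmetry gives only that twice this is zero, which is too weak in an arbitrary ring;
  -- expanding at the first column makes the two leading terms cancel outright.
  kills-self : ∀ g K → Kills g (λ cs → lapl g cs K)
  kills-self g K []       = ≈-refl
  kills-self g K (c ∷ cs) = begin
    lapl g (c ∷ cs) (λ ds → lapl g ds K)  ≈⟨ lapl-lapl-∷ g g c cs K ⟩
    (g c * lapl g cs K - g c * lapl g cs K) + lapl g cs (λ ds → lapl g ds (λ es → K (c ∷ es)))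
      ≈⟨ +-cong (-‿inverseʳ _) (kills-self g (λ es → K (c ∷ es)) cs) ⟩
    0# + 0#                               ≈⟨ +-identityˡ 0# ⟩
    0# ∎

  kills-sum : ∀ {A : Set} (β : A → Carrier) (s : A → I → Carrier) ws {K} →
    (∀ {w} → w ∈ ws → Kills (s w) K) → Kills (λ i → sumL (λ w → β w * s w i) ws) K
  kills-sum β s []       k cs = lapl-zeroˡ cs (λ _ → ≈-refl)
  kills-sum β s (w ∷ ws) {K} k cs = begin
    lapl (λ i → β w * s w i + sumL (λ v → β v * s v i) ws) cs K
      ≈⟨ lapl-+ˡ _ _ cs K ⟩
    lapl (λ i → β w * s w i) cs K + lapl (λ i → sumL (λ v → β v * s v i) ws) cs K
      ≈⟨ +-cong (≈-trans (lapl-*ˡ (β w) (s w) cs K) (*-zero′ (k (here ≡.refl) cs)))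
                (kills-sum β s ws (λ i → k (there i)) cs) ⟩
    0# + 0# ≈⟨ +-identityˡ 0# ⟩
    0# ∎

  kills-D : ∀ {A : Set} (s : A → I → Carrier) {w ws} → w ∈ ws → Kills (s w) (D (map s ws))
  kills-D s {ws = w ∷ ws} (here ≡.refl) = kills-self (s w) (D (map s ws))
  kills-D s {ws = v ∷ ws} (there i)     = kills-lapl (s _) (s v) (kills-D s i)

  -- Each `h b` is killed by the rows `S` at the bottom, and still is with the unmodified rows `r`
  -- in between; all that remains of the change to row `b` is the factor `t`.
  D-rowops : ∀ t (r h : I → I → Carrier) S bs → (∀ {b} → b ∈ bs → Kills (h b) (D S)) → ∀ cs →
    D (map (λ b i → t * r b i + h b i) bs ++ S) cs ≈ pow t (length bs) * D (map r bs ++ S) cs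
  D-rowops t r h S []       k cs = ≈-sym (*-identityˡ _)
  D-rowops t r h S (b ∷ bs) k cs = begin
    lapl (λ i → t * r b i + h b i) cs (D (map (λ b i → t * r b i + h b i) bs ++ S))
      ≈⟨ lapl-congʳ _ cs (D-rowops t r h S bs (λ i → k (there i))) ⟩
    lapl (λ i → t * r b i + h b i) cs (λ ds → pow t (length bs) * E ds)
      ≈⟨ lapl-*ʳ _ _ cs E ⟩
    pow t (length bs) * lapl (λ i → t * r b i + h b i) cs E
      ≈⟨ *-congˡ (lapl-+ˡ _ (h b) cs E) ⟩
    pow t (length bs) * (lapl (λ i → t * r b i) cs E + lapl (h b) cs E)
      ≈⟨ *-congˡ (≈-trans (+-cong (lapl-*ˡ t (r b) cs E) (extend bs cs)) (+-identityʳ _)) ⟩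
    pow t (length bs) * (t * lapl (r b) cs E)
      ≈⟨ x*yz≈y*xz _ t _ ⟩
    t * (pow t (length bs) * lapl (r b) cs E)
      ≈⟨ ≈-sym (*-assoc t _ _) ⟩
    (t * pow t (length bs)) * lapl (r b) cs E ∎
    where
    E = D (map r bs ++ S)
    extend : ∀ as → Kills (h b) (D (map r as ++ S))
    extend []       = k (here ≡.refl)
    extend (a ∷ as) = kills-lapl (h b) (r a) (extend as)

  -- No row can use the column `x`, so it is left over when the rows run out, and `D [] (_ ∷ _)` is
  -- zero.
  D-zero-column : ∀ (f : I → I → Carrier) x zs ds → (∀ {z} → z ∈ zs → f z x ≈ 0#) → D (map f zs) (x ∷ ds) ≈ 0#
  D-zero-column f x []       ds e = ≈-refl
  D-zero-column f x (z ∷ zs) ds e = -‿zero (*-zero″ (e (here ≡.refl)))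
    (lapl-zeroʳ (f z) ds (λ es → D-zero-column f x zs es (λ i → e (there i))))

  D-single : ∀ (f : I → I → Carrier) x zs → (∀ {z} → z ∈ zs → f x z ≈ 0#) →
    D (map f (x ∷ zs)) (x ∷ zs) ≈ f x x * D (map f zs) zs
  D-single f x zs e = ≈-trans (+-congˡ (≈-trans (-‿cong (lapl-zeroˡ zs e)) -0#≈0#)) (+-identityʳ _)

  -- The three-term recursion of continuants; `D-zero-column` removes the terms in which row `y`
  -- passes over the column `x`.
  D-tridiagonal : ∀ (f : I → I → Carrier) x y zs →
    (∀ {z} → z ∈ zs → f x z ≈ 0#) → (∀ {z} → z ∈ zs → f z x ≈ 0#) →
    D (map f (x ∷ y ∷ zs)) (x ∷ y ∷ zs) ≈
      f x x * D (map f (y ∷ zs)) (y ∷ zs) - (f x y * f y x) * D (map f zs) zs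
  D-tridiagonal f x y zs e e′ = +-congˡ (-‿cong (begin
    f x y * lapl (f y) (x ∷ zs) (D (map f zs)) - lapl (f x) zs _
      ≈⟨ +-congˡ (≈-trans (-‿cong (lapl-zeroˡ zs e)) -0#≈0#) ⟩
    f x y * lapl (f y) (x ∷ zs) (D (map f zs)) + 0#
      ≈⟨ +-identityʳ _ ⟩
    f x y * (f y x * D (map f zs) zs - lapl (f y) zs (λ ds → D (map f zs) (x ∷ ds)))
      ≈⟨ *-congˡ (≈-trans (+-congˡ (≈-trans (-‿cong
           (lapl-zeroʳ (f y) zs (λ ds → D-zero-column f x zs ds e′))) -0#≈0#)) (+-identityʳ _)) ⟩
    f x y * (f y x * D (map f zs) zs)
      ≈⟨ ≈-sym (*-assoc _ _ _) ⟩
    (f x y * f y x) * D (map f zs) zs ∎))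

  D-diagonal : ∀ (f : I → I → Carrier) t {ws} → AllPairs (λ v w → f v w ≈ 0#) ws →
    (∀ {w} → w ∈ ws → f w w ≈ t) → D (map f ws) ws ≈ pow t (length ws)
  D-diagonal f t []                d = ≈-refl
  D-diagonal f t (_∷_ {w} {ws} z zs) d = ≈-trans (D-single f w ws (All.lookup z))
    (*-cong (d (here ≡.refl)) (D-diagonal f t zs (λ i → d (there i))))

  module _ (φ : Carrier → Carrier) (φ-0 : φ 0# ≈ 0#) (φ-1 : φ 1# ≈ 1#)
           (φ-minus : ∀ a b → φ (a - b) ≈ φ a - φ b) (φ-* : ∀ a b → φ (a * b) ≈ φ a * φ b) where

    lapl-hom : ∀ g cs K → φ (lapl g cs K) ≈ lapl (λ i → φ (g i)) cs (λ ds → φ (K ds))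
    lapl-hom g []       K = φ-0
    lapl-hom g (c ∷ cs) K = ≈-trans (φ-minus _ _)
      (+-cong (φ-* (g c) (K cs)) (-‿cong (lapl-hom g cs (λ ds → K (c ∷ ds)))))

    -- Applied to the substitution of t² for the variable, which therefore passes through
    -- characteristic polynomials entry by entry.
    D-hom : ∀ (f : I → I → Carrier) xs cs → φ (D (map f xs) cs) ≈ D (map (λ x i → φ (f x i)) xs) cs
    D-hom f []       []      = φ-1
    D-hom f []       (_ ∷ _) = φ-0
    D-hom f (x ∷ xs) cs      = ≈-trans (lapl-hom (f x) cs (D (map f xs)))
      (lapl-congʳ (λ i → φ (f x i)) cs (D-hom f xs))

-- Polynomials

-- A record wrapper: _≈P_ unfolds to a function type, from which Agda cannot infer the polynomials.
infix 4 _≋_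
record _≋_ (p q : Poly) : Set where
  constructor mk
  field at : p ≈P q
open _≋_ public

≋-isEquivalence : IsEquivalence _≋_
≋-isEquivalence = record
  { refl  = mk λ n → refl
  ; sym   = λ e → mk λ n → ≡.sym (at e n)
  ; trans = λ e f → mk λ n → ≡.trans (at e n) (at f n) }

polySetoid : Setoid _ _
polySetoid = record { isEquivalence = ≋-isEquivalence }

open IsEquivalence ≋-isEquivalence public using ()
  renaming (refl to ≋-refl; sym to ≋-sym; trans to ≋-trans; reflexive to ≋-reflexive)

coeff-+ : ∀ p q n → coeff (p +P q) n ≡ coeff p n +ℚ coeff q n
coeff-+ []      q       n       = ≡.sym (ℚP.+-identityˡ (coeff q n))
coeff-+ (a ∷ p) []      n       = ≡.sym (ℚP.+-identityʳ (coeff (a ∷ p) n))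
coeff-+ (a ∷ p) (b ∷ q) zero    = refl
coeff-+ (a ∷ p) (b ∷ q) (suc n) = coeff-+ p q n

coeff-· : ∀ a p n → coeff (a ·P p) n ≡ a *ℚ coeff p n
coeff-· a []      n       = ≡.sym (ℚP.*-zeroʳ a)
coeff-· a (b ∷ p) zero    = refl
coeff-· a (b ∷ p) (suc n) = coeff-· a p n

coeff-neg : ∀ p n → coeff (negP p) n ≡ negℚ (coeff p n)
coeff-neg []      n       = refl
coeff-neg (a ∷ p) zero    = refl
coeff-neg (a ∷ p) (suc n) = coeff-neg p n

∷-cong : ∀ {a b p q} → a ≡ b → p ≋ q → (a ∷ p) ≋ (b ∷ q)
∷-cong e f = mk λ { zero → e ; (suc n) → at f n }

tail-≋ : ∀ {a b p q} → (a ∷ p) ≋ (b ∷ q) → p ≋ q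
tail-≋ e = mk λ n → at e (suc n)

0∷[] : (0ℚ ∷ []) ≋ []
0∷[] = mk λ { zero → refl ; (suc n) → refl }

+-cong : ∀ {p p′ q q′} → p ≋ p′ → q ≋ q′ → (p +P q) ≋ (p′ +P q′)
+-cong {p} {p′} {q} {q′} e f = mk λ n →
  ≡.trans (coeff-+ p q n) (≡.trans (cong₂ _+ℚ_ (at e n) (at f n)) (≡.sym (coeff-+ p′ q′ n)))

+-congˡ : ∀ p {q q′} → q ≋ q′ → (p +P q) ≋ (p +P q′)
+-congˡ p {q} {q′} e = +-cong {p} {p} {q} {q′} ≋-refl e

+-congʳ : ∀ q {p p′} → p ≋ p′ → (p +P q) ≋ (p′ +P q)
+-congʳ q {p} {p′} e = +-cong {p} {p′} {q} {q} e ≋-refl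

+-assoc : ∀ p q r → ((p +P q) +P r) ≋ (p +P (q +P r))
+-assoc p q r = mk λ n → begin
  coeff ((p +P q) +P r) n                  ≡⟨ coeff-+ (p +P q) r n ⟩
  coeff (p +P q) n +ℚ coeff r n            ≡⟨ cong (_+ℚ coeff r n) (coeff-+ p q n) ⟩
  (coeff p n +ℚ coeff q n) +ℚ coeff r n    ≡⟨ ℚP.+-assoc (coeff p n) (coeff q n) (coeff r n) ⟩
  coeff p n +ℚ (coeff q n +ℚ coeff r n)    ≡⟨ cong (coeff p n +ℚ_) (≡.sym (coeff-+ q r n)) ⟩
  coeff p n +ℚ coeff (q +P r) n            ≡⟨ ≡.sym (coeff-+ p (q +P r) n) ⟩
  coeff (p +P (q +P r)) n                  ∎
  where open ≡.≡-Reasoning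

+-comm : ∀ p q → (p +P q) ≋ (q +P p)
+-comm p q = mk λ n →
  ≡.trans (coeff-+ p q n) (≡.trans (ℚP.+-comm (coeff p n) (coeff q n)) (≡.sym (coeff-+ q p n)))

+-identityʳ : ∀ p → (p +P 0P) ≋ p
+-identityʳ p = +-comm p 0P

neg-cong : ∀ {p q} → p ≋ q → negP p ≋ negP q
neg-cong {p} {q} e = mk λ n →
  ≡.trans (coeff-neg p n) (≡.trans (cong negℚ (at e n)) (≡.sym (coeff-neg q n)))

+-inverseˡ : ∀ p → (negP p +P p) ≋ 0P
+-inverseˡ p = mk λ n → ≡.trans (coeff-+ (negP p) p n)
  (≡.trans (cong (_+ℚ coeff p n) (coeff-neg p n)) (ℚP.+-inverseˡ (coeff p n)))

·-cong : ∀ {a b p q} → a ≡ b → p ≋ q → (a ·P p) ≋ (b ·P q)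
·-cong {a} {b} {p} {q} refl f = mk λ n →
  ≡.trans (coeff-· a p n) (≡.trans (cong (a *ℚ_) (at f n)) (≡.sym (coeff-· a q n)))

·-zeroˡ : ∀ p → (0ℚ ·P p) ≋ 0P
·-zeroˡ p = mk λ n → ≡.trans (coeff-· 0ℚ p n) (ℚP.*-zeroˡ (coeff p n))

·-identity : ∀ p → (1ℚ ·P p) ≋ p
·-identity p = mk λ n → ≡.trans (coeff-· 1ℚ p n) (ℚP.*-identityˡ (coeff p n))

·-assoc : ∀ a b p → ((a *ℚ b) ·P p) ≋ (a ·P (b ·P p))
·-assoc a b p = mk λ n → ≡.trans (coeff-· (a *ℚ b) p n) (≡.trans (ℚP.*-assoc a b (coeff p n))
  (≡.trans (cong (a *ℚ_) (≡.sym (coeff-· b p n))) (≡.sym (coeff-· a (b ·P p) n))))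

·-distribˡ : ∀ a p q → (a ·P (p +P q)) ≋ ((a ·P p) +P (a ·P q))
·-distribˡ a p q = mk λ n → begin
  coeff (a ·P (p +P q)) n                    ≡⟨ coeff-· a (p +P q) n ⟩
  a *ℚ coeff (p +P q) n                      ≡⟨ cong (a *ℚ_) (coeff-+ p q n) ⟩
  a *ℚ (coeff p n +ℚ coeff q n)              ≡⟨ ℚP.*-distribˡ-+ a (coeff p n) (coeff q n) ⟩
  a *ℚ coeff p n +ℚ a *ℚ coeff q n           ≡⟨ cong₂ _+ℚ_ (≡.sym (coeff-· a p n)) (≡.sym (coeff-· a q n)) ⟩
  coeff (a ·P p) n +ℚ coeff (a ·P q) n       ≡⟨ ≡.sym (coeff-+ (a ·P p) (a ·P q) n) ⟩
  coeff ((a ·P p) +P (a ·P q)) n             ∎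
  where open ≡.≡-Reasoning

module ≋-R = SetoidReasoning polySetoid

+-interchange : ∀ p q r s → ((p +P q) +P (r +P s)) ≋ ((p +P r) +P (q +P s))
+-interchange p q r s = begin
  (p +P q) +P (r +P s)   ≈⟨ +-assoc p q (r +P s) ⟩
  p +P (q +P (r +P s))   ≈⟨ +-congˡ p (≋-sym (+-assoc q r s)) ⟩
  p +P ((q +P r) +P s)   ≈⟨ +-congˡ p (+-congʳ s (+-comm q r)) ⟩
  p +P ((r +P q) +P s)   ≈⟨ +-congˡ p (+-assoc r q s) ⟩
  p +P (r +P (q +P s))   ≈⟨ ≋-sym (+-assoc p r (q +P s)) ⟩
  (p +P r) +P (q +P s)   ∎
  where open ≋-R

*-zeroʳ : ∀ p → (p *P 0P) ≋ 0P
*-zeroʳ []      = ≋-refl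
*-zeroʳ (a ∷ p) = ≋-trans (∷-cong refl (*-zeroʳ p)) 0∷[]

*-congˡ : ∀ p {q q′} → q ≋ q′ → (p *P q) ≋ (p *P q′)
*-congˡ []      e = ≋-refl
*-congˡ (a ∷ p) e = +-cong (·-cong {a} refl e) (∷-cong refl (*-congˡ p e))

*-comm-∷ : ∀ p b q → (p *P (b ∷ q)) ≋ ((b ·P p) +P (0ℚ ∷ (p *P q)))
*-comm-∷ []      b q = ≋-sym 0∷[]
*-comm-∷ (a ∷ p) b q = ∷-cong (cong (_+ℚ 0ℚ) (ℚP.*-comm a b)) (begin
  (a ·P q) +P (p *P (b ∷ q))                  ≈⟨ +-congˡ (a ·P q) (*-comm-∷ p b q) ⟩
  (a ·P q) +P ((b ·P p) +P (0ℚ ∷ (p *P q)))   ≈⟨ ≋-sym (+-assoc (a ·P q) (b ·P p) _) ⟩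
  ((a ·P q) +P (b ·P p)) +P (0ℚ ∷ (p *P q))   ≈⟨ +-congʳ (0ℚ ∷ (p *P q)) (+-comm (a ·P q) (b ·P p)) ⟩
  ((b ·P p) +P (a ·P q)) +P (0ℚ ∷ (p *P q))   ≈⟨ +-assoc (b ·P p) (a ·P q) _ ⟩
  (b ·P p) +P ((a ·P q) +P (0ℚ ∷ (p *P q)))   ∎)
  where open ≋-R

*-comm : ∀ p q → (p *P q) ≋ (q *P p)
*-comm []      q = ≋-sym (*-zeroʳ q)
*-comm (a ∷ p) q = ≋-trans (+-congˡ (a ·P q) (∷-cong refl (*-comm p q))) (≋-sym (*-comm-∷ q a p))

*-cong : ∀ {p p′ q q′} → p ≋ p′ → q ≋ q′ → (p *P q) ≋ (p′ *P q′)
*-cong {p} {p′} {q} {q′} e f = begin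
  p *P q    ≈⟨ *-congˡ p f ⟩
  p *P q′   ≈⟨ *-comm p q′ ⟩
  q′ *P p   ≈⟨ *-congˡ q′ e ⟩
  q′ *P p′  ≈⟨ *-comm q′ p′ ⟩
  p′ *P q′  ∎
  where open ≋-R

*-distribˡ : ∀ p q r → (p *P (q +P r)) ≋ ((p *P q) +P (p *P r))
*-distribˡ []      q r = ≋-refl
*-distribˡ (a ∷ p) q r = ≋-trans
  (+-cong (·-distribˡ a q r) (∷-cong (≡.sym (ℚP.+-identityˡ 0ℚ)) (*-distribˡ p q r)))
  (+-interchange (a ·P q) (a ·P r) (0ℚ ∷ (p *P q)) (0ℚ ∷ (p *P r)))

*-distribʳ : ∀ r p q → ((p +P q) *P r) ≋ ((p *P r) +P (q *P r))
*-distribʳ r p q = ≋-trans (*-comm (p +P q) r)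
  (≋-trans (*-distribˡ r p q) (+-cong (*-comm r p) (*-comm r q)))

·-*-assoc : ∀ a p q → ((a ·P p) *P q) ≋ (a ·P (p *P q))
·-*-assoc a []      q = ≋-refl
·-*-assoc a (b ∷ p) q = ≋-trans
  (+-cong (·-assoc a b q) (∷-cong (≡.sym (ℚP.*-zeroʳ a)) (·-*-assoc a p q)))
  (≋-sym (·-distribˡ a (b ·P q) (0ℚ ∷ (p *P q))))

0∷-* : ∀ p q → ((0ℚ ∷ p) *P q) ≋ (0ℚ ∷ (p *P q))
0∷-* p q = +-congʳ (0ℚ ∷ (p *P q)) (·-zeroˡ q)

*-assoc : ∀ p q r → ((p *P q) *P r) ≋ (p *P (q *P r))
*-assoc []      q r = ≋-refl
*-assoc (a ∷ p) q r = begin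
  ((a ·P q) +P (0ℚ ∷ (p *P q))) *P r               ≈⟨ *-distribʳ r (a ·P q) _ ⟩
  ((a ·P q) *P r) +P ((0ℚ ∷ (p *P q)) *P r)        ≈⟨ +-cong (·-*-assoc a q r) (0∷-* (p *P q) r) ⟩
  (a ·P (q *P r)) +P (0ℚ ∷ ((p *P q) *P r))        ≈⟨ +-congˡ (a ·P (q *P r)) (∷-cong refl (*-assoc p q r)) ⟩
  (a ·P (q *P r)) +P (0ℚ ∷ (p *P (q *P r)))        ∎
  where open ≋-R

constP-* : ∀ a p → (constP a *P p) ≋ (a ·P p)
constP-* a p = ≋-trans (+-congˡ (a ·P p) 0∷[]) (+-identityʳ (a ·P p))

*-identityˡ : ∀ p → (1P *P p) ≋ p
*-identityˡ p = ≋-trans (constP-* 1ℚ p) (·-identity p)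

polyRing : CommutativeRing _ _
polyRing = record
  { Carrier = Poly ; _≈_ = _≋_ ; _+_ = _+P_ ; _*_ = _*P_ ; -_ = negP ; 0# = 0P ; 1# = 1P
  ; isCommutativeRing = record
    { isRing = record
      { +-isAbelianGroup = record
        { isGroup = record
          { isMonoid = record
            { isSemigroup = record
              { isMagma = record { isEquivalence = ≋-isEquivalence ; ∙-cong = +-cong }
              ; assoc = +-assoc }
            ; identity = (λ p → ≋-refl) , +-identityʳ }
          ; inverse = +-inverseˡ , (λ p → ≋-trans (+-comm p (negP p)) (+-inverseˡ p))
          ; ⁻¹-cong = neg-cong }
        ; comm = +-comm }
      ; *-cong = *-cong
      ; *-assoc = *-assoc
      ; *-identity = *-identityˡ , (λ p → ≋-trans (*-comm p 1P) (*-identityˡ p))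
      ; distrib = *-distribˡ , *-distribʳ }
    ; *-comm = *-comm } }

X-* : ∀ p → (X *P p) ≋ (0ℚ ∷ p)
X-* p = ≋-trans (0∷-* 1P p) (∷-cong refl (*-identityˡ p))

-- Multiplication by `X` shifts the coefficients, so powers of t cancel without a theory of
-- polynomial division.
X-cancel : ∀ {p q} → (X *P p) ≋ (X *P q) → p ≋ q
X-cancel {p} {q} e = tail-≋ (≋-trans (≋-sym (X-* p)) (≋-trans e (X-* q)))

constP-+ : ∀ a b → constP (a +ℚ b) ≋ (constP a +P constP b)
constP-+ a b = ≋-refl

constP-*-constP : ∀ a b → constP (a *ℚ b) ≋ (constP a *P constP b)
constP-*-constP a b = ≋-sym (constP-* a (constP b))

compose-0 : ∀ p r → p ≋ 0P → compose p r ≋ 0P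
compose-0 []      r e = ≋-refl
compose-0 (a ∷ p) r e = ≋-trans
  (+-cong (≋-trans (∷-cong (at e 0) ≋-refl) 0∷[])
          (*-congˡ r (compose-0 p r (mk λ n → at e (suc n)))))
  (*-zeroʳ r)

compose-cong : ∀ {p q} r → p ≋ q → compose p r ≋ compose q r
compose-cong {[]}    {q}     r e = ≋-sym (compose-0 q r (≋-sym e))
compose-cong {a ∷ p} {[]}    r e = compose-0 (a ∷ p) r e
compose-cong {a ∷ p} {b ∷ q} r e =
  +-cong (∷-cong (at e 0) ≋-refl) (*-congˡ r (compose-cong {p} {q} r (tail-≋ e)))

compose-+ : ∀ p q r → compose (p +P q) r ≋ (compose p r +P compose q r)
compose-+ []      q       r = ≋-refl
compose-+ (a ∷ p) []      r = ≋-sym (+-identityʳ _)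
compose-+ (a ∷ p) (b ∷ q) r = ≋-trans
  (+-cong (constP-+ a b) (≋-trans (*-congˡ r (compose-+ p q r)) (*-distribˡ r (compose p r) (compose q r))))
  (+-interchange (constP a) (constP b) (r *P compose p r) (r *P compose q r))

compose-· : ∀ a p r → compose (a ·P p) r ≋ (constP a *P compose p r)
compose-· a []      r = ≋-sym (*-zeroʳ (constP a))
compose-· a (b ∷ p) r = begin
  constP (a *ℚ b) +P (r *P compose (a ·P p) r)
    ≈⟨ +-cong (constP-*-constP a b) (*-congˡ r (compose-· a p r)) ⟩
  (constP a *P constP b) +P (r *P (constP a *P compose p r))
    ≈⟨ +-congˡ (constP a *P constP b) (≋-sym (*-assoc r (constP a) (compose p r))) ⟩
  (constP a *P constP b) +P ((r *P constP a) *P compose p r)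
    ≈⟨ +-congˡ (constP a *P constP b) (*-cong (*-comm r (constP a)) ≋-refl) ⟩
  (constP a *P constP b) +P ((constP a *P r) *P compose p r)
    ≈⟨ +-congˡ (constP a *P constP b) (*-assoc (constP a) r (compose p r)) ⟩
  (constP a *P constP b) +P (constP a *P (r *P compose p r))
    ≈⟨ ≋-sym (*-distribˡ (constP a) (constP b) (r *P compose p r)) ⟩
  constP a *P (constP b +P (r *P compose p r)) ∎
  where open ≋-R

compose-* : ∀ p q r → compose (p *P q) r ≋ (compose p r *P compose q r)
compose-* []      q r = ≋-refl
compose-* (a ∷ p) q r = begin
  compose ((a ·P q) +P (0ℚ ∷ (p *P q))) r
    ≈⟨ compose-+ (a ·P q) (0ℚ ∷ (p *P q)) r ⟩
  compose (a ·P q) r +P (constP 0ℚ +P (r *P compose (p *P q) r))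
    ≈⟨ +-cong (compose-· a q r) (+-cong 0∷[] (*-congˡ r (compose-* p q r))) ⟩
  (constP a *P compose q r) +P (r *P (compose p r *P compose q r))
    ≈⟨ +-congˡ (constP a *P compose q r) (≋-sym (*-assoc r (compose p r) (compose q r))) ⟩
  (constP a *P compose q r) +P ((r *P compose p r) *P compose q r)
    ≈⟨ ≋-sym (*-distribʳ (compose q r) (constP a) (r *P compose p r)) ⟩
  (constP a +P (r *P compose p r)) *P compose q r ∎
  where open ≋-R

compose-constP : ∀ a r → compose (constP a) r ≋ constP a
compose-constP a r = ≋-trans (+-congˡ (constP a) (*-zeroʳ r)) (+-identityʳ (constP a))

compose-X : ∀ r → compose X r ≋ r
compose-X r = begin
  constP 0ℚ +P (r *P (constP 1ℚ +P (r *P 0P)))  ≈⟨ +-cong 0∷[] (*-congˡ r (compose-constP 1ℚ r)) ⟩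
  r *P 1P                                       ≈⟨ *-comm r 1P ⟩
  1P *P r                                       ≈⟨ *-identityˡ r ⟩
  r ∎
  where open ≋-R

negP-· : ∀ p → negP p ≋ (negℚ 1ℚ ·P p)
negP-· p = mk λ n → ≡.trans (coeff-neg p n)
  (≡.trans (≡.trans (cong negℚ (≡.sym (ℚP.*-identityˡ (coeff p n)))) (ℚP.neg-distribˡ-* 1ℚ (coeff p n)))
           (≡.sym (coeff-· (negℚ 1ℚ) p n)))

compose-neg : ∀ p r → compose (negP p) r ≋ negP (compose p r)
compose-neg p r = begin
  compose (negP p) r               ≈⟨ compose-cong r (negP-· p) ⟩
  compose (negℚ 1ℚ ·P p) r         ≈⟨ compose-· (negℚ 1ℚ) p r ⟩
  constP (negℚ 1ℚ) *P compose p r  ≈⟨ constP-* (negℚ 1ℚ) (compose p r) ⟩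
  negℚ 1ℚ ·P compose p r           ≈⟨ ≋-sym (negP-· (compose p r)) ⟩
  negP (compose p r)               ∎
  where open ≋-R

open ListDeterminant polyRing Point

private
  module P = CommutativeRing polyRing
  module PP = RingProperties P.ring

-- Characteristic polynomials

-- `det` of Defs expands through a local function that cannot be named from outside.  Its size argument
-- `m` is separated from the matrix dimension by abstracting `suc n` in a matrix of dimension `suc (suc n)`.

laplaceTerm : ∀ {n} → Matrix Poly (suc n) → Fin (suc n) → ℚ → Poly
laplaceTerm M j s = s ·P (M zero j *P det (λ i k → M (suc i) (punchIn j k)))

laplaceSum : ∀ {n} → Matrix Poly (suc n) → (m : ℕ) → (Fin m → Fin (suc n)) → ℚ → Poly
laplaceSum M zero    col s = 0P
laplaceSum M (suc m) col s = laplaceTerm M (col zero) s +P laplaceSum M m (λ k → col (suc k)) (negℚ s)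

mutual
  det-laplaceSum : ∀ n (M : Matrix Poly (suc n)) → det M ≡ laplaceSum M (suc n) (λ j → j) 1ℚ
  det-laplaceSum zero    M = refl
  det-laplaceSum (suc n) M with (λ (k : Fin n) → Fin.suc (Fin.suc k))
  ... | col = cong (λ z → laplaceTerm M zero 1ℚ +P (laplaceTerm M (suc zero) (negℚ 1ℚ) +P z)) (expand-rest n M col)

  -- The omitted left side is the local loop of `det`, found by unification with the use in
  -- `det-laplaceSum`. Two terms are peeled off there so that the remaining loop size `n` can be
  -- told apart from the dimension.
  expand-rest : ∀ n (M : Matrix Poly (suc (suc n))) (col : Fin n → Fin (suc (suc n))) →
    _ ≡ laplaceSum M n col (negℚ (negℚ 1ℚ))
  expand-rest n M col with suc n | negℚ (negℚ 1ℚ)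
  ... | N | s = expand N M n col s

  expand : ∀ n (M : Matrix Poly (suc n)) m (col : Fin m → Fin (suc n)) s → _ ≡ laplaceSum M m col s
  expand n M zero    col s = refl
  expand n M (suc m) col s = cong (laplaceTerm M (col zero) s +P_) (expand n M m (λ k → col (suc k)) (negℚ s))

alternatingSum : ∀ m → (Fin m → Poly) → Poly
alternatingSum zero    h = 0P
alternatingSum (suc m) h = h zero P.- alternatingSum m (λ k → h (suc k))

alternatingSum-cong : ∀ m {h h′} → (∀ k → h k ≋ h′ k) → alternatingSum m h ≋ alternatingSum m h′
alternatingSum-cong zero    e = ≋-refl
alternatingSum-cong (suc m) e = P.+-cong (e zero) (P.-‿cong (alternatingSum-cong m (λ k → e (suc k))))

neg-· : ∀ s p → (negℚ s ·P p) ≋ (s ·P negP p)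
neg-· s p = mk λ n → ≡.trans (coeff-· (negℚ s) p n) (≡.trans (≡.trans (≡.sym (ℚP.neg-distribˡ-* s (coeff p n)))
  (ℚP.neg-distribʳ-* s (coeff p n))) (≡.sym (≡.trans (coeff-· s (negP p) n) (cong (s *ℚ_) (coeff-neg p n)))))

laplaceSum-alternatingSum : ∀ {n} (M : Matrix Poly (suc n)) m col s → laplaceSum M m col s ≋
  (s ·P alternatingSum m (λ k → M zero (col k) *P det (λ i j → M (suc i) (punchIn (col k) j))))
laplaceSum-alternatingSum M zero    col s = ≋-refl
laplaceSum-alternatingSum M (suc m) col s = ≋-trans
  (+-congˡ (laplaceTerm M (col zero) s)
    (≋-trans (laplaceSum-alternatingSum M m (λ k → col (suc k)) (negℚ s)) (neg-· s _)))
  (≋-sym (·-distribˡ s (M zero (col zero) *P det (λ i j → M (suc i) (punchIn (col zero) j)))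
    (negP (alternatingSum m (λ k → M zero (col (suc k)) *P det (λ i j → M (suc i) (punchIn (col (suc k)) j)))))))

det-alternatingSum : ∀ {n} (M : Matrix Poly (suc n)) →
  det M ≋ alternatingSum (suc n) (λ k → M zero k *P det (λ i j → M (suc i) (punchIn k j)))
det-alternatingSum {n} M = ≋-trans (≋-reflexive (det-laplaceSum n M))
  (≋-trans (laplaceSum-alternatingSum M (suc n) (λ j → j) 1ℚ) (·-identity _))

det-cong : ∀ {n} {M N : Matrix Poly n} → (∀ i j → M i j ≋ N i j) → det M ≋ det N
det-cong {zero}          e = ≋-refl
det-cong {suc n} {M} {N} e = ≋-trans (det-alternatingSum M) (≋-trans
  (alternatingSum-cong (suc n) (λ k → *-cong (e zero k) (det-cong (λ i j → e (suc i) (punchIn k j)))))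
  (≋-sym (det-alternatingSum N)))

lapl-alternatingSum : ∀ {n} g (c : Fin (suc n) → Point) K → lapl g (tabulate c) K ≋
  alternatingSum (suc n) (λ j → g (c j) *P K (tabulate (λ k → c (punchIn j k))))
lapl-alternatingSum {zero}  g c K = ≋-refl
lapl-alternatingSum {suc n} g c K = +-congˡ (g (c zero) *P K (tabulate (λ k → c (suc k))))
  (P.-‿cong (lapl-alternatingSum g (λ k → c (suc k)) (λ ds → K (c zero ∷ ds))))

det-D : ∀ {n} (ρ : Fin n → Point → Poly) (c : Fin n → Point) →
  det (λ i j → ρ i (c j)) ≋ D (tabulate ρ) (tabulate c)
det-D {zero}  ρ c = ≋-refl
det-D {suc n} ρ c = ≋-trans (det-alternatingSum (λ i j → ρ i (c j))) (≋-trans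
  (alternatingSum-cong (suc n) (λ k → *-congˡ (ρ zero (c k)) (det-D (λ i → ρ (suc i)) (λ j → c (punchIn k j)))))
  (≋-sym (lapl-alternatingSum (ρ zero) c (D (tabulate (λ i → ρ (suc i)))))))

det-lookup : ∀ (f : Point → Point → Poly) xs →
  det (λ i j → f (lookup xs i) (lookup xs j)) ≋ D (map f xs) xs
det-lookup f xs = ≋-trans (det-D (λ i → f (lookup xs i)) (lookup xs))
  (≋-reflexive (cong₂ D (≡.trans (≡.sym (map-tabulate (lookup xs) f)) (cong (map f) (tabulate-lookup xs)))
                        (tabulate-lookup xs)))

charEntry : Poly → (Point → Point → ℚ) → Point → Point → Poly
charEntry t M u v = (if u ==P v then t else 0P) -P constP (M u v)

==P-refl : ∀ u → (u ==P u) ≡ true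
==P-refl u with u ≟P u
... | yes _ = refl
... | no ne = ⊥-elim (ne refl)

==P-≢ : ∀ {u v} → u ≢ v → (u ==P v) ≡ false
==P-≢ {u} {v} ne with u ≟P v
... | yes e = ⊥-elim (ne e)
... | no _  = refl

lookup-∈ : ∀ (xs : List Point) i → lookup xs i ∈ xs
lookup-∈ (x ∷ xs) zero    = here refl
lookup-∈ (x ∷ xs) (suc i) = there (lookup-∈ xs i)

-- Uniqueness turns the equality test on positions into one on points, so that the matrix can be
-- indexed by the list itself.
δ-lookup : ∀ {xs} → Unique xs → ∀ i j → δ i j ≡ (lookup xs i ==P lookup xs j)
δ-lookup {x ∷ xs} (x∉ ∷ u) zero    zero    = ≡.sym (==P-refl x)
δ-lookup {x ∷ xs} (x∉ ∷ u) zero    (suc j) = ≡.sym (==P-≢ (All.lookup x∉ (lookup-∈ xs j)))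
δ-lookup {x ∷ xs} (x∉ ∷ u) (suc i) zero    = ≡.sym (==P-≢ (λ e → All.lookup x∉ (lookup-∈ xs i) (≡.sym e)))
δ-lookup {x ∷ xs} (x∉ ∷ u) (suc i) (suc j) = δ-lookup u i j

charPoly-D : ∀ (M : Point → Point → ℚ) {xs} → Unique xs →
  charPoly (λ i j → M (lookup xs i) (lookup xs j)) ≋ D (map (charEntry X M) xs) xs
charPoly-D M {xs} u = ≋-trans
  (det-cong (λ i j → ≋-reflexive (cong (λ b → (if b then X else 0P) -P constP (M (lookup xs i) (lookup xs j)))
                                       (δ-lookup u i j))))
  (det-lookup (charEntry X M) xs)

compose-minus : ∀ p q r → compose (p -P q) r ≋ (compose p r -P compose q r)
compose-minus p q r = ≋-trans (compose-+ p (negP q) r) (+-congˡ (compose p r) (compose-neg q r))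

compose-charEntry : ∀ M r u v → compose (charEntry X M u v) r ≋ charEntry r M u v
compose-charEntry M r u v = ≋-trans (compose-minus (if u ==P v then X else 0P) (constP (M u v)) r)
  (P.+-cong (lemma (u ==P v)) (P.-‿cong (compose-constP (M u v) r)))
  where
  lemma : ∀ b → compose (if b then X else 0P) r ≋ (if b then r else 0P)
  lemma true  = compose-X r
  lemma false = ≋-refl

compose-charPoly : ∀ (M : Point → Point → ℚ) {xs} → Unique xs → ∀ r →
  compose (charPoly (λ i j → M (lookup xs i) (lookup xs j))) r ≋ D (map (charEntry r M) xs) xs
compose-charPoly M {xs} u r = ≋-trans (compose-cong r (charPoly-D M u)) (≋-trans
  (D-hom (λ p → compose p r) ≋-refl (compose-constP 1ℚ r) (λ a b → compose-minus a b r) (λ a b → compose-* a b r)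
         (charEntry X M) xs xs)
  (D-cong xs xs (λ {x} {c} _ _ → compose-charEntry M r x c)))

-- Gram matrices and the Schur complement

sumQ : (Point → ℚ) → List Point → ℚ
sumQ f []       = 0ℚ
sumQ f (x ∷ xs) = f x +ℚ sumQ f xs

gram : (Point → Point → ℚ) → List Point → Point → Point → ℚ
gram M ws u v = sumQ (λ w → M u w *ℚ M v w) ws

gram-sym : ∀ M ws u v → gram M ws u v ≡ gram M ws v u
gram-sym M []       u v = refl
gram-sym M (w ∷ ws) u v = cong₂ _+ℚ_ (ℚP.*-comm (M u w) (M v w)) (gram-sym M ws u v)

charEntry-≢ : ∀ t M {u v} → u ≢ v → charEntry t M u v ≋ negP (constP (M u v))
charEntry-≢ t M {u} {v} ne = ≋-reflexive (cong (λ b → (if b then t else 0P) -P constP (M u v)) (==P-≢ ne))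

charEntry-refl : ∀ t M u → charEntry t M u u ≋ (t -P constP (M u u))
charEntry-refl t M u = ≋-reflexive (cong (λ b → (if b then t else 0P) -P constP (M u u)) (==P-refl u))

constP-0 : ∀ {a} → a ≡ 0ℚ → constP a ≋ 0P
constP-0 e = ≋-trans (∷-cong e ≋-refl) 0∷[]

neg-constP-0 : ∀ {a} → a ≡ 0ℚ → negP (constP a) ≋ 0P
neg-constP-0 e = ≋-trans (P.-‿cong (constP-0 e)) PP.-0#≈0#

charEntry-zero : ∀ t M {u v} → u ≢ v → M u v ≡ 0ℚ → charEntry t M u v ≋ 0P
charEntry-zero t M ne e = ≋-trans (charEntry-≢ t M ne) (neg-constP-0 e)

pow-cancel : ∀ n {p q} → (pow X n *P p) ≋ (pow X n *P q) → p ≋ q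
pow-cancel zero    {p} {q} e = ≋-trans (≋-sym (*-identityˡ p)) (≋-trans e (*-identityˡ q))
pow-cancel (suc n) {p} {q} e = pow-cancel n (X-cancel
  (≋-trans (≋-sym (*-assoc X (pow X n) p)) (≋-trans e (*-assoc X (pow X n) q))))

-- For a bipartite graph with equally many black and white vertices the Schur complement of the white block
-- turns t I - A into t² I - B Bᵀ; multiplying the black rows by t avoids dividing by t.
module Bipartite (M : Point → Point → ℚ) (M-sym : ∀ u v → M u v ≡ M v u) (bs ws : List Point)
  (M-black : ∀ {u v} → u ∈ bs → v ∈ bs → M u v ≡ 0ℚ) (M-white : ∀ {u v} → u ∈ ws → v ∈ ws → M u v ≡ 0ℚ)
  (disjoint : ∀ {u v} → u ∈ bs → v ∈ ws → u ≢ v) (ws-unique : Unique ws) (balanced : length bs ≡ length ws) where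

  private
    f = charEntry X M
    g = charEntry (X *P X) (gram M ws)
    h : Point → Point → Poly
    h b i = sumL (λ w → constP (M b w) *P f w i) ws

  -- In a black column `i` the white row `w` has the entry `- M w i`, so the combination with
  -- coefficients `M b w` is minus a Gram entry.
  sum-black : ∀ b {i} → i ∈ bs → ∀ vs → (∀ {w} → w ∈ vs → w ∈ ws) →
    sumL (λ w → constP (M b w) *P f w i) vs ≋ negP (constP (sumQ (λ w → M b w *ℚ M i w) vs))
  sum-black b i∈ []       sub = ≋-sym (neg-constP-0 refl)
  sum-black b {i} i∈ (w ∷ vs) sub = begin
    (constP (M b w) *P f w i) +P sumL (λ w → constP (M b w) *P f w i) vs
      ≈⟨ P.+-cong (*-congˡ (constP (M b w)) (charEntry-≢ X M (λ e → disjoint i∈ (sub (here refl)) (≡.sym e))))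
                  (sum-black b i∈ vs (λ j → sub (there j))) ⟩
    (constP (M b w) *P negP (constP (M w i))) +P negP (constP (sumQ (λ w → M b w *ℚ M i w) vs))
      ≈⟨ P.+-congʳ {negP (constP (sumQ (λ w → M b w *ℚ M i w) vs))}
          (≋-trans (≋-sym (PP.-‿distribʳ-* (constP (M b w)) (constP (M w i))))
            (P.-‿cong (≋-trans (≋-sym (constP-*-constP (M b w) (M w i)))
              (∷-cong (cong (M b w *ℚ_) (M-sym w i)) ≋-refl)))) ⟩
    negP (constP (M b w *ℚ M i w)) +P negP (constP (sumQ (λ w → M b w *ℚ M i w) vs))
      ≈⟨ PP.-‿+-comm (constP (M b w *ℚ M i w)) (constP (sumQ (λ w → M b w *ℚ M i w) vs)) ⟩
    negP (constP (M b w *ℚ M i w +ℚ sumQ (λ w → M b w *ℚ M i w) vs)) ∎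
    where open ≋-R

  sum-white-zero : ∀ b {i} → i ∈ ws → ∀ vs → (∀ {w} → w ∈ vs → w ∈ ws) → (∀ {w} → w ∈ vs → w ≢ i) →
    sumL (λ w → constP (M b w) *P f w i) vs ≋ 0P
  sum-white-zero b i∈ []       sub ne = ≋-refl
  sum-white-zero b {i} i∈ (w ∷ vs) sub ne = P.+-cong
    (≋-trans (*-congˡ (constP (M b w)) (charEntry-zero X M (ne (here refl)) (M-white (sub (here refl)) i∈)))
             (*-zeroʳ (constP (M b w))))
    (sum-white-zero b i∈ vs (λ j → sub (there j)) (λ j → ne (there j)))

  charEntry-white : ∀ {w} → w ∈ ws → f w w ≋ X
  charEntry-white {w} w∈ = ≋-trans (charEntry-refl X M w) (≋-trans
    (+-congˡ X (neg-constP-0 (M-white w∈ w∈))) (+-identityʳ X))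

  -- Entries between white vertices vanish in `M`, so only the diagonal term `w = i` survives and
  -- contributes `X`.
  sum-white : ∀ b {i} vs → (∀ {w} → w ∈ vs → w ∈ ws) → Unique vs → i ∈ vs →
    sumL (λ w → constP (M b w) *P f w i) vs ≋ (constP (M b i) *P X)
  sum-white b (w ∷ vs) sub (w∉ ∷ u) (here refl) = ≋-trans
    (P.+-cong (*-congˡ (constP (M b w)) (charEntry-white (sub (here refl))))
      (sum-white-zero b (sub (here refl)) vs (λ j → sub (there j)) (λ j e → All.lookup w∉ j (≡.sym e))))
    (+-identityʳ (constP (M b w) *P X))
  sum-white b {i} (w ∷ vs) sub (w∉ ∷ u) (there j) = ≋-trans
    (+-congʳ (sumL (λ w → constP (M b w) *P f w i) vs) (≋-trans
      (*-congˡ (constP (M b w)) (charEntry-zero X M (All.lookup w∉ j) (M-white (sub (here refl)) (sub (there j)))))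
      (*-zeroʳ (constP (M b w)))))
    (sum-white b vs (λ k → sub (there k)) u j)

  row-black : ∀ {b i} → b ∈ bs → i ∈ bs → ((X *P f b i) +P h b i) ≋ g b i
  row-black {b} {i} b∈ i∈ = P.+-cong
    (≋-trans (*-congˡ X (≋-trans (+-congˡ (if b ==P i then X else 0P) (neg-constP-0 (M-black b∈ i∈)))
                                 (+-identityʳ (if b ==P i then X else 0P))))
             (lemma (b ==P i)))
    (sum-black b i∈ ws (λ j → j))
    where
    lemma : ∀ c → (X *P (if c then X else 0P)) ≋ (if c then X *P X else 0P)
    lemma true  = ≋-refl
    lemma false = *-zeroʳ X

  -- The scaling of row `b` by `X` is chosen to match the `X` on the diagonal of the white block.
  row-white : ∀ {b i} → b ∈ bs → i ∈ ws → ((X *P f b i) +P h b i) ≋ 0P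
  row-white {b} {i} b∈ i∈ = begin
    (X *P f b i) +P h b i
      ≈⟨ P.+-cong (*-congˡ X (charEntry-≢ X M (disjoint b∈ i∈))) (sum-white b ws (λ j → j) ws-unique i∈) ⟩
    (X *P negP (constP (M b i))) +P (constP (M b i) *P X)
      ≈⟨ P.+-cong (≋-sym (PP.-‿distribʳ-* X (constP (M b i)))) (*-comm (constP (M b i)) X) ⟩
    negP (X *P constP (M b i)) +P (X *P constP (M b i))
      ≈⟨ +-inverseˡ (X *P constP (M b i)) ⟩
    0P ∎
    where open ≋-R

  ws-diagonal : AllPairs (λ v w → f v w ≋ 0P) ws
  ws-diagonal = go ws (λ j → j) ws-unique
    where
    go : ∀ vs → (∀ {w} → w ∈ vs → w ∈ ws) → Unique vs → AllPairs (λ v w → f v w ≋ 0P) vs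
    go []       sub []       = []
    go (v ∷ vs) sub (n ∷ u) =
      All.tabulate (λ j → charEntry-zero X M (All.lookup n j) (M-white (sub (here refl)) (sub (there j))))
      ∷ go vs (λ j → sub (there j)) u

  -- Scaling costs one factor `X` per black row and the diagonal white block returns one per white
  -- row; with equally many of both, these powers cancel.
  D-bipartite : D (map f (bs ++ ws)) (bs ++ ws) ≋ D (map g bs) bs
  D-bipartite = pow-cancel (length bs) (begin
    pow X (length bs) *P D (map f (bs ++ ws)) (bs ++ ws)
      ≡⟨ cong (λ rs → pow X (length bs) *P D rs (bs ++ ws)) (map-++ f bs ws) ⟩
    pow X (length bs) *P D (map f bs ++ map f ws) (bs ++ ws)
      ≈⟨ ≋-sym (D-rowops X f h (map f ws) bs
           (λ {b} _ → kills-sum (λ w → constP (M b w)) f ws (kills-D f)) (bs ++ ws)) ⟩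
    D (map r bs ++ map f ws) (bs ++ ws)
      ≈⟨ D-block (map r bs) (map f ws) bs ws (length-map r bs) (λ q → r-zero bs (λ j → j) q) ⟩
    D (map r bs) bs *P D (map f ws) ws
      ≈⟨ *-cong (D-cong bs bs row-black) (D-diagonal f X ws-diagonal charEntry-white) ⟩
    D (map g bs) bs *P pow X (length ws)
      ≈⟨ *-comm (D (map g bs) bs) (pow X (length ws)) ⟩
    pow X (length ws) *P D (map g bs) bs
      ≡⟨ cong (λ n → pow X n *P D (map g bs) bs) (≡.sym balanced) ⟩
    pow X (length bs) *P D (map g bs) bs ∎)
    where
    open ≋-R
    r : Point → Point → Poly
    r b i = (X *P f b i) +P h b i
    r-zero : ∀ cs → (∀ {b} → b ∈ cs → b ∈ bs) → ∀ {q} → q ∈ map r cs → ∀ {i} → i ∈ ws → q i ≋ 0P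
    r-zero (c ∷ cs) sub (here refl) i∈ = row-white (sub (here refl)) i∈
    r-zero (c ∷ cs) sub (there q)   i∈ = r-zero cs (λ j → sub (there j)) q i∈

-- Tridiagonal matrices and continued fractions

-- Symmetry of `S` supplies the other triangle. The sign of an off-diagonal entry is left open
-- because the determinant sees only its square, and the diagonal is unconstrained.
data Tridiagonal (S : Point → Point → ℚ) : List Point → Set where
  []  : Tridiagonal S []
  [_] : ∀ v → Tridiagonal S (v ∷ [])
  cons : ∀ {u v vs} → S u v *ℚ S u v ≡ 1ℚ → (∀ {z} → z ∈ vs → S u z ≡ 0ℚ) →
    Tridiagonal S (v ∷ vs) → Tridiagonal S (u ∷ v ∷ vs)

module ContinuedFraction (S : Point → Point → ℚ) (S-sym : ∀ u v → S u v ≡ S v u) (c : Point → Poly)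
  (c-diag : ∀ v → (X -P constP (S v v)) ≋ c v) where

  private
    g = charEntry X S

  -- Both components go through the induction together: the denominator is the continuant of the
  -- tail, which makes the three-term recursion and the recursion of `contFrac` the same.
  contFrac-D : ∀ {x xs} → Unique (x ∷ xs) → Tridiagonal S (x ∷ xs) →
    (D (map g (x ∷ xs)) (x ∷ xs) ≋ proj₁ (contFrac (map c (x ∷ xs)))) ×
    (D (map g xs) xs ≋ proj₂ (contFrac (map c (x ∷ xs))))
  contFrac-D {x} u [ .x ] = ≋-trans (D-single g x [] (λ ()))
    (≋-trans (*-comm (g x x) 1P) (≋-trans (*-identityˡ (g x x)) (≋-trans (charEntry-refl X S x) (c-diag x)))) ,
    ≋-refl
  contFrac-D {x} {y ∷ ys} ((x≢y ∷ x∉) ∷ u) (cons near far t)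
    with contFrac (map c (y ∷ ys)) | contFrac-D u t
  ... | (n , d) | (en , ed) = (begin
    D (map g (x ∷ y ∷ ys)) (x ∷ y ∷ ys)
      ≈⟨ D-tridiagonal g x y ys
          (λ j → charEntry-zero X S (All.lookup x∉ j) (far j))
          (λ {z} j → charEntry-zero X S (λ e → All.lookup x∉ j (≡.sym e)) (≡.trans (S-sym z x) (far j))) ⟩
    (g x x *P D (map g (y ∷ ys)) (y ∷ ys)) -P ((g x y *P g y x) *P D (map g ys) ys)
      ≈⟨ P.+-cong (*-cong (≋-trans (charEntry-refl X S x) (c-diag x)) en)
           (P.-‿cong (≋-trans (*-cong off-diagonal ed) (*-identityˡ d))) ⟩
    (c x *P n) -P d ∎) , en
    where
    open ≋-R
    off-diagonal : (g x y *P g y x) ≋ 1P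
    off-diagonal = begin
      g x y *P g y x
        ≈⟨ *-cong (charEntry-≢ X S x≢y) (≋-trans (charEntry-≢ X S (λ e → x≢y (≡.sym e)))
             (P.-‿cong (∷-cong (S-sym y x) ≋-refl))) ⟩
      negP (constP (S x y)) *P negP (constP (S x y))
        ≈⟨ ≋-sym (PP.-‿distribˡ-* (constP (S x y)) (negP (constP (S x y)))) ⟩
      negP (constP (S x y) *P negP (constP (S x y)))
        ≈⟨ P.-‿cong (≋-sym (PP.-‿distribʳ-* (constP (S x y)) (constP (S x y)))) ⟩
      negP (negP (constP (S x y) *P constP (S x y)))
        ≈⟨ PP.-‿involutive (constP (S x y) *P constP (S x y)) ⟩
      constP (S x y) *P constP (S x y)
        ≈⟨ ≋-sym (constP-*-constP (S x y) (S x y)) ⟩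
      constP (S x y *ℚ S x y)
        ≈⟨ ∷-cong near ≋-refl ⟩
      1P ∎

-- One step of the Euclidean algorithm: a common divisor of `c n - d` and `n` divides
-- `c n - (c n - d) = d`, hence both `n` and `d`.
contFrac-coprime : ∀ c cs → CoprimeP (proj₁ (contFrac (c ∷ cs))) (proj₂ (contFrac (c ∷ cs)))
contFrac-coprime c []        e (_ , _) q = q
contFrac-coprime c (c′ ∷ cs) e (a , ea) (b , eb)
  with contFrac (c′ ∷ cs) | contFrac-coprime c′ cs
... | (n , d) | coprime = coprime e (b , eb) ((c *P b) -P a , at (begin
    e *P ((c *P b) -P a)               ≈⟨ *-distribˡ e (c *P b) (negP a) ⟩
    (e *P (c *P b)) +P (e *P negP a)   ≈⟨ P.+-cong e-c-b (≋-trans (≋-sym (PP.-‿distribʳ-* e a)) (P.-‿cong (mk ea))) ⟩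
    (c *P n) -P ((c *P n) -P d)        ≈⟨ +-congˡ (c *P n) (≋-sym (PP.-‿+-comm (c *P n) (negP d))) ⟩
    (c *P n) +P (negP (c *P n) +P negP (negP d))
      ≈⟨ ≋-sym (+-assoc (c *P n) (negP (c *P n)) (negP (negP d))) ⟩
    ((c *P n) -P (c *P n)) +P negP (negP d)
      ≈⟨ P.+-cong (P.-‿inverseʳ (c *P n)) (PP.-‿involutive d) ⟩
    d ∎))
  where
  open ≋-R
  e-c-b : (e *P (c *P b)) ≋ (c *P n)
  e-c-b = ≋-trans (≋-sym (*-assoc e c b)) (≋-trans (*-cong (*-comm e c) (≋-refl {b}))
    (≋-trans (*-assoc c e b) (*-congˡ c (mk eb))))

MonicDegree : ℕ → Poly → Set
MonicDegree n p = coeff p n ≡ 1ℚ × (∀ m → n < m → coeff p m ≡ 0ℚ)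

linear-coeff : ∀ a n m → coeff ((X -P constP a) *P n) (suc m) ≡ (0ℚ +ℚ negℚ a) *ℚ coeff n (suc m) +ℚ coeff n m
linear-coeff a n m = ≡.trans (coeff-+ ((0ℚ +ℚ negℚ a) ·P n) (0ℚ ∷ ((1ℚ ∷ []) *P n)) (suc m))
  (cong₂ _+ℚ_ (coeff-· (0ℚ +ℚ negℚ a) n (suc m)) (at (*-identityˡ n) m))

-- Carrying the denominator along, one degree lower, keeps `d` from disturbing the leading
-- coefficient; its monicity later shows that it is not zero.
contFrac-monic : ∀ (e : Point → ℚ) x xs → let (n , d) = contFrac (map (λ v → X -P constP (e v)) (x ∷ xs)) in
  MonicDegree (suc (length xs)) n × MonicDegree (length xs) d
contFrac-monic e x [] = (refl , λ { (suc (suc m)) (s≤s (s≤s _)) → refl }) , (refl , λ { (suc m) (s≤s _) → refl })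
contFrac-monic e x (y ∷ ys) with contFrac (map (λ v → X -P constP (e v)) (y ∷ ys)) | contFrac-monic e y ys
... | (n , d) | ((n₁ , n₀) , (d₁ , d₀)) =
  (≡.trans (step (suc (length ys)) ℕP.≤-refl) n₁ ,
   λ { (suc m) (s≤s l) → ≡.trans (step m (ℕP.<⇒≤ l)) (n₀ m l) }) , (n₁ , n₀)
  where
  -- In degree `suc m` the constant part of the linear factor meets a zero coefficient of `n`, and
  -- `d` has already ended, so only `X` times `n` contributes.
  step : ∀ m → suc (length ys) ℕ.≤ m → coeff (((X -P constP (e x)) *P n) -P d) (suc m) ≡ coeff n m
  step m l = begin
    coeff (((X -P constP (e x)) *P n) -P d) (suc m)
      ≡⟨ coeff-+ ((X -P constP (e x)) *P n) (negP d) (suc m) ⟩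
    coeff ((X -P constP (e x)) *P n) (suc m) +ℚ coeff (negP d) (suc m)
      ≡⟨ cong₂ _+ℚ_ (linear-coeff (e x) n m) (≡.trans (coeff-neg d (suc m)) (cong negℚ (d₀ (suc m) (ℕP.m<n⇒m<1+n l)))) ⟩
    ((0ℚ +ℚ negℚ (e x)) *ℚ coeff n (suc m) +ℚ coeff n m) +ℚ 0ℚ
      ≡⟨ ℚP.+-identityʳ _ ⟩
    (0ℚ +ℚ negℚ (e x)) *ℚ coeff n (suc m) +ℚ coeff n m
      ≡⟨ cong (λ z → (0ℚ +ℚ negℚ (e x)) *ℚ z +ℚ coeff n m) (n₀ (suc m) (s≤s l)) ⟩
    (0ℚ +ℚ negℚ (e x)) *ℚ 0ℚ +ℚ coeff n m
      ≡⟨ cong (_+ℚ coeff n m) (ℚP.*-zeroʳ (0ℚ +ℚ negℚ (e x))) ⟩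
    0ℚ +ℚ coeff n m
      ≡⟨ ℚP.+-identityˡ (coeff n m) ⟩
    coeff n m ∎
    where open ≡.≡-Reasoning

monic-≉0 : ∀ {n p} → MonicDegree n p → ¬ (p ≈P 0P)
monic-≉0 {n} (e , _) z with ≡.trans (≡.sym e) (z n)
... | ()

-- The Gram matrix of a snake graph

IsUnit : ℚ → Set
IsUnit a = a *ℚ a ≡ 1ℚ

unit-* : ∀ {a b} → IsUnit a → IsUnit b → IsUnit (a *ℚ b)
unit-* {a} {b} p q = ≡.trans (CSP.interchange (CommutativeRing.*-commutativeSemigroup ℚP.+-*-commutativeRing) a b a b)
  (≡.trans (cong₂ _*ℚ_ p q) (ℚP.*-identityˡ 1ℚ))

*-zero-left : ∀ {a} b → a ≡ 0ℚ → a *ℚ b ≡ 0ℚ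
*-zero-left b refl = ℚP.*-zeroˡ b

*-zero-right : ∀ a {b} → b ≡ 0ℚ → a *ℚ b ≡ 0ℚ
*-zero-right a refl = ℚP.*-zeroʳ a

0+ : ∀ {a b} → a ≡ 0ℚ → a +ℚ b ≡ b
0+ {b = b} refl = ℚP.+-identityˡ b

+0 : ∀ {a b} → b ≡ 0ℚ → a +ℚ b ≡ a
+0 {a} refl = ℚP.+-identityʳ a

gram-zeroˡ : ∀ M ws {u} v → (∀ {w} → w ∈ ws → M u w ≡ 0ℚ) → gram M ws u v ≡ 0ℚ
gram-zeroˡ M []       v z = refl
gram-zeroˡ M (w ∷ ws) v z = ≡.trans (0+ (*-zero-left (M v w) (z (here refl)))) (gram-zeroˡ M ws v (λ i → z (there i)))

-- The diagonal entry of the head is never read, so agreement is asked only for `v` in the tail. At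
-- the head `β`, the new white `y` changes just that entry.
Tridiagonal-cong : ∀ {S S′ : Point → Point → ℚ} {x xs} → (∀ u {v} → v ∈ xs → S′ u v ≡ S u v) →
  Tridiagonal S (x ∷ xs) → Tridiagonal S′ (x ∷ xs)
Tridiagonal-cong e [ v ] = [ v ]
Tridiagonal-cong e (cons near far t) = cons
  (≡.trans (cong₂ _*ℚ_ (e _ (here refl)) (e _ (here refl))) near)
  (λ i → ≡.trans (e _ (there i)) (far i))
  (Tridiagonal-cong (λ u i → e u (there i)) t)

-- A snake graph is grown one tile at a time along its current edge.  The index β is the black and ω the white end of
-- that edge, bW (resp. β ∷ bB) lists the black vertices on the side of ω (resp. β) starting nearest to the
-- edge, and ω ∷ ws the white vertices.  A tile adds a black x next to ω and a white y next to β; the new edge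
-- is x y for a straight tile, and y β for a tile where the snake turns around β.
module Ladder (M : Point → Point → ℚ) where

  -- `x` and `β` are the black corners of the tile, `y` and `ω` the white ones. `orthogonal` is the
  -- Kasteleyn condition, read as a scalar product of two rows of B restricted to the tile.
  record Cell (x y β ω : Point) : Set where
    field
      xω : IsUnit (M x ω)
      xy : IsUnit (M x y)
      βy : IsUnit (M β y)
      orthogonal : M x y *ℚ M β y +ℚ M x ω *ℚ M β ω ≡ 0ℚ

  -- The new vertices see the old snake only across the current edge: among old vertices, `x` can
  -- meet no white one but `ω`, and `y` no black one but `β`.
  record Attach (x y : Point) (bW : List Point) (β : Point) (bB : List Point) (ω : Point) (ws : List Point) : Set where
    field
      cell    : Cell x y β ω
      x-apart : ∀ {w} → w ∈ ws → M x w ≡ 0ℚ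
      W-apart : ∀ {v} → v ∈ bW → M v y ≡ 0ℚ
      B-apart : ∀ {v} → v ∈ bB → M v y ≡ 0ℚ
    open Cell cell public

  data Snake : List Point → Point → List Point → Point → List Point → Set where
    lastEdge : ∀ β ω → Snake [] β [] ω []
    turn     : ∀ {x y bW β bB ω ws} → Attach x y bW β bB ω ws → Snake bW β bB ω ws →
               Snake (x ∷ bW) β bB y (ω ∷ ws)
    straight : ∀ {x y bW β bB ω ws} → Attach x y bW β bB ω ws → Snake bW β bB ω ws →
               Snake (β ∷ bB) x bW y (ω ∷ ws)

  -- The last three fields strengthen the induction: apart from `β`, the only black neighbour of `ω`
  -- is the first vertex of `bW`. A new `x` meets the old black vertices through `ω` alone, so these
  -- adjacencies determine its row.
  record Invariant (bW : List Point) (β : Point) (bB : List Point) (ω : Point) (ws : List Point) : Set where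
    private
      S = gram M (ω ∷ ws)
    field
      triW   : Tridiagonal S bW
      triB   : Tridiagonal S (β ∷ bB)
      cross  : ∀ {u v} → u ∈ bW → v ∈ β ∷ bB → S u v ≡ 0ℚ
      ω-B    : ∀ {v} → v ∈ bB → M v ω ≡ 0ℚ
      ω-near : ∀ {x xs} → bW ≡ x ∷ xs → IsUnit (M x ω)
      ω-far  : ∀ {x xs} → bW ≡ x ∷ xs → ∀ {v} → v ∈ xs → M v ω ≡ 0ℚ

  module Grow {x y bW β bB ω ws} (a : Attach x y bW β bB ω ws) (inv : Invariant bW β bB ω ws) where
    open Attach a
    open Invariant inv
    S′ = gram M (y ∷ ω ∷ ws)

    old : ∀ u {v} → M v y ≡ 0ℚ → S′ u v ≡ gram M (ω ∷ ws) u v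
    old u e = 0+ (*-zero-right (M u y) e)

    x-row : ∀ v → gram M (ω ∷ ws) x v ≡ M x ω *ℚ M v ω
    x-row v = +0 (gram-zeroˡ M ws v x-apart)

    triW′ : Tridiagonal S′ (x ∷ bW)
    triW′ = go bW triW ω-near ω-far W-apart
      where
      go : ∀ bW → Tridiagonal (gram M (ω ∷ ws)) bW → (∀ {x xs} → bW ≡ x ∷ xs → IsUnit (M x ω)) →
        (∀ {x xs} → bW ≡ x ∷ xs → ∀ {v} → v ∈ xs → M v ω ≡ 0ℚ) → (∀ {v} → v ∈ bW → M v y ≡ 0ℚ) →
        Tridiagonal S′ (x ∷ bW)
      go []       t near far apart = [ x ]
      go (b ∷ bs) t near far apart = cons
        (≡.subst IsUnit (≡.sym (≡.trans (old x (apart (here refl))) (x-row b))) (unit-* {M x ω} xω (near refl)))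
        (λ {z} i → ≡.trans (old x (apart (there i))) (≡.trans (x-row z) (*-zero-right (M x ω) (far refl i))))
        (Tridiagonal-cong (λ u i → old u (apart (there i))) t)

    triB′ : Tridiagonal S′ (β ∷ bB)
    triB′ = Tridiagonal-cong (λ u i → old u (B-apart i)) triB

    -- `x` and `β` share the white vertices `y` and `ω`, whose contributions cancel in the tile; `x`
    -- shares none with `bB`, and `y` adds nothing to pairs containing an old vertex of `bW`.
    cross′ : ∀ {u v} → u ∈ x ∷ bW → v ∈ β ∷ bB → S′ u v ≡ 0ℚ
    cross′ (here refl) (here refl) = ≡.trans (cong (M x y *ℚ M β y +ℚ_) (x-row β)) orthogonal
    cross′ (here refl) (there j)   = ≡.trans (old x (B-apart j)) (≡.trans (x-row _) (*-zero-right (M x ω) (ω-B j)))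
    cross′ {u} {v} (there i) j     = ≡.trans (gram-sym M (y ∷ ω ∷ ws) u v) (≡.trans (old v (W-apart i))
      (≡.trans (gram-sym M (ω ∷ ws) v u) (cross i j)))

  -- A turn keeps the black pivot `β`, so the side of `ω` grows by `x`. A straight tile exchanges
  -- the colours of the ends of the edge: `x` becomes the black end and the two sides trade roles,
  -- which is why `triB′` and `triW′` are interchanged there.
  invariant : ∀ {bW β bB ω ws} → Snake bW β bB ω ws → Invariant bW β bB ω ws
  invariant (lastEdge β ω) = record
    { triW = [] ; triB = [ β ] ; cross = λ () ; ω-B = λ () ; ω-near = λ () ; ω-far = λ () }
  invariant (turn a s) = record
    { triW = triW′ ; triB = triB′ ; cross = cross′ ; ω-B = B-apart
    ; ω-near = λ { refl → xy } ; ω-far = λ { refl → W-apart } }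
    where open Attach a
          open Grow a (invariant s)
  invariant (straight {x} {y} {ω = ω} {ws} a s) = record
    { triW = triB′ ; triB = triW′
    ; cross = λ {u} {v} i j → ≡.trans (gram-sym M (y ∷ ω ∷ ws) u v) (cross′ j i)
    ; ω-B = W-apart ; ω-near = λ { refl → βy } ; ω-far = λ { refl → B-apart } }
    where open Attach a
          open Grow a (invariant s)

  balanced : ∀ {bW β bB ω ws} → Snake bW β bB ω ws → length bW ℕ.+ length (β ∷ bB) ≡ length (ω ∷ ws)
  balanced (lastEdge β ω) = refl
  balanced (turn a s)     = cong suc (balanced s)
  balanced (straight {bW = bW} {bB = bB} a s) = cong suc (≡.trans (ℕP.+-suc (length bB) (length bW))
    (≡.trans (cong suc (ℕP.+-comm (length bB) (length bW)))
      (≡.trans (≡.sym (ℕP.+-suc (length bW) (length bB))) (balanced s))))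

snoc-tridiagonal : ∀ {S : Point → Point → ℚ} rs {y x} → Tridiagonal S (rs ++ y ∷ []) → S y x *ℚ S y x ≡ 1ℚ →
  (∀ {z} → z ∈ rs → S z x ≡ 0ℚ) → Tridiagonal S (rs ++ y ∷ x ∷ [])
snoc-tridiagonal []            t                 near far = cons near (λ ()) [ _ ]
snoc-tridiagonal (r ∷ [])      (cons n f t)      near far =
  cons n (λ { (here refl) → far (here refl) }) (snoc-tridiagonal [] t near (λ ()))
snoc-tridiagonal {S} (r ∷ r′ ∷ rs) {y} {x} (cons n f t) near far =
  cons n (go rs f) (snoc-tridiagonal (r′ ∷ rs) t near (λ i → far (there i)))
  where
  go : ∀ qs → (∀ {z} → z ∈ qs ++ y ∷ [] → S r z ≡ 0ℚ) → ∀ {z} → z ∈ qs ++ y ∷ x ∷ [] → S r z ≡ 0ℚ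
  go []       f (here refl)         = f (here refl)
  go []       f (there (here refl)) = far (here refl)
  go (q ∷ qs) f (here refl)         = f (here refl)
  go (q ∷ qs) f (there i)           = go qs (λ j → f (there j)) i

-- A boundary may be traversed from either end, so the shape of its matrix has to survive reversal.
reverse-tridiagonal : ∀ {S : Point → Point → ℚ} → (∀ u v → S u v ≡ S v u) → ∀ xs →
  Tridiagonal S xs → Tridiagonal S (reverse xs)
reverse-tridiagonal sym [] t = []
reverse-tridiagonal sym (x ∷ []) t = [ x ]
reverse-tridiagonal {S} sym (x ∷ y ∷ ys) (cons n f t) = ≡.subst (Tridiagonal S) (≡.sym
  (≡.trans (unfold-reverse x (y ∷ ys)) (≡.trans (cong (_++ x ∷ []) (unfold-reverse y ys)) (++-assoc (reverse ys) (y ∷ []) (x ∷ [])))))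
  (snoc-tridiagonal (reverse ys) (≡.subst (Tridiagonal S) (unfold-reverse y ys) (reverse-tridiagonal sym (y ∷ ys) t))
    (≡.trans (cong₂ _*ℚ_ (sym y x) (sym y x)) n) (λ {z} i → ≡.trans (sym z x) (f (reverse⁻ i))))

factorization : ∀ (M S : Point → Point → ℚ) xs bs₁ bs₂ ws →
  (∀ u v → M u v ≡ M v u) → (∀ u v → S u v ≡ gram M ws u v) →
  Unique xs → Unique bs₁ → Unique bs₂ → Unique ws → xs ↭ (bs₁ ++ bs₂) ++ ws →
  (∀ {u v} → u ∈ bs₁ ++ bs₂ → v ∈ bs₁ ++ bs₂ → M u v ≡ 0ℚ) → (∀ {u v} → u ∈ ws → v ∈ ws → M u v ≡ 0ℚ) →
  (∀ {u v} → u ∈ bs₁ ++ bs₂ → v ∈ ws → u ≢ v) → length (bs₁ ++ bs₂) ≡ length ws →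
  (∀ {u v} → u ∈ bs₁ → v ∈ bs₂ → u ≢ v) → (∀ {u v} → u ∈ bs₁ → v ∈ bs₂ → S u v ≡ 0ℚ) →
  charPoly (λ i j → M (lookup xs i) (lookup xs j)) ≋
    (compose (charPoly (λ i j → S (lookup bs₁ i) (lookup bs₁ j))) (X *P X)
      *P compose (charPoly (λ i j → S (lookup bs₂ i) (lookup bs₂ j))) (X *P X))
factorization M S xs bs₁ bs₂ ws M-sym S-gram xs! bs₁! bs₂! ws! p M-black M-white b≢w balanced apart cross = begin
  charPoly (λ i j → M (lookup xs i) (lookup xs j))
    ≈⟨ charPoly-D M xs! ⟩
  D (map (charEntry X M) xs) xs
    ≈⟨ D-↭ (charEntry X M) p ⟩
  D (map (charEntry X M) ((bs₁ ++ bs₂) ++ ws)) ((bs₁ ++ bs₂) ++ ws)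
    ≈⟨ Bipartite.D-bipartite M M-sym (bs₁ ++ bs₂) ws M-black M-white b≢w ws! balanced ⟩
  D (map (charEntry (X *P X) (gram M ws)) (bs₁ ++ bs₂)) (bs₁ ++ bs₂)
    ≈⟨ D-cong (bs₁ ++ bs₂) (bs₁ ++ bs₂) (λ {u} {v} _ _ →
         ≋-reflexive (cong (λ a → (if u ==P v then X *P X else 0P) -P constP a) (≡.sym (S-gram u v)))) ⟩
  D (map g (bs₁ ++ bs₂)) (bs₁ ++ bs₂)
    ≡⟨ cong (λ rs → D rs (bs₁ ++ bs₂)) (map-++ g bs₁ bs₂) ⟩
  D (map g bs₁ ++ map g bs₂) (bs₁ ++ bs₂)
    ≈⟨ D-block (map g bs₁) (map g bs₂) bs₁ bs₂ (length-map g bs₁) (λ q → zero-rows bs₁ (λ j → j) q) ⟩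
  D (map g bs₁) bs₁ *P D (map g bs₂) bs₂
    ≈⟨ *-cong (≋-sym (compose-charPoly S bs₁! (X *P X))) (≋-sym (compose-charPoly S bs₂! (X *P X))) ⟩
  _ ∎
  where
  open ≋-R
  g = charEntry (X *P X) S
  zero-rows : ∀ cs → (∀ {b} → b ∈ cs → b ∈ bs₁) → ∀ {q} → q ∈ map g cs → ∀ {i} → i ∈ bs₂ → q i ≋ 0P
  zero-rows (c ∷ cs) sub (here refl) i∈ = charEntry-zero (X *P X) S (apart (sub (here refl)) i∈) (cross (sub (here refl)) i∈)
  zero-rows (c ∷ cs) sub (there q)   i∈ = zero-rows cs (λ j → sub (there j)) q i∈

-- Directions and coordinates

-- A direction together with the transverse one: each geometric argument is given once for such a
-- pair and covers its mirror image.
data Opp : Step → Step → Set where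
  RU : Opp R U
  UR : Opp U R

opp-sym : ∀ {d e} → Opp d e → Opp e d
opp-sym RU = UR
opp-sym UR = RU

go : Step → Point → Point
go R (a , b) = (suc a , b)
go U (a , b) = (a , suc b)

coord : Step → Point → ℕ
coord R = proj₁
coord U = proj₂

edge : Step → Point → Edge
edge R p = hor p
edge U p = ver p

coord-go : ∀ d p → coord d (go d p) ≡ suc (coord d p)
coord-go R p = refl
coord-go U p = refl

coord-go-opp : ∀ {d e} → Opp d e → ∀ p → coord e (go d p) ≡ coord e p
coord-go-opp RU p = refl
coord-go-opp UR p = refl

go-comm : ∀ {d e} → Opp d e → ∀ p → go d (go e p) ≡ go e (go d p)
go-comm RU p = refl
go-comm UR p = refl

coord-≤-go : ∀ d e p → coord e p ≤ coord e (go d p)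
coord-≤-go R R p = ℕP.n≤1+n _
coord-≤-go R U p = ℕP.≤-refl
coord-≤-go U R p = ℕP.≤-refl
coord-≤-go U U p = ℕP.n≤1+n _

go-injective : ∀ d {p q} → go d p ≡ go d q → p ≡ q
go-injective R refl = refl
go-injective U refl = refl

step-view : ∀ {d e} → Opp d e → ∀ s → s ≡ d ⊎ s ≡ e
step-view RU R = inj₁ refl
step-view RU U = inj₂ refl
step-view UR R = inj₂ refl
step-view UR U = inj₁ refl

edge-view : ∀ x → Σ Step λ d → Σ Point λ p → x ≡ edge d p
edge-view (hor p) = R , p , refl
edge-view (ver p) = U , p , refl

endpoints-edge : ∀ d p → endpoints (edge d p) ≡ (p , go d p)
endpoints-edge R p = refl
endpoints-edge U p = refl

edge-injective : ∀ {d d′ p p′} → edge d p ≡ edge d′ p′ → d ≡ d′ × p ≡ p′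
edge-injective {R} {R} refl = refl , refl
edge-injective {U} {U} refl = refl , refl
edge-injective {R} {U} ()
edge-injective {U} {R} ()

go-step-injective : ∀ {d e p} → go d p ≡ go e p → d ≡ e
go-step-injective {R} {R} q = refl
go-step-injective {U} {U} q = refl
go-step-injective {R} {U} q = ⊥-elim (ℕP.1+n≢n (cong proj₁ q))
go-step-injective {U} {R} q = ⊥-elim (ℕP.1+n≢n (cong proj₂ q))

go-≢ : ∀ d {p} → go d p ≢ p
go-≢ R q = ℕP.1+n≢n (cong proj₁ q)
go-≢ U q = ℕP.1+n≢n (cong proj₂ q)

tilesFrom-∷ : ∀ d p ss → tilesFrom p (d ∷ ss) ≡ p ∷ tilesFrom (go d p) ss
tilesFrom-∷ R p ss = refl
tilesFrom-∷ U p ss = refl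

data Sides (d e : Step) (p : Point) : Edge → Set where
  near-d : Sides d e p (edge d p)
  far-d  : Sides d e p (edge d (go e p))
  near-e : Sides d e p (edge e p)
  far-e  : Sides d e p (edge e (go d p))

∈-sides⁻ : ∀ {d e} → Opp d e → ∀ {p x} → x ∈ sides p → Sides d e p x
∈-sides⁻ RU (here refl)                         = near-d
∈-sides⁻ RU (there (here refl))                 = far-d
∈-sides⁻ RU (there (there (here refl)))         = near-e
∈-sides⁻ RU (there (there (there (here refl)))) = far-e
∈-sides⁻ UR (here refl)                         = near-e
∈-sides⁻ UR (there (here refl))                 = far-e
∈-sides⁻ UR (there (there (here refl)))         = near-d
∈-sides⁻ UR (there (there (there (here refl)))) = far-d

∈-sides⁺ : ∀ {d e} → Opp d e → ∀ {p x} → Sides d e p x → x ∈ sides p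
∈-sides⁺ RU near-d = here refl
∈-sides⁺ RU far-d  = there (here refl)
∈-sides⁺ RU near-e = there (there (here refl))
∈-sides⁺ RU far-e  = there (there (there (here refl)))
∈-sides⁺ UR near-e = here refl
∈-sides⁺ UR far-e  = there (here refl)
∈-sides⁺ UR near-d = there (there (here refl))
∈-sides⁺ UR far-d  = there (there (there (here refl)))

data Corners (d e : Step) (p : Point) : Point → Set where
  c₀  : Corners d e p p
  c-d : Corners d e p (go d p)
  c-e : Corners d e p (go e p)
  c₁  : Corners d e p (go e (go d p))

∈-corners⁻ : ∀ {d e} → Opp d e → ∀ {p x} → x ∈ corners p → Corners d e p x
∈-corners⁻ RU (here refl)                         = c₀
∈-corners⁻ RU (there (here refl))                 = c-d
∈-corners⁻ RU (there (there (here refl)))         = c-e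
∈-corners⁻ RU (there (there (there (here refl)))) = c₁
∈-corners⁻ UR (here refl)                         = c₀
∈-corners⁻ UR (there (here refl))                 = c-e
∈-corners⁻ UR (there (there (here refl)))         = c-d
∈-corners⁻ UR (there (there (there (here refl)))) = c₁

∈-corners⁺ : ∀ {d e} → Opp d e → ∀ {p x} → Corners d e p x → x ∈ corners p
∈-corners⁺ RU c₀  = here refl
∈-corners⁺ RU c-d = there (here refl)
∈-corners⁺ RU c-e = there (there (here refl))
∈-corners⁺ RU c₁  = there (there (there (here refl)))
∈-corners⁺ UR c₀  = here refl
∈-corners⁺ UR c-e = there (here refl)
∈-corners⁺ UR c-d = there (there (here refl))
∈-corners⁺ UR c₁  = there (there (there (here refl)))

corner-≥ : ∀ {t v} → v ∈ corners t → ∀ e → coord e t ≤ coord e v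
corner-≥ {t} i e with ∈-corners⁻ RU i
... | c₀  = ℕP.≤-refl
... | c-d = coord-≤-go R e t
... | c-e = coord-≤-go U e t
... | c₁  = ℕP.≤-trans (coord-≤-go R e t) (coord-≤-go U e (go R t))

corner-≤ : ∀ {t v} → v ∈ corners t → ∀ e → coord e v ≤ suc (coord e t)
corner-≤ {t} i e with ∈-corners⁻ RU i
corner-≤ {t} i e | c₀  = ℕP.n≤1+n _
corner-≤ {t} i R | c-d = ℕP.≤-refl
corner-≤ {t} i U | c-d = ℕP.n≤1+n _
corner-≤ {t} i R | c-e = ℕP.n≤1+n _
corner-≤ {t} i U | c-e = ℕP.≤-refl
corner-≤ {t} i R | c₁  = ℕP.≤-refl
corner-≤ {t} i U | c₁  = ℕP.≤-refl

-- Vertices, edges and adjacency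

∈-vertices⁺ : ∀ ss {t v} → t ∈ tiles ss → v ∈ corners t → v ∈ vertices ss
∈-vertices⁺ ss i j = ∈-deduplicate⁺ _≟P_ (∈-concatMap⁺ corners (lose i j))

find-∈ : ∀ {A : Set} {P : A → Set} {xs} → Any P xs → Σ A λ x → x ∈ xs × P x
find-∈ (here p)  = _ , here refl , p
find-∈ (there i) = let (x , j , p) = find-∈ i in x , there j , p

∈-vertices⁻ : ∀ ss {v} → v ∈ vertices ss → Σ Point λ t → t ∈ tiles ss × v ∈ corners t
∈-vertices⁻ ss i = find-∈ (∈-concatMap⁻ corners (∈-deduplicate⁻ _≟P_ (concatMap corners (tiles ss)) i))

∈-edges⁺ : ∀ ss {t x} → t ∈ tiles ss → x ∈ sides t → x ∈ edges ss
∈-edges⁺ ss i j = ∈-deduplicate⁺ _≟E_ (∈-concatMap⁺ sides (lose i j))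

∈-edges⁻ : ∀ ss {x} → x ∈ edges ss → Σ Point λ t → t ∈ tiles ss × x ∈ sides t
∈-edges⁻ ss i = find-∈ (∈-concatMap⁻ sides (∈-deduplicate⁻ _≟E_ (concatMap sides (tiles ss)) i))

vertices-unique : ∀ ss → Unique (vertices ss)
vertices-unique ss = deduplicate-! (concatMap corners (tiles ss))

unique-↭ : ∀ {xs ys : List Point} → Unique xs → Unique ys →
  (∀ {v} → v ∈ xs → v ∈ ys) → (∀ {v} → v ∈ ys → v ∈ xs) → xs ↭ ys
unique-↭ u u′ f g = ∼bag⇒↭ (unique∧set⇒bag u u′ (mk⇔ f g))

==P-≡ : ∀ {u v} → (u ==P v) ≡ true → u ≡ v
==P-≡ {u} {v} e with u ≟P v
... | yes q = q
==P-≡ () | no _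

data Joined (x : Edge) (u v : Point) : Set where
  fwd : ∀ {d} → x ≡ edge d u → v ≡ go d u → Joined x u v
  bwd : ∀ {d} → x ≡ edge d v → u ≡ go d v → Joined x u v

joins⁻ : ∀ x u v → joins x u v ≡ true → Joined x u v
joins⁻ x u v e with edge-view x
joins⁻ .(edge d p) u v e | d , p , refl rewrite endpoints-edge d p
  with p ==P u in e₁ | go d p ==P v in e₂ | p ==P v in e₃ | go d p ==P u in e₄
... | true  | true  | _    | _    = fwd (cong (edge d) (==P-≡ e₁)) (≡.trans (≡.sym (==P-≡ e₂)) (cong (go d) (==P-≡ e₁)))
... | true  | false | true | true = bwd (cong (edge d) (==P-≡ e₃)) (≡.trans (≡.sym (==P-≡ e₄)) (cong (go d) (==P-≡ e₃)))
... | false | _     | true | true = bwd (cong (edge d) (==P-≡ e₃)) (≡.trans (≡.sym (==P-≡ e₄)) (cong (go d) (==P-≡ e₃)))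

joins-edge : ∀ d p → joins (edge d p) p (go d p) ≡ true
joins-edge d p rewrite endpoints-edge d p | ==P-refl p | ==P-refl (go d p) = refl

joins-sym : ∀ x u v → joins x u v ≡ joins x v u
joins-sym x u v with endpoints x
... | (y , z) = ∨-comm ((y ==P u) ∧ (z ==P v)) ((y ==P v) ∧ (z ==P u))

go-go-≢ : ∀ d e p → go d (go e p) ≢ p
go-go-≢ R R p q = ℕP.m≢1+n+m (proj₁ p) {1} (≡.sym (cong proj₁ q))
go-go-≢ R U p q = ℕP.1+n≢n (cong proj₁ q)
go-go-≢ U R p q = ℕP.1+n≢n (cong proj₁ q)
go-go-≢ U U p q = ℕP.m≢1+n+m (proj₂ p) {1} (≡.sym (cong proj₂ q))

-- The ends of an edge are ordered by their coordinates, so two points determine its base point and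
-- its direction. Hence whatever edge `find` returns is the expected one.
joined-unique : ∀ {x y u v} → Joined x u v → Joined y u v → x ≡ y
joined-unique (fwd {d} refl q) (fwd {d′} refl q′) = cong (λ d → edge d _) (go-step-injective {d} {d′} (≡.trans (≡.sym q) q′))
joined-unique (bwd {d} refl q) (bwd {d′} refl q′) = cong (λ d → edge d _) (go-step-injective {d} {d′} (≡.trans (≡.sym q) q′))
joined-unique {u = u} (fwd {d} refl refl) (bwd {d′} refl q′) = ⊥-elim (go-go-≢ d′ d u (≡.sym q′))
joined-unique {u = u} (bwd {d} refl refl) (fwd {d′} refl q′) = ⊥-elim (go-go-≢ d′ d _ (≡.sym q′))

find-just : ∀ (b : Edge → Bool) xs {x} → find (λ e → b e Bool.≟ true) xs ≡ just x → x ∈ xs × b x ≡ true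
find-just b (y ∷ ys) e with b y Bool.≟ true
find-just b (y ∷ ys) refl | yes q = here refl , q
find-just b (y ∷ ys) e    | no _  = let (i , q) = find-just b ys e in there i , q

find-nothing : ∀ (b : Edge → Bool) xs → find (λ e → b e Bool.≟ true) xs ≡ nothing → ∀ {x} → x ∈ xs → b x ≢ true
find-nothing b (y ∷ ys) e i with b y Bool.≟ true
find-nothing b (y ∷ ys) () i          | yes q
find-nothing b (y ∷ ys) e (here refl) | no ne = ne
find-nothing b (y ∷ ys) e (there i)   | no _  = find-nothing b ys e i

find-cong : ∀ (b b′ : Edge → Bool) xs → (∀ x → b x ≡ b′ x) →
  find (λ e → b e Bool.≟ true) xs ≡ find (λ e → b′ e Bool.≟ true) xs
find-cong b b′ []       e = refl
find-cong b b′ (x ∷ xs) e rewrite e x | find-cong b b′ xs e = refl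

edgeBetween-sym : ∀ ss u v → edgeBetween ss u v ≡ edgeBetween ss v u
edgeBetween-sym ss u v = find-cong (λ e → joins e u v) (λ e → joins e v u) (edges ss) (λ e → joins-sym e u v)

adjW-sym : ∀ ss w u v → adjW ss w u v ≡ adjW ss w v u
adjW-sym ss w u v with edgeBetween ss u v | edgeBetween ss v u | edgeBetween-sym ss u v
... | just x  | .(just x) | refl = refl
... | nothing | .nothing  | refl = refl

data Adjacency (ss : List Step) (w : Weighting) (u v : Point) : Set where
  apart : adjacent ss u v ≡ false → adjW ss w u v ≡ 0ℚ → Adjacency ss w u v
  joined : ∀ {x} → x ∈ edges ss → Joined x u v → adjacent ss u v ≡ true → adjW ss w u v ≡ signℚ (w x) → Adjacency ss w u v

adjacency : ∀ ss w u v → Adjacency ss w u v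
adjacency ss w u v = view _ refl
  where
  view : ∀ m → edgeBetween ss u v ≡ m → Adjacency ss w u v
  view (just x) e = let (i , q) = find-just (λ e → joins e u v) (edges ss) e in
    joined i (joins⁻ x u v q) (adj e) (wt e)
    where
    adj : edgeBetween ss u v ≡ just x → adjacent ss u v ≡ true
    adj e rewrite e = refl
    wt : edgeBetween ss u v ≡ just x → adjW ss w u v ≡ signℚ (w x)
    wt e rewrite e = refl
  view nothing e = apart adj wt
    where
    adj : adjacent ss u v ≡ false
    adj rewrite e = refl
    wt : adjW ss w u v ≡ 0ℚ
    wt rewrite e = refl

adjW-edge : ∀ ss w d p → edge d p ∈ edges ss → adjW ss w p (go d p) ≡ signℚ (w (edge d p)) × adjacent ss p (go d p) ≡ true
adjW-edge ss w d p i = view _ refl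
  where
  view : ∀ m → edgeBetween ss p (go d p) ≡ m → adjW ss w p (go d p) ≡ signℚ (w (edge d p)) × adjacent ss p (go d p) ≡ true
  view (just x) e with joined-unique (joins⁻ x p (go d p) (proj₂ (find-just (λ e → joins e p (go d p)) (edges ss) e))) (fwd {d = d} refl refl)
  ... | refl rewrite e = refl , refl
  view nothing  e = ⊥-elim (find-nothing (λ e → joins e p (go d p)) (edges ss) e i (joins-edge d p))

signℚ-unit : ∀ s → IsUnit (signℚ s)
signℚ-unit Sign.+ = refl
signℚ-unit Sign.- = refl

sumFin-lookup : ∀ (f : Point → ℚ) xs → sumFin (λ k → f (lookup xs k)) ≡ sumQ f xs
sumFin-lookup f []       = refl
sumFin-lookup f (x ∷ xs) = cong (f x +ℚ_) (sumFin-lookup f xs)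

BBtAt-gram : ∀ ss col w u v → BBtAt ss col w u v ≡ gram (adjW ss w) (whiteVs ss col) u v
BBtAt-gram ss col w u v = sumFin-lookup (λ x → adjW ss w u x *ℚ adjW ss w v x) (whiteVs ss col)

-- The fraction `n / 1` is normalised by a gcd that does not reduce for a variable `n`, so the sum
-- is compared among unnormalised fractions.
fromℚᵘ-suc : ∀ p q → ℚᵘ.1ℚᵘ ℚᵘ.+ p ℚᵘ.≃ q → 1ℚ +ℚ fromℚᵘ p ≡ fromℚᵘ q
fromℚᵘ-suc p q e = ℚP.toℚᵘ-injective (begin
  toℚᵘ (1ℚ +ℚ fromℚᵘ p)          ≈⟨ ℚP.toℚᵘ-homo-+ 1ℚ (fromℚᵘ p) ⟩
  toℚᵘ 1ℚ ℚᵘ.+ toℚᵘ (fromℚᵘ p)   ≈⟨ ℚᵘP.+-congʳ (toℚᵘ 1ℚ) (ℚP.toℚᵘ-fromℚᵘ p) ⟩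
  toℚᵘ 1ℚ ℚᵘ.+ p                 ≈⟨ e ⟩
  q                              ≈⟨ ℚᵘP.≃-sym (ℚP.toℚᵘ-fromℚᵘ q) ⟩
  toℚᵘ (fromℚᵘ q)                ∎)
  where open ℚᵘP.≃-Reasoning

sucℚ : ∀ n → 1ℚ +ℚ (ℤpos n /ℚ 1) ≡ ℤpos (suc n) /ℚ 1
sucℚ n = fromℚᵘ-suc (ℚᵘ.mkℚᵘ (ℤpos n) 0) (ℚᵘ.mkℚᵘ (ℤpos (suc n)) 0)
  (ℚᵘ.*≡* (cong (λ z → (ℤpos 1 ℤ.+ z) ℤ.* ℤpos 1) (ℤP.*-identityʳ (ℤpos n))))

-- `q` stands for the embedding of ℕ into ℚ, known only through its recursion. In the application
-- `b` tests for neighbours and `p` for white vertices: a sum of squared weights over the white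
-- vertices counts all neighbours of a black one.
sumQ-count : ∀ (q : ℕ → ℚ) → 0ℚ ≡ q 0 → (∀ n → 1ℚ +ℚ q n ≡ q (suc n)) → ∀ (f : Point → ℚ) (p b : Point → Bool) →
  (∀ x → (b x ≡ false × f x ≡ 0ℚ) ⊎ (b x ≡ true × p x ≡ true × f x ≡ 1ℚ)) → ∀ xs →
  sumQ f (filterᵇ p xs) ≡ q (length (filterᵇ b xs))
sumQ-count q q₀ q₁ f p b h [] = q₀
sumQ-count q q₀ q₁ f p b h (x ∷ xs) with b x | p x | h x
... | false | true  | inj₁ (_ , z)     = ≡.trans (0+ z) (sumQ-count q q₀ q₁ f p b h xs)
... | false | false | inj₁ (_ , z)     = sumQ-count q q₀ q₁ f p b h xs
... | true  | true  | inj₂ (_ , _ , e) = ≡.trans (cong₂ _+ℚ_ e (sumQ-count q q₀ q₁ f p b h xs)) (q₁ _)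

module Coloured (ss : List Step) (col : Colouring) (w : Weighting) (proper : ProperColouring ss col) where

  joined-colour : ∀ {x u v} → x ∈ edges ss → Joined x u v → col u ≢ col v
  joined-colour {u = u} i (fwd {d} refl refl) e = proper (edge d u) i (≡.trans (cong (col ∘ proj₁) (endpoints-edge d u))
    (≡.trans e (≡.sym (cong (col ∘ proj₂) (endpoints-edge d u)))))
  joined-colour {v = v} i (bwd {d} refl refl) e = proper (edge d v) i (≡.trans (cong (col ∘ proj₁) (endpoints-edge d v))
    (≡.trans (≡.sym e) (≡.sym (cong (col ∘ proj₂) (endpoints-edge d v)))))

  adjW-same-colour : ∀ {u v} → col u ≡ col v → adjW ss w u v ≡ 0ℚ
  adjW-same-colour {u} {v} e with adjacency ss w u v
  ... | apart _ z      = z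
  ... | joined i j _ _ = ⊥-elim (joined-colour i j e)

  adjacent-sym : ∀ u v → adjacent ss u v ≡ adjacent ss v u
  adjacent-sym u v with edgeBetween ss u v | edgeBetween ss v u | edgeBetween-sym ss u v
  ... | just x  | .(just x) | refl = refl
  ... | nothing | .nothing  | refl = refl

  neighbour : ∀ v → col v ≡ true → ∀ x → (adjacent ss x v ≡ false × adjW ss w v x *ℚ adjW ss w v x ≡ 0ℚ) ⊎
    (adjacent ss x v ≡ true × not (col x) ≡ true × adjW ss w v x *ℚ adjW ss w v x ≡ 1ℚ)
  neighbour v black x with adjacency ss w v x
  ... | apart a z          = inj₁ (≡.trans (adjacent-sym x v) a , *-zero-left (adjW ss w v x) z)
  ... | joined {y} i j a e = inj₂ (≡.trans (adjacent-sym x v) a , white (col x) (λ c → joined-colour i j (≡.trans black (≡.sym c))) ,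
    ≡.trans (cong₂ _*ℚ_ e e) (signℚ-unit (w y)))
    where
    white : ∀ c → c ≢ true → not c ≡ true
    white true  n = ⊥-elim (n refl)
    white false n = refl

  BBtAt-degree : ∀ v → col v ≡ true → BBtAt ss col w v v ≡ ℤpos (degree ss v) /ℚ 1
  BBtAt-degree v black = ≡.trans (BBtAt-gram ss col w v v) 
    (sumQ-count (λ n → ℤpos n /ℚ 1) refl sucℚ (λ x → adjW ss w v x *ℚ adjW ss w v x)
      (λ x → not (col x)) (λ x → adjacent ss x v) (neighbour v black) (vertices ss))

-- Tiles and the two boundary paths

-- The snake T_i, T_{i+1}, … with T_i = p entered in direction d (e is the other direction), together with its two
-- boundary paths from the entry edge on: `as` starts at p and `bs` at go e p.  `vs` lists all vertices.
-- The last tile is left in the direction it was entered, so that the last edge of the paths is the end edge.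
data Paths : Step → Step → Point → List Step → List Point → List Point → List Point → Set where
  end      : ∀ {d e p} → Paths d e p [] (p ∷ go d p ∷ []) (go e p ∷ go e (go d p) ∷ [])
                                        (p ∷ go e p ∷ go d p ∷ go e (go d p) ∷ [])
  straight : ∀ {d e p ss as bs vs} → Paths d e (go d p) ss as bs vs →
    Paths d e p (d ∷ ss) (p ∷ as) (go e p ∷ bs) (p ∷ go e p ∷ vs)
  turn     : ∀ {d e p ss as bs vs} → Paths e d (go e p) ss as bs vs →
    Paths d e p (e ∷ ss) (p ∷ go d p ∷ bs) as (p ∷ go d p ∷ vs)

paths : ∀ {d e} → Opp d e → ∀ p ss → Σ (List Point) λ as → Σ (List Point) λ bs → Σ (List Point) λ vs → Paths d e p ss as bs vs
paths o p []       = _ , _ , _ , end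
paths o p (s ∷ ss) with step-view o s
... | inj₁ refl = let (_ , _ , _ , q) = paths o (go s p) ss in _ , _ , _ , straight q
... | inj₂ refl = let (_ , _ , _ , q) = paths (opp-sym o) (go s p) ss in _ , _ , _ , turn q

head-as : ∀ {d e p ss as bs vs} → Paths d e p ss as bs vs → Σ (List Point) λ as′ → as ≡ p ∷ as′
head-as end          = _ , refl
head-as (straight q) = _ , refl
head-as (turn q)     = _ , refl

head-bs : ∀ {d e p ss as bs vs} → Paths d e p ss as bs vs → Σ (List Point) λ bs′ → bs ≡ go e p ∷ bs′
head-bs end          = _ , refl
head-bs (straight q) = _ , refl
head-bs (turn q)     = head-as q

p∈as : ∀ {d e p ss as bs vs} → Paths d e p ss as bs vs → p ∈ as
p∈as q with head-as q
... | _ , refl = here refl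

e∈bs : ∀ {d e p ss as bs vs} → Paths d e p ss as bs vs → go e p ∈ bs
e∈bs q with head-bs q
... | _ , refl = here refl

vs-≥ : ∀ {d e p ss as bs vs} → Paths d e p ss as bs vs → ∀ c {v} → v ∈ vs → coord c p ≤ coord c v
vs-≥ end c (here refl) = ℕP.≤-refl
vs-≥ {e = e} {p} end c (there (here refl)) = coord-≤-go e c p
vs-≥ {d} {p = p} end c (there (there (here refl))) = coord-≤-go d c p
vs-≥ {d} {e} {p} end c (there (there (there (here refl)))) = ℕP.≤-trans (coord-≤-go d c p) (coord-≤-go e c (go d p))
vs-≥ (straight q) c (here refl) = ℕP.≤-refl
vs-≥ {e = e} {p} (straight q) c (there (here refl)) = coord-≤-go e c p
vs-≥ {d} {p = p} (straight q) c (there (there i)) = ℕP.≤-trans (coord-≤-go d c p) (vs-≥ q c i)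
vs-≥ (turn q) c (here refl) = ℕP.≤-refl
vs-≥ {d} {p = p} (turn q) c (there (here refl)) = coord-≤-go d c p
vs-≥ {e = e} {p} (turn q) c (there (there i)) = ℕP.≤-trans (coord-≤-go e c p) (vs-≥ q c i)

-- No step lowers a coordinate and the step `s` raises its own. This strict inequality is what
-- separates the vertices of a new tile from the rest of the snake.
vs-> : ∀ {d e s p ss as bs vs} → Paths d e (go s p) ss as bs vs → ∀ {v} → v ∈ vs → coord s p < coord s v
vs-> {s = s} {p} q i = ℕP.≤-trans (ℕP.≤-reflexive (≡.sym (coord-go s p))) (vs-≥ q s i)

record Split (as bs vs : List Point) : Set where
  field
    as⊆    : ∀ {v} → v ∈ as → v ∈ vs
    bs⊆    : ∀ {v} → v ∈ bs → v ∈ vs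
    either : ∀ {v} → v ∈ vs → v ∈ as ⊎ v ∈ bs
    as!    : Unique as
    bs!    : Unique bs
    vs!    : Unique vs
    disj   : ∀ {v} → v ∈ as → v ∈ bs → ⊥

split-[] : Split [] [] []
split-[] = record { as⊆ = λ () ; bs⊆ = λ () ; either = λ () ; as! = [] ; bs! = [] ; vs! = [] ; disj = λ () }

split-swap : ∀ {as bs vs} → Split as bs vs → Split bs as vs
split-swap s = record { as⊆ = bs⊆ ; bs⊆ = as⊆ ; either = Sum.swap ∘ either ; as! = bs! ; bs! = as! ; vs! = vs!
                      ; disj = λ i j → disj j i }
  where open Split s

fresh : ∀ {x : Point} {vs} → x ∉ vs → All (x ≢_) vs
fresh {vs = []}     n = []
fresh {vs = v ∷ vs} n = (λ e → n (here e)) ∷ fresh (λ i → n (there i))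

split-∷ : ∀ {x as bs vs} → x ∉ vs → Split as bs vs → Split (x ∷ as) bs (x ∷ vs)
split-∷ {x} {as} {bs} {vs} n s = record
  { as⊆ = λ { (here e) → here e ; (there i) → there (as⊆ i) } ; bs⊆ = λ i → there (bs⊆ i)
  ; either = λ { (here e) → inj₁ (here e) ; (there i) → Sum.map₁ there (either i) }
  ; as! = fresh (λ i → n (as⊆ i)) ∷ as! ; bs! = bs! ; vs! = fresh n ∷ vs!
  ; disj = λ { (here refl) j → n (bs⊆ j) ; (there i) j → disj i j } }
  where open Split s

split-pair : ∀ {x y as bs vs} → x ≢ y → x ∉ vs → y ∉ vs → Split as bs vs → Split (x ∷ as) (y ∷ bs) (x ∷ y ∷ vs)
split-pair ne nx ny s = split-∷ (λ { (here e) → ne e ; (there i) → nx i }) (split-swap (split-∷ ny (split-swap s)))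

below-∉ : ∀ c {x : Point} {vs} → (∀ {v} → v ∈ vs → coord c x < coord c v) → x ∉ vs
below-∉ c h i = ℕP.<-irrefl refl (h i)

below-opp : ∀ {d e} → Opp d e → ∀ {p} {vs : List Point} → (∀ {v} → v ∈ vs → coord d p < coord d v) →
  ∀ {v} → v ∈ vs → coord d (go e p) < coord d v
below-opp o {p} h i = ≡.subst (_< _) (≡.sym (coord-go-opp (opp-sym o) p)) (h i)

split : ∀ {d e p ss as bs vs} → Opp d e → Paths d e p ss as bs vs → Split as bs vs
split {d} {e} {p} o end = split-pair (λ q → go-≢ e (≡.sym q)) (below-∉ d below) (below-∉ d (below-opp o below))
  (split-pair (λ q → go-≢ e (≡.sym q)) (λ ()) (λ ()) split-[])
  where
  below : ∀ {v} → v ∈ go d p ∷ go e (go d p) ∷ [] → coord d p < coord d v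
  below (here refl) = ℕP.≤-reflexive (≡.sym (coord-go d p))
  below (there (here refl)) = ℕP.≤-reflexive (≡.sym (≡.trans (coord-go-opp (opp-sym o) (go d p)) (coord-go d p)))
split {d} {e} {p} o (straight q) = split-pair (λ r → go-≢ e (≡.sym r)) (below-∉ d (vs-> q)) (below-∉ d (below-opp o (vs-> q))) (split o q)
split {d} {e} {p} o (turn q) = split-∷ (λ { (here r) → go-≢ d (≡.sym r) ; (there i) → below-∉ e (vs-> q) i })
  (split-∷ (below-∉ e (below-opp (opp-sym o) (vs-> q))) (split-swap (split (opp-sym o) q)))

∈-tilesFrom-head : ∀ p ss → p ∈ tilesFrom p ss
∈-tilesFrom-head p []       = here refl
∈-tilesFrom-head p (R ∷ ss) = here refl
∈-tilesFrom-head p (U ∷ ss) = here refl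

∈-tilesFrom-tail : ∀ d p ss {t} → t ∈ tilesFrom (go d p) ss → t ∈ tilesFrom p (d ∷ ss)
∈-tilesFrom-tail d p ss i = ≡.subst (_ ∈_) (≡.sym (tilesFrom-∷ d p ss)) (there i)

∈-tilesFrom⁻ : ∀ d p ss {t} → t ∈ tilesFrom p (d ∷ ss) → t ≡ p ⊎ t ∈ tilesFrom (go d p) ss
∈-tilesFrom⁻ d p ss i with ≡.subst (_ ∈_) (tilesFrom-∷ d p ss) i
... | here e  = inj₁ e
... | there j = inj₂ j

vs-corner : ∀ {d e p ss as bs vs} → Opp d e → Paths d e p ss as bs vs → ∀ {v} → v ∈ vs →
  Σ Point λ t → t ∈ tilesFrom p ss × v ∈ corners t
vs-corner o end (here refl)                         = _ , here refl , ∈-corners⁺ o c₀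
vs-corner o end (there (here refl))                 = _ , here refl , ∈-corners⁺ o c-e
vs-corner o end (there (there (here refl)))         = _ , here refl , ∈-corners⁺ o c-d
vs-corner o end (there (there (there (here refl)))) = _ , here refl , ∈-corners⁺ o c₁
vs-corner {d} {p = p} o (straight {ss = ss} q) (here refl)         = p , ∈-tilesFrom-head p (d ∷ ss) , ∈-corners⁺ o c₀
vs-corner {d} {p = p} o (straight {ss = ss} q) (there (here refl)) = p , ∈-tilesFrom-head p (d ∷ ss) , ∈-corners⁺ o c-e
vs-corner {d} {p = p} o (straight {ss = ss} q) (there (there i))   =
  let (t , j , k) = vs-corner o q i in t , ∈-tilesFrom-tail d p ss j , k
vs-corner {e = e} {p} o (turn {ss = ss} q) (here refl)         = p , ∈-tilesFrom-head p (e ∷ ss) , ∈-corners⁺ o c₀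
vs-corner {e = e} {p} o (turn {ss = ss} q) (there (here refl)) = p , ∈-tilesFrom-head p (e ∷ ss) , ∈-corners⁺ o c-d
vs-corner {e = e} {p} o (turn {ss = ss} q) (there (there i))   =
  let (t , j , k) = vs-corner (opp-sym o) q i in t , ∈-tilesFrom-tail e p ss j , k

corner-vs : ∀ {d e p ss as bs vs} → Opp d e → Paths d e p ss as bs vs → ∀ {t v} → t ∈ tilesFrom p ss → v ∈ corners t → v ∈ vs
corner-vs o end (here refl) j with ∈-corners⁻ o j
... | c₀  = here refl
... | c-e = there (here refl)
... | c-d = there (there (here refl))
... | c₁  = there (there (there (here refl)))
corner-vs {d} {e} {p} o (straight {ss = ss} q) i j with ∈-tilesFrom⁻ d p ss i
... | inj₂ i′ = there (there (corner-vs o q i′ j))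
... | inj₁ refl with ∈-corners⁻ o j
... | c₀  = here refl
... | c-e = there (here refl)
... | c-d = there (there (Split.as⊆ (split o q) (p∈as q)))
... | c₁  = there (there (Split.bs⊆ (split o q) (e∈bs q)))
corner-vs {d} {e} {p} o (turn {ss = ss} q) i j with ∈-tilesFrom⁻ e p ss i
... | inj₂ i′ = there (there (corner-vs (opp-sym o) q i′ j))
... | inj₁ refl with ∈-corners⁻ o j
... | c₀  = here refl
... | c-d = there (here refl)
... | c-e = there (there (Split.as⊆ (split (opp-sym o) q) (p∈as q)))
... | c₁  = there (there (Split.bs⊆ (split (opp-sym o) q) (≡.subst (_∈ _) (go-comm o p) (e∈bs q))))

tilesFrom-≥ : ∀ p ss {t} → t ∈ tilesFrom p ss → ∀ c → coord c p ≤ coord c t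
tilesFrom-≥ p []       (here refl) c = ℕP.≤-refl
tilesFrom-≥ p (s ∷ ss) i c with ∈-tilesFrom⁻ s p ss i
... | inj₁ refl = ℕP.≤-refl
... | inj₂ j    = ℕP.≤-trans (coord-≤-go s c p) (tilesFrom-≥ (go s p) ss j c)

tilesFrom-> : ∀ d p ss {t} → t ∈ tilesFrom (go d p) ss → coord d p < coord d t
tilesFrom-> d p ss i = ℕP.≤-trans (ℕP.≤-reflexive (≡.sym (coord-go d p))) (tilesFrom-≥ (go d p) ss i d)

-- The two summands are ±1 and their product is the product of all four signs, hence -1, so they are
-- opposite. The first identity serves tiles whose corner `p` is black, the second those where it is
-- white.
negative-cell : ∀ a b c f → a Sign.* b Sign.* c Sign.* f ≡ Sign.- →
  signℚ c *ℚ signℚ b +ℚ signℚ a *ℚ signℚ f ≡ 0ℚ × signℚ c *ℚ signℚ a +ℚ signℚ b *ℚ signℚ f ≡ 0ℚ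
negative-cell Sign.+ Sign.+ Sign.+ Sign.+ ()
negative-cell Sign.+ Sign.+ Sign.+ Sign.- e = refl , refl
negative-cell Sign.+ Sign.+ Sign.- Sign.+ e = refl , refl
negative-cell Sign.+ Sign.+ Sign.- Sign.- ()
negative-cell Sign.+ Sign.- Sign.+ Sign.+ e = refl , refl
negative-cell Sign.+ Sign.- Sign.+ Sign.- ()
negative-cell Sign.+ Sign.- Sign.- Sign.+ ()
negative-cell Sign.+ Sign.- Sign.- Sign.- e = refl , refl
negative-cell Sign.- Sign.+ Sign.+ Sign.+ e = refl , refl
negative-cell Sign.- Sign.+ Sign.+ Sign.- ()
negative-cell Sign.- Sign.+ Sign.- Sign.+ ()
negative-cell Sign.- Sign.+ Sign.- Sign.- e = refl , refl
negative-cell Sign.- Sign.- Sign.+ Sign.+ ()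
negative-cell Sign.- Sign.- Sign.+ Sign.- e = refl , refl
negative-cell Sign.- Sign.- Sign.- Sign.+ e = refl , refl
negative-cell Sign.- Sign.- Sign.- Sign.- ()

-- The sign test in `negCount` is local to it, so the signs are passed as variables with equations;
-- after splitting and rewriting, the count computes.
odd-negCount : ∀ w x₁ x₂ x₃ x₄ s₁ s₂ s₃ s₄ → w x₁ ≡ s₁ → w x₂ ≡ s₂ → w x₃ ≡ s₃ → w x₄ ≡ s₄ →
  Odd (negCount w (x₁ ∷ x₂ ∷ x₃ ∷ x₄ ∷ [])) → w x₁ Sign.* w x₂ Sign.* w x₃ Sign.* w x₄ ≡ Sign.-
odd-negCount w x₁ x₂ x₃ x₄ Sign.+ Sign.+ Sign.+ Sign.+ e₁ e₂ e₃ e₄ rewrite e₁ | e₂ | e₃ | e₄ = λ ()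
odd-negCount w x₁ x₂ x₃ x₄ Sign.+ Sign.+ Sign.+ Sign.- e₁ e₂ e₃ e₄ rewrite e₁ | e₂ | e₃ | e₄ = λ _ → refl
odd-negCount w x₁ x₂ x₃ x₄ Sign.+ Sign.+ Sign.- Sign.+ e₁ e₂ e₃ e₄ rewrite e₁ | e₂ | e₃ | e₄ = λ _ → refl
odd-negCount w x₁ x₂ x₃ x₄ Sign.+ Sign.+ Sign.- Sign.- e₁ e₂ e₃ e₄ rewrite e₁ | e₂ | e₃ | e₄ = λ ()
odd-negCount w x₁ x₂ x₃ x₄ Sign.+ Sign.- Sign.+ Sign.+ e₁ e₂ e₃ e₄ rewrite e₁ | e₂ | e₃ | e₄ = λ _ → refl
odd-negCount w x₁ x₂ x₃ x₄ Sign.+ Sign.- Sign.+ Sign.- e₁ e₂ e₃ e₄ rewrite e₁ | e₂ | e₃ | e₄ = λ ()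
odd-negCount w x₁ x₂ x₃ x₄ Sign.+ Sign.- Sign.- Sign.+ e₁ e₂ e₃ e₄ rewrite e₁ | e₂ | e₃ | e₄ = λ ()
odd-negCount w x₁ x₂ x₃ x₄ Sign.+ Sign.- Sign.- Sign.- e₁ e₂ e₃ e₄ rewrite e₁ | e₂ | e₃ | e₄ = λ _ → refl
odd-negCount w x₁ x₂ x₃ x₄ Sign.- Sign.+ Sign.+ Sign.+ e₁ e₂ e₃ e₄ rewrite e₁ | e₂ | e₃ | e₄ = λ _ → refl
odd-negCount w x₁ x₂ x₃ x₄ Sign.- Sign.+ Sign.+ Sign.- e₁ e₂ e₃ e₄ rewrite e₁ | e₂ | e₃ | e₄ = λ ()
odd-negCount w x₁ x₂ x₃ x₄ Sign.- Sign.+ Sign.- Sign.+ e₁ e₂ e₃ e₄ rewrite e₁ | e₂ | e₃ | e₄ = λ ()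
odd-negCount w x₁ x₂ x₃ x₄ Sign.- Sign.+ Sign.- Sign.- e₁ e₂ e₃ e₄ rewrite e₁ | e₂ | e₃ | e₄ = λ _ → refl
odd-negCount w x₁ x₂ x₃ x₄ Sign.- Sign.- Sign.+ Sign.+ e₁ e₂ e₃ e₄ rewrite e₁ | e₂ | e₃ | e₄ = λ ()
odd-negCount w x₁ x₂ x₃ x₄ Sign.- Sign.- Sign.+ Sign.- e₁ e₂ e₃ e₄ rewrite e₁ | e₂ | e₃ | e₄ = λ _ → refl
odd-negCount w x₁ x₂ x₃ x₄ Sign.- Sign.- Sign.- Sign.+ e₁ e₂ e₃ e₄ rewrite e₁ | e₂ | e₃ | e₄ = λ _ → refl
odd-negCount w x₁ x₂ x₃ x₄ Sign.- Sign.- Sign.- Sign.- e₁ e₂ e₃ e₄ rewrite e₁ | e₂ | e₃ | e₄ = λ ()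

kasteleyn-sign-RU : ∀ w p → KastFace 4 (negCount w (sides p)) →
  w (hor p) Sign.* w (hor (go U p)) Sign.* w (ver p) Sign.* w (ver (go R p)) ≡ Sign.-
kasteleyn-sign-RU w p (odd , _) = odd-negCount w _ _ _ _ _ _ _ _ refl refl refl refl (odd refl)

kasteleyn-sign : ∀ {d e} → Opp d e → ∀ w p → KastFace 4 (negCount w (sides p)) →
  w (edge d p) Sign.* w (edge d (go e p)) Sign.* w (edge e p) Sign.* w (edge e (go d p)) ≡ Sign.-
kasteleyn-sign RU w p k = kasteleyn-sign-RU w p k
kasteleyn-sign UR w p k = ≡.trans (rotate (w (ver p)) (w (ver (go R p))) (w (hor p)) (w (hor (go U p)))) (kasteleyn-sign-RU w p k)
  where
  rotate : ∀ a b c f → a Sign.* b Sign.* c Sign.* f ≡ c Sign.* f Sign.* a Sign.* b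
  rotate a b c f = ≡.trans (SignP.*-assoc (a Sign.* b) c f)
    (≡.trans (SignP.*-comm (a Sign.* b) (c Sign.* f)) (≡.sym (SignP.*-assoc (c Sign.* f) a b)))

filterᵇ-true : ∀ (b : Point → Bool) {x xs} → b x ≡ true → filterᵇ b (x ∷ xs) ≡ x ∷ filterᵇ b xs
filterᵇ-true b e rewrite e = refl

filterᵇ-false : ∀ (b : Point → Bool) {x xs} → b x ≡ false → filterᵇ b (x ∷ xs) ≡ filterᵇ b xs
filterᵇ-false b e rewrite e = refl

∈-filterᵇ⁻ : ∀ (b : Point → Bool) {xs v} → v ∈ filterᵇ b xs → v ∈ xs × b v ≡ true
∈-filterᵇ⁻ b i = let (j , t) = ∈-filter⁻ (λ x → Bool.T? (b x)) i in j , Equivalence.to T-≡ t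

∈-filterᵇ⁺ : ∀ (b : Point → Bool) {xs v} → v ∈ xs → b v ≡ true → v ∈ filterᵇ b xs
∈-filterᵇ⁺ b i e = ∈-filter⁺ (λ x → Bool.T? (b x)) i (Equivalence.from T-≡ e)

filterᵇ-unique : ∀ (b : Point → Bool) {xs} → Unique xs → Unique (filterᵇ b xs)
filterᵇ-unique b = Unique.filter⁺ (λ x → Bool.T? (b x))

≢-colour : ∀ {a b : Bool} → a ≢ b → a ≡ not b
≢-colour {true}  {true}  n = ⊥-elim (n refl)
≢-colour {true}  {false} n = refl
≢-colour {false} {true}  n = refl
≢-colour {false} {false} n = ⊥-elim (n refl)

last-∈ : ∀ {xs : List Point} {v} → last xs ≡ just v → v ∈ xs
last-∈ {x ∷ []}     refl = here refl
last-∈ {x ∷ y ∷ xs} e    = there (last-∈ {y ∷ xs} e)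

tilesFrom-last : ∀ d p ss → last (tilesFrom p (d ∷ ss)) ≡ last (tilesFrom (go d p) ss)
tilesFrom-last R p []       = refl
tilesFrom-last U p []       = refl
tilesFrom-last R p (R ∷ ss) = refl
tilesFrom-last R p (U ∷ ss) = refl
tilesFrom-last U p (R ∷ ss) = refl
tilesFrom-last U p (U ∷ ss) = refl

last-just : ∀ p ss → Σ Point λ t → last (tilesFrom p ss) ≡ just t
last-just p []       = p , refl
last-just p (s ∷ ss) = let (t , e) = last-just (go s p) ss in t , ≡.trans (tilesFrom-last s p ss) e

lastTile-last : ∀ ss → last (tiles ss) ≡ just (lastTile ss)
lastTile-last ss with last (tiles ss) | last-just (0 , 0) ss
... | just t | _ = refl

memP-≢ : ∀ {v} xs → (∀ {x} → x ∈ xs → v ≢ x) → memP v xs ≡ false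
memP-≢ []       n = refl
memP-≢ (x ∷ xs) n rewrite ==P-≢ (n (here refl)) = memP-≢ xs (λ i → n (there i))

-- From the coloured graph to a `Snake`

module Growing (ss₀ : List Step) (col : Colouring) (w : Weighting) (proper : ProperColouring ss₀ col)
  (turns : TurnsBlack ss₀ col) (kast : ∀ t → t ∈ tiles ss₀ → KastFace 4 (negCount w (sides t))) where

  open Coloured ss₀ col w proper
  M = adjW ss₀ w
  open Ladder M
  white = λ v → not (col v)

  -- Every edge joins a point to its right or upper neighbour, and of these steps only `go d` raises
  -- the coordinate `d`.
  M-apart : ∀ {d e} → Opp d e → ∀ {x v} → coord d x < coord d v → v ≢ go d x → M x v ≡ 0ℚ
  M-apart o {x} {v} l n with adjacency ss₀ w x v
  ... | apart _ z = z
  M-apart o {x} {v} l n | joined _ (fwd {s} _ refl) _ _ with step-view o s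
  ... | inj₁ refl = ⊥-elim (n refl)
  ... | inj₂ refl = ⊥-elim (ℕP.<-irrefl (≡.sym (coord-go-opp (opp-sym o) x)) l)
  M-apart {d} o {x} {v} l n | joined _ (bwd {s} _ refl) _ _ = ⊥-elim (ℕP.<⇒≱ l (coord-≤-go s d v))

  M-edge : ∀ {p t} → t ∈ tiles ss₀ → ∀ d → edge d p ∈ sides t → M p (go d p) ≡ signℚ (w (edge d p))
  M-edge {p} i d j = proj₁ (adjW-edge ss₀ w d p (∈-edges⁺ ss₀ i j))

  M-edge′ : ∀ {p t} → t ∈ tiles ss₀ → ∀ d → edge d p ∈ sides t → M (go d p) p ≡ signℚ (w (edge d p))
  M-edge′ {p} i d j = ≡.trans (adjW-sym ss₀ w (go d p) p) (M-edge i d j)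

  col-edge : ∀ {p t} → t ∈ tiles ss₀ → ∀ d → edge d p ∈ sides t → col p ≡ not (col (go d p))
  col-edge {p} i d j = ≢-colour (joined-colour (∈-edges⁺ ss₀ i j) (fwd {d = d} refl refl))

  unit : ∀ {a} s → a ≡ signℚ s → IsUnit a
  unit s refl = signℚ-unit s

  module Tile {d e} (o : Opp d e) {p} (i : p ∈ tiles ss₀) where
    private
      s₁ : edge d p ∈ sides p
      s₁ = ∈-sides⁺ o near-d
      s₂ : edge d (go e p) ∈ sides p
      s₂ = ∈-sides⁺ o far-d
      s₃ : edge e p ∈ sides p
      s₃ = ∈-sides⁺ o near-e
      s₄ : edge e (go d p) ∈ sides p
      s₄ = ∈-sides⁺ o far-e
      neg = negative-cell (w (edge d p)) (w (edge d (go e p))) (w (edge e p)) (w (edge e (go d p))) (kasteleyn-sign o w p (kast p i))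
      m₄ : M (go d p) (go d (go e p)) ≡ signℚ (w (edge e (go d p)))
      m₄ = ≡.trans (cong (M (go d p)) (go-comm o p)) (M-edge i e s₄)

    -- Named after the colour of `p` in its use, where `x = p`; `cell-white` describes the same tile
    -- with `x = go e p`. The identities themselves do not refer to the colouring.
    cell-black : Cell p (go e p) (go d (go e p)) (go d p)
    cell-black = record
      { xω = unit (w (edge d p)) (M-edge i d s₁) ; xy = unit (w (edge e p)) (M-edge i e s₃) ; βy = unit (w (edge d (go e p))) (M-edge′ i d s₂)
      ; orthogonal = ≡.trans (cong₂ _+ℚ_ (cong₂ _*ℚ_ (M-edge i e s₃) (M-edge′ i d s₂))
          (cong₂ _*ℚ_ (M-edge i d s₁) (≡.trans (adjW-sym ss₀ w _ _) m₄))) (proj₁ neg) }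

    cell-white : Cell (go e p) p (go d p) (go d (go e p))
    cell-white = record
      { xω = unit (w (edge d (go e p))) (M-edge i d s₂) ; xy = unit (w (edge e p)) (M-edge′ i e s₃) ; βy = unit (w (edge d p)) (M-edge′ i d s₁)
      ; orthogonal = ≡.trans (cong₂ _+ℚ_ (cong₂ _*ℚ_ (M-edge′ i e s₃) (M-edge′ i d s₁))
          (cong₂ _*ℚ_ (M-edge i d s₂) m₄)) (proj₂ neg) }

    col-e : col p ≡ not (col (go e p))
    col-e = col-edge i e s₃
    col-d : col p ≡ not (col (go d p))
    col-d = col-edge i d s₁

  -- A partial snake whose last edge has the black end β, on the path bsB, and the white end ω, on the path bsW.
  Half : Point → Point → List Point → List Point → List Point → Set
  Half β ω bsW bsB vs = col β ≡ true × col ω ≡ false × Σ (List Point) λ bB → Σ (List Point) λ ws →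
    filterᵇ col bsB ≡ β ∷ bB × filterᵇ white vs ≡ ω ∷ ws × Snake (filterᵇ col bsW) β bB ω ws

  State : Point → Point → List Point → List Point → List Point → Set
  State α β as bs vs = Half α β bs as vs ⊎ Half β α as bs vs

  -- All old vertices lie strictly beyond `x` and `y` in direction `d`, so `x` and `y` can reach
  -- only `go d x` and `go d y`. These are `ω` and `β`, which uniqueness and disjointness exclude
  -- from the lists in question.
  attach : ∀ {d e} → Opp d e → ∀ {x y bsW bsB vs bB ws} → Split bsB bsW vs → go d y ∈ bsB →
    Cell x y (go d y) (go d x) → (∀ {v} → v ∈ vs → coord d x < coord d v) → (∀ {v} → v ∈ vs → coord d y < coord d v) →
    filterᵇ col bsB ≡ go d y ∷ bB → filterᵇ white vs ≡ go d x ∷ ws →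
    Attach x y (filterᵇ col bsW) (go d y) bB (go d x) ws
  attach {d} o {x} {y} {bsW} {bsB} {vs} {bB} {ws} sp β∈ cell lx ly eB eW = record
    { cell = cell
    ; x-apart = λ {v} i → M-apart o (lx (ws⊆ i)) (λ { refl → head-∉ (filterᵇ-unique white vs!) eW i })
    ; W-apart = λ {v} i → let j = proj₁ (∈-filterᵇ⁻ col i) in
        ≡.trans (adjW-sym ss₀ w v y) (M-apart o (ly (bs⊆ j)) (λ { refl → disj β∈ j }))
    ; B-apart = λ {v} i → ≡.trans (adjW-sym ss₀ w v y)
        (M-apart o (ly (as⊆ (proj₁ (∈-filterᵇ⁻ col (≡.subst (_ ∈_) (≡.sym eB) (there i))))))
                   (λ { refl → head-∉ (filterᵇ-unique col as!) eB i })) }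
    where
    open Split sp
    ws⊆ : ∀ {v} → v ∈ ws → v ∈ vs
    ws⊆ i = proj₁ (∈-filterᵇ⁻ white (≡.subst (_ ∈_) (≡.sym eW) (there i)))
    head-∉ : ∀ {x : Point} {xs ys} → Unique ys → ys ≡ x ∷ xs → x ∉ xs
    head-∉ (n ∷ u) refl i = All.lookup n i refl

  -- Across a straight tile the black end changes to the other path, so the two alternatives of
  -- `State` are exchanged.
  state-straight : ∀ {d e} → Opp d e → ∀ {p as bs vs} → p ∈ tiles ss₀ → Split as bs vs →
    go d p ∈ as → go d (go e p) ∈ bs → (∀ {v} → v ∈ vs → coord d p < coord d v) →
    State (go d p) (go d (go e p)) as bs vs → State p (go e p) (p ∷ as) (go e p ∷ bs) (p ∷ go e p ∷ vs)
  state-straight {d} {e} o {p} {as} {bs} {vs} i sp a∈ b∈ l (inj₁ (cβ , cω , bB , ws , eB , eW , s)) =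
    inj₂ (cy , cx , filterᵇ col bs , go d (go e p) ∷ ws , filterᵇ-true col cy ,
      ≡.trans (filterᵇ-true white (cong not cx)) (cong (p ∷_) (≡.trans (filterᵇ-false white (cong not cy)) eW)) ,
      ≡.subst (λ z → Snake z _ _ _ _) (≡.sym (≡.trans (filterᵇ-false col cx) eB))
        (straight (attach o sp a∈ cell-white (below-opp o l) l eB eW) s))
    where
    open Tile o i
    cx : col p ≡ false
    cx = ≡.trans col-d (cong not cβ)
    cy : col (go e p) ≡ true
    cy = true′ (col (go e p)) (≡.trans (≡.sym cx) col-e)
      where true′ : ∀ b → false ≡ not b → b ≡ true
            true′ true  _ = refl
            true′ false ()
  state-straight {d} {e} o {p} {as} {bs} {vs} i sp a∈ b∈ l (inj₂ (cβ , cω , bB , ws , eB , eW , s)) =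
    inj₁ (cx , cy , filterᵇ col as , go d p ∷ ws , filterᵇ-true col cx ,
      ≡.trans (filterᵇ-false white (cong not cx)) (≡.trans (filterᵇ-true white (cong not cy)) (cong (go e p ∷_) eW)) ,
      ≡.subst (λ z → Snake z _ _ _ _) (≡.sym (≡.trans (filterᵇ-false col cy) eB))
        (straight (attach o (split-swap sp) b∈ cell-black l (below-opp o l) eB eW) s))
    where
    open Tile o i
    cx : col p ≡ true
    cx = ≡.trans col-d (cong not cω)
    cy : col (go e p) ≡ false
    cy = false′ (col (go e p)) (≡.trans (≡.sym cx) col-e)
      where false′ : ∀ b → true ≡ not b → b ≡ false
            false′ false _ = refl
            false′ true  ()

  -- The pivot `go e p` is opposite to the black corner `go d p`, so it is black and remains the
  -- black end. The other alternative would make the neighbours `p` and `go e p` both white.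
  state-turn : ∀ {d e} → Opp d e → ∀ {p as bs vs} → p ∈ tiles ss₀ → Split as bs vs →
    go e p ∈ as → (∀ {v} → v ∈ vs → coord e p < coord e v) → col (go d p) ≡ true →
    State (go e p) (go e (go d p)) as bs vs → State p (go e p) (p ∷ go d p ∷ bs) as (p ∷ go d p ∷ vs)
  state-turn {d} {e} o {p} {as} {bs} {vs} i sp a∈ l ck st = finish st
    where
    open Tile (opp-sym o) i
    cp : col p ≡ false
    cp = ≡.trans col-e (cong not ck)
    finish : State (go e p) (go e (go d p)) as bs vs → State p (go e p) (p ∷ go d p ∷ bs) as (p ∷ go d p ∷ vs)
    finish (inj₁ (cβ , cω , bB , ws , eB , eW , s)) =
      inj₂ (cβ , cp , bB , go e (go d p) ∷ ws , eB ,
        ≡.trans (filterᵇ-true white (cong not cp)) (cong (p ∷_) (≡.trans (filterᵇ-false white (cong not ck)) eW)) ,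
        ≡.subst (λ z → Snake z _ _ _ _) (≡.sym (≡.trans (filterᵇ-false col cp) (filterᵇ-true col ck)))
          (turn (attach (opp-sym o) sp a∈ cell-white (below-opp (opp-sym o) l) l eB eW) s))
    finish (inj₂ (cβ , cω , _)) with ≡.trans (≡.sym cp) (≡.trans col-d (cong not cω))
    ... | ()

  state-edge : ∀ α β → col α ≡ not (col β) → State α β (α ∷ []) (β ∷ []) (α ∷ β ∷ [])
  state-edge α β e = view (col β) refl
    where
    view : ∀ b → col β ≡ b → State α β (α ∷ []) (β ∷ []) (α ∷ β ∷ [])
    view true cβ = inj₂ (cβ , cα , [] , [] , filterᵇ-true col cβ ,
      ≡.trans (filterᵇ-true white (cong not cα)) (cong (α ∷_) (filterᵇ-false white (cong not cβ))) ,
      ≡.subst (λ z → Snake z _ _ _ _) (≡.sym (filterᵇ-false col cα)) (lastEdge β α))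
      where
      cα = ≡.trans e (cong not cβ)
    view false cβ = inj₁ (cα , cβ , [] , [] , filterᵇ-true col cα ,
      ≡.trans (filterᵇ-false white (cong not cα)) (filterᵇ-true white (cong not cβ)) ,
      ≡.subst (λ z → Snake z _ _ _ _) (≡.sym (filterᵇ-false col cβ)) (lastEdge α β))
      where
      cα = ≡.trans e (cong not cβ)

  -- The degree of a turn is taken in the whole graph, so the tiles before `p` must be located too.
  -- Their weak bound in direction `e` becomes strict once the snake turns. `entered` keeps the turn
  -- away from the excluded corners of the first tile, `ends` from those of the last.
  record Suffix (d e : Step) (p : Point) (ss : List Step) : Set where
    field
      inside  : ∀ {t} → t ∈ tilesFrom p ss → t ∈ tiles ss₀
      earlier : ∀ {t} → t ∈ tiles ss₀ → t ∈ tilesFrom p ss ⊎ (coord d t < coord d p × coord e t ≤ coord e p)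
      entered : 1 ≤ coord d p
      ends    : last (tilesFrom p ss) ≡ last (tiles ss₀)

  suffix-straight : ∀ {d e} → Opp d e → ∀ {p ss} → Suffix d e p (d ∷ ss) → Suffix d e (go d p) ss
  suffix-straight {d} {e} o {p} {ss} x = record
    { inside = λ i → inside (∈-tilesFrom-tail d p ss i)
    ; earlier = earlier′
    ; entered = ℕP.≤-trans entered (coord-≤-go d d p)
    ; ends = ≡.trans (≡.sym (tilesFrom-last d p ss)) ends }
    where
    open Suffix x
    earlier′ : ∀ {t} → t ∈ tiles ss₀ → t ∈ tilesFrom (go d p) ss ⊎ (coord d t < coord d (go d p) × coord e t ≤ coord e (go d p))
    earlier′ i with earlier i
    ... | inj₂ (l , m) = inj₂ (ℕP.<-≤-trans l (coord-≤-go d d p) , ℕP.≤-trans m (coord-≤-go d e p))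
    ... | inj₁ j with ∈-tilesFrom⁻ d p ss j
    ... | inj₁ refl = inj₂ (ℕP.≤-reflexive (≡.sym (coord-go d p)) , coord-≤-go d e p)
    ... | inj₂ k    = inj₁ k

  suffix-turn : ∀ {d e} → Opp d e → ∀ {p ss} → Suffix d e p (e ∷ ss) → Suffix e d (go e p) ss
  suffix-turn {d} {e} o {p} {ss} x = record
    { inside = λ i → inside (∈-tilesFrom-tail e p ss i)
    ; earlier = earlier′
    ; entered = ℕP.≤-trans (s≤s z≤n) (ℕP.≤-reflexive (≡.sym (coord-go e p)))
    ; ends = ≡.trans (≡.sym (tilesFrom-last e p ss)) ends }
    where
    open Suffix x
    earlier′ : ∀ {t} → t ∈ tiles ss₀ → t ∈ tilesFrom (go e p) ss ⊎ (coord e t < coord e (go e p) × coord d t ≤ coord d (go e p))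
    earlier′ i with earlier i
    ... | inj₂ (l , m) = inj₂ (ℕP.≤-trans (s≤s m) (ℕP.≤-reflexive (≡.sym (coord-go e p))) ,
                               ℕP.≤-trans (ℕP.<⇒≤ l) (coord-≤-go e d p))
    ... | inj₁ j with ∈-tilesFrom⁻ e p ss j
    ... | inj₁ refl = inj₂ (ℕP.≤-reflexive (≡.sym (coord-go e p)) , coord-≤-go e d p)
    ... | inj₂ k    = inj₁ k

  -- The corner go d p of a turning tile has degree 2, so it is a turn.
  module TurnTile {d e} (o : Opp d e) {p ss} (x : Suffix d e p (e ∷ ss)) where
    open Suffix x
    k = go d p
    p∈tiles : p ∈ tiles ss₀
    p∈tiles = inside (∈-tilesFrom-head p (e ∷ ss))

    ck-d : coord d k ≡ suc (coord d p)
    ck-d = coord-go d p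
    ck-e : coord e k ≡ coord e p
    ck-e = coord-go-opp o p

    -- Shaped to rule out two of the four lattice neighbours of `k`: the one below it in direction
    -- `e` and the one beyond it in direction `d`.
    vertex-bounds : ∀ {u} → u ∈ vertices ss₀ →
      coord d u ≤ coord d p ⊎ (coord e p ≤ coord e u × (coord d u ≤ suc (coord d p) ⊎ coord e p < coord e u))
    vertex-bounds {u} i with ∈-vertices⁻ ss₀ i
    ... | t , j , c with earlier j
    ... | inj₂ (l , _) = inj₁ (ℕP.≤-trans (corner-≤ c d) l)
    ... | inj₁ j′ with ∈-tilesFrom⁻ e p ss j′
    ... | inj₁ refl = inj₂ (corner-≥ c e , inj₁ (corner-≤ c d))
    ... | inj₂ j″   = let l = ℕP.<-≤-trans (tilesFrom-> e p ss j″) (corner-≥ c e) in inj₂ (ℕP.<⇒≤ l , inj₂ l)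

    neighbour-k : ∀ {u} → u ∈ vertices ss₀ → adjacent ss₀ u k ≡ true → u ≡ p ⊎ u ≡ go e k
    neighbour-k {u} i a with adjacency ss₀ w u k
    ... | apart b _ with ≡.trans (≡.sym a) b
    ... | ()
    neighbour-k {u} i a | joined _ (fwd {s} _ q) _ _ with step-view o s
    ... | inj₁ refl = inj₁ (go-injective s (≡.sym q))
    ... | inj₂ refl = ⊥-elim (impossible (vertex-bounds i))
      where
      du : coord d u ≡ suc (coord d p)
      du = ≡.trans (≡.sym (coord-go-opp (opp-sym o) u)) (≡.trans (cong (coord d) (≡.sym q)) ck-d)
      eu : suc (coord e u) ≡ coord e p
      eu = ≡.trans (≡.sym (coord-go e u)) (≡.trans (cong (coord e) (≡.sym q)) ck-e)
      impossible : coord d u ≤ coord d p ⊎ (coord e p ≤ coord e u × (coord d u ≤ suc (coord d p) ⊎ coord e p < coord e u)) → ⊥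
      impossible (inj₁ l)       = ℕP.<⇒≱ (ℕP.≤-reflexive (≡.sym du)) l
      impossible (inj₂ (l , _)) = ℕP.<⇒≱ (ℕP.≤-reflexive eu) l
    neighbour-k {u} i a | joined _ (bwd {s} _ q) _ _ with step-view o s
    ... | inj₂ refl = inj₂ q
    ... | inj₁ refl = ⊥-elim (impossible (vertex-bounds i))
      where
      du : coord d u ≡ suc (suc (coord d p))
      du = ≡.trans (cong (coord d) q) (≡.trans (coord-go d k) (cong suc ck-d))
      eu : coord e u ≡ coord e p
      eu = ≡.trans (cong (coord e) q) (≡.trans (coord-go-opp o k) ck-e)
      impossible : coord d u ≤ coord d p ⊎ (coord e p ≤ coord e u × (coord d u ≤ suc (coord d p) ⊎ coord e p < coord e u)) → ⊥
      impossible (inj₁ l)            = ℕP.<⇒≱ (ℕP.≤-trans (ℕP.n≤1+n _) (ℕP.≤-reflexive (≡.sym du))) l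
      impossible (inj₂ (_ , inj₁ l)) = ℕP.<⇒≱ (ℕP.≤-reflexive (≡.sym du)) l
      impossible (inj₂ (_ , inj₂ l)) = ℕP.<-irrefl (≡.sym eu) l

    adjacent-p : adjacent ss₀ p k ≡ true
    adjacent-p = proj₂ (adjW-edge ss₀ w d p (∈-edges⁺ ss₀ p∈tiles (∈-sides⁺ o near-d)))

    adjacent-e : adjacent ss₀ (go e k) k ≡ true
    adjacent-e = ≡.trans (adjacent-sym (go e k) k) (proj₂ (adjW-edge ss₀ w e k (∈-edges⁺ ss₀ p∈tiles (∈-sides⁺ o far-e))))

    degree-k : degree ss₀ k ≡ 2
    degree-k = ↭-length (unique-↭ {ys = p ∷ go e k ∷ []} (filterᵇ-unique (λ u → adjacent ss₀ u k) (vertices-unique ss₀))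
      ((p≢ ∷ []) ∷ [] ∷ [])
      (λ i → let (j , a) = ∈-filterᵇ⁻ (λ u → adjacent ss₀ u k) i in
        Sum.[ (λ { refl → here refl }) , (λ { refl → there (here refl) }) ] (neighbour-k j a))
      (λ { (here refl) → ∈-filterᵇ⁺ (λ u → adjacent ss₀ u k) (∈-vertices⁺ ss₀ p∈tiles (∈-corners⁺ o c₀)) adjacent-p
         ; (there (here refl)) → ∈-filterᵇ⁺ (λ u → adjacent ss₀ u k) (∈-vertices⁺ ss₀ p∈tiles (∈-corners⁺ o c₁)) adjacent-e }))
      where
      p≢ : p ≢ go e k
      p≢ q = ℕP.<-irrefl (≡.trans (cong (coord e) q) (coord-go e k)) (s≤s (ℕP.≤-reflexive (≡.sym ck-e)))

    last-above : coord e p < coord e (lastTile ss₀)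
    last-above = tilesFrom-> e p ss (last-∈ (≡.trans (≡.sym (tilesFrom-last e p ss)) (≡.trans ends (lastTile-last ss₀))))

    small-≢ : ∀ {v} → coord d v ≤ 1 → k ≢ v
    small-≢ l refl = ℕP.<⇒≱ (ℕP.≤-trans (s≤s entered) (ℕP.≤-reflexive (≡.sym ck-d))) l

    last-≢ : ∀ {v} → v ∈ corners (lastTile ss₀) → k ≢ v
    last-≢ i refl = ℕP.<⇒≱ (ℕP.<-≤-trans last-above (corner-≥ i e)) (ℕP.≤-reflexive ck-e)

    one : ∀ c → coord c (1 , 0) ≤ 1 × coord c (0 , 0) ≤ 1 × coord c (0 , 1) ≤ 1
    one R = s≤s z≤n , z≤n , z≤n
    one U = z≤n , z≤n , s≤s z≤n

    k-not-excluded : ∀ {v} → v ∈ excluded ss₀ → k ≢ v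
    k-not-excluded (here refl)                                 = small-≢ (proj₁ (one d))
    k-not-excluded (there (here refl))                         = small-≢ (proj₁ (proj₂ (one d)))
    k-not-excluded (there (there (here refl)))                 = small-≢ (proj₂ (proj₂ (one d)))
    k-not-excluded (there (there (there (here refl))))         = last-≢ (∈-corners⁺ RU c-e)
    k-not-excluded (there (there (there (there (here refl))))) = last-≢ (∈-corners⁺ RU c₁)
    k-not-excluded (there (there (there (there (there (here refl)))))) = last-≢ (∈-corners⁺ RU c-d)

    k-black : col k ≡ true
    k-black = turns k (∈-vertices⁺ ss₀ p∈tiles (∈-corners⁺ o c-d))
      (inj₁ degree-k , Equivalence.from T-≡ (cong not (memP-≢ (excluded ss₀) k-not-excluded)))

  -- The last tile is treated as straight, so the recursion bottoms out in the end edge alone, which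
  -- has one vertex of each colour.
  state-end : ∀ {d e} → Opp d e → ∀ {p} → p ∈ tiles ss₀ →
    State p (go e p) (p ∷ go d p ∷ []) (go e p ∷ go e (go d p) ∷ []) (p ∷ go e p ∷ go d p ∷ go e (go d p) ∷ [])
  state-end {d} {e} o {p} i = ≡.subst
    (λ z → State p (go e p) (p ∷ go d p ∷ []) (go e p ∷ z ∷ []) (p ∷ go e p ∷ go d p ∷ z ∷ [])) (go-comm o p)
    (state-straight o i (split-pair (λ q → go-≢ e (≡.sym (≡.trans q (go-comm o p)))) (λ ()) (λ ()) split-[]) (here refl) (here refl) below
      (state-edge (go d p) (go d (go e p))
        (≡.trans (col-edge i e (∈-sides⁺ o far-e)) (cong (λ z → not (col z)) (≡.sym (go-comm o p))))))
    where
    below : ∀ {v} → v ∈ go d p ∷ go d (go e p) ∷ [] → coord d p < coord d v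
    below (here refl) = ℕP.≤-reflexive (≡.sym (coord-go d p))
    below (there (here refl)) = ℕP.≤-reflexive (≡.sym (≡.trans (coord-go d (go e p)) (cong suc (coord-go-opp (opp-sym o) p))))

  state-straight′ : ∀ {d e} → Opp d e → ∀ {p ss as bs vs} → p ∈ tiles ss₀ → Paths d e (go d p) ss as bs vs →
    State (go d p) (go e (go d p)) as bs vs → State p (go e p) (p ∷ as) (go e p ∷ bs) (p ∷ go e p ∷ vs)
  state-straight′ o {p} {as = as} {bs} {vs} i q s = state-straight o i (split o q) (p∈as q)
    (≡.subst (_∈ bs) (≡.sym (go-comm o p)) (e∈bs q)) (vs-> q)
    (≡.subst (λ z → State _ z as bs vs) (≡.sym (go-comm o p)) s)

  state : ∀ {d e} → Opp d e → ∀ {p ss as bs vs} → Paths d e p ss as bs vs → Suffix d e p ss → State p (go e p) as bs vs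
  state o end x = state-end o (Suffix.inside x (here refl))
  state o {p} (straight {d} {ss = ss} q) x = state-straight′ o (Suffix.inside x (∈-tilesFrom-head p (d ∷ ss))) q
    (state o q (suffix-straight o x))
  state o {p} (turn {d} {e} {ss = ss} {as} {bs} {vs} q) x = state-turn o (Suffix.inside x (∈-tilesFrom-head p (e ∷ ss)))
    (split (opp-sym o) q) (p∈as q) (vs-> q) (TurnTile.k-black o x)
    (≡.subst (λ z → State _ z as bs vs) (go-comm o p) (state (opp-sym o) q (suffix-turn o x)))

-- Reversal and reordering of lists

unique-reverse : ∀ {xs : List Point} → Unique xs → Unique (reverse xs)
unique-reverse []                       = []
unique-reverse {x ∷ xs} (n ∷ u) = ≡.subst Unique (≡.sym (unfold-reverse x xs))
  (Unique.++⁺ (unique-reverse u) ([] ∷ []) (λ { (i , here refl) → All.lookup n (reverse⁻ i) refl }))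

filterᵇ-reverse : ∀ (b : Point → Bool) xs → filterᵇ b (reverse xs) ≡ reverse (filterᵇ b xs)
filterᵇ-reverse b [] = refl
filterᵇ-reverse b (x ∷ xs) = ≡.trans (cong (filterᵇ b) (unfold-reverse x xs))
  (≡.trans (filter-++ (λ v → Bool.T? (b v)) (reverse xs) (x ∷ []))
    (≡.trans (cong (_++ filterᵇ b (x ∷ [])) (filterᵇ-reverse b xs)) (snoc (b x) refl)))
  where
  snoc : ∀ c → b x ≡ c → reverse (filterᵇ b xs) ++ filterᵇ b (x ∷ []) ≡ reverse (filterᵇ b (x ∷ xs))
  snoc true e  = ≡.trans (cong (reverse (filterᵇ b xs) ++_) (filterᵇ-true b e))
    (≡.trans (≡.sym (unfold-reverse x (filterᵇ b xs))) (cong reverse (≡.sym (filterᵇ-true b e))))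
  snoc false e = ≡.trans (cong (reverse (filterᵇ b xs) ++_) (filterᵇ-false b e))
    (≡.trans (++-identityʳ (reverse (filterᵇ b xs))) (cong reverse (≡.sym (filterᵇ-false b e))))

sumQ-↭ : ∀ (f : Point → ℚ) {xs ys} → xs ↭ ys → sumQ f xs ≡ sumQ f ys
sumQ-↭ f refl         = refl
sumQ-↭ f (prep x p)   = cong (f x +ℚ_) (sumQ-↭ f p)
sumQ-↭ f {x ∷ y ∷ xs} {_ ∷ _ ∷ ys} (swap _ _ p) = ≡.trans
  (CSP.x∙yz≈y∙xz (CommutativeRing.+-commutativeSemigroup ℚP.+-*-commutativeRing) (f x) (f y) (sumQ f xs))
  (cong (λ z → f y +ℚ (f x +ℚ z)) (sumQ-↭ f p))
sumQ-↭ f (trans p q)  = ≡.trans (sumQ-↭ f p) (sumQ-↭ f q)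

map-cong-∈ : ∀ {A B : Set} {f g : A → B} xs → (∀ {x} → x ∈ xs → f x ≡ g x) → map f xs ≡ map g xs
map-cong-∈ []       e = refl
map-cong-∈ (x ∷ xs) e = cong₂ _∷_ (e (here refl)) (map-cong-∈ xs (λ i → e (there i)))

tridiagonal-≗ : ∀ {S S′ : Point → Point → ℚ} → (∀ u v → S′ u v ≡ S u v) → ∀ {xs} → Tridiagonal S xs → Tridiagonal S′ xs
tridiagonal-≗ e {[]}     t = []
tridiagonal-≗ e {x ∷ xs} t = Tridiagonal-cong (λ u {v} _ → e u v) t

-- The claim for a pair of boundary paths

module Conclusion (ss : List Step) (col : Colouring) (w : Weighting) (proper : ProperColouring ss col) where

  open Coloured ss col w proper
  private
    S = BBtAt ss col w
    white = λ v → not (col v)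

  S-sym : ∀ u v → S u v ≡ S v u
  S-sym u v = ≡.trans (BBtAt-gram ss col w u v) (≡.trans (gram-sym (adjW ss w) (whiteVs ss col) u v) (≡.sym (BBtAt-gram ss col w v u)))

  -- The witnesses are the numerator and denominator that `contFrac` computes. Nonemptiness excludes
  -- the default value for the empty list, whose denominator is zero.
  contFracClaim : ∀ P → Unique (blackOn col P) → Tridiagonal S (blackOn col P) → blackOn col P ≢ [] → ContFracClaim ss col w P
  contFracClaim P u t ne = claim (blackOn col P) refl
    where
    claim : ∀ L → blackOn col P ≡ L → ContFracClaim ss col w P
    claim [] e = ⊥-elim (ne e)
    claim (x ∷ xs) e = ≡.subst
      (λ L → Σ Poly λ p → Σ Poly λ q → CFEquals (map (cPoly ss) L) p q × ¬ (q ≈P 0P) × CoprimeP p q × Monic p ×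
        charPoly (λ i j → S (lookup L i) (lookup L j)) ≈P p) (≡.sym e)
      ( n , d , at (*-comm n d) , monic-≉0 {length xs} {d} (proj₂ monic)
      , contFrac-coprime (cPoly ss x) (map (cPoly ss) xs) , (suc (length xs) , proj₁ monic)
      , at (≋-trans (charPoly-D S u′) (≋-trans
          (proj₁ (ContinuedFraction.contFrac-D S S-sym (λ v → X -P constP (S v v)) (λ v → ≋-refl) u′ t′))
          (≋-reflexive (cong (λ cs → proj₁ (contFrac cs)) (map-cong-∈ (x ∷ xs) diag))))) )
      where
      n = proj₁ (contFrac (map (cPoly ss) (x ∷ xs)))
      d = proj₂ (contFrac (map (cPoly ss) (x ∷ xs)))
      u′ = ≡.subst Unique e u
      t′ = ≡.subst (Tridiagonal S) e t
      monic = contFrac-monic (λ v → ℤpos (degree ss v) /ℚ 1) x xs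
      diag : ∀ {v} → v ∈ x ∷ xs → (X -P constP (S v v)) ≡ cPoly ss v
      diag i = cong (λ a → X -P constP a) (BBtAt-degree _ (proj₂ (∈-filterᵇ⁻ col {P} (≡.subst (_ ∈_) (≡.sym e) i))))

  Claim : List Point → List Point → Set
  Claim P₁ P₂ =
    (charPoly (adjMatrix ss w) ≈P
       compose (charPoly (boundaryMatrix ss col w P₁)) (X *P X) *P
       compose (charPoly (boundaryMatrix ss col w P₂)) (X *P X)) ×
    ContFracClaim ss col w P₁ × ContFracClaim ss col w P₂

  claim-swap : ∀ {P₁ P₂} → Claim P₁ P₂ → Claim P₂ P₁
  claim-swap {P₁} {P₂} (f , cf₁ , cf₂) = at (≋-trans {charPoly (adjMatrix ss w)} (mk f) (*-comm
    (compose (charPoly (boundaryMatrix ss col w P₁)) (X *P X))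
    (compose (charPoly (boundaryMatrix ss col w P₂)) (X *P X)))) , cf₂ , cf₁

  -- Collects the input of `factorization` and `contFracClaim` in a form stable under exchanging the
  -- two paths and reversing either, the only freedom that the definition of a boundary leaves.
  record BoundaryPair (P₁ P₂ : List Point) : Set where
    field
      P₁!    : Unique P₁
      P₂!    : Unique P₂
      disj   : ∀ {v} → v ∈ P₁ → v ∈ P₂ → ⊥
      cover  : ∀ {v} → v ∈ vertices ss → v ∈ P₁ ⊎ v ∈ P₂
      P₁⊆    : ∀ {v} → v ∈ P₁ → v ∈ vertices ss
      P₂⊆    : ∀ {v} → v ∈ P₂ → v ∈ vertices ss
      tri₁   : Tridiagonal S (blackOn col P₁)
      tri₂   : Tridiagonal S (blackOn col P₂)
      cross  : ∀ {u v} → u ∈ blackOn col P₁ → v ∈ blackOn col P₂ → S u v ≡ 0ℚ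
      size   : length (blackOn col P₁) ℕ.+ length (blackOn col P₂) ≡ length (whiteVs ss col)
      ne₁    : blackOn col P₁ ≢ []
      ne₂    : blackOn col P₂ ≢ []

  sides-swap : ∀ {P₁ P₂} → BoundaryPair P₁ P₂ → BoundaryPair P₂ P₁
  sides-swap {P₁} {P₂} s = record
    { P₁! = P₂! ; P₂! = P₁! ; disj = λ i j → disj j i ; cover = λ i → Sum.swap (cover i) ; P₁⊆ = P₂⊆ ; P₂⊆ = P₁⊆
    ; tri₁ = tri₂ ; tri₂ = tri₁ ; cross = λ {u} {v} i j → ≡.trans (S-sym u v) (cross j i)
    ; size = ≡.trans (ℕP.+-comm (length (blackOn col P₂)) (length (blackOn col P₁))) size ; ne₁ = ne₂ ; ne₂ = ne₁ }
    where open BoundaryPair s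

  sides-reverse : ∀ {P₁ P₂} → BoundaryPair P₁ P₂ → BoundaryPair (reverse P₁) P₂
  sides-reverse {P₁} {P₂} s = record
    { P₁! = unique-reverse P₁! ; P₂! = P₂! ; disj = λ i j → disj (reverse⁻ i) j
    ; cover = λ i → Sum.map₁ reverse⁺ (cover i) ; P₁⊆ = λ i → P₁⊆ (reverse⁻ i) ; P₂⊆ = P₂⊆
    ; tri₁ = ≡.subst (Tridiagonal S) (≡.sym eq) (reverse-tridiagonal S-sym (blackOn col P₁) tri₁) ; tri₂ = tri₂
    ; cross = λ i j → cross (reverse⁻ (≡.subst (_ ∈_) eq i)) j
    ; size = ≡.trans (cong (ℕ._+ length (blackOn col P₂)) len) size
    ; ne₁ = λ e → ne₁ (empty (blackOn col P₁) (≡.trans (≡.sym len) (cong length e))) ; ne₂ = ne₂ }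
    where
    open BoundaryPair s
    eq = filterᵇ-reverse col P₁
    len : length (blackOn col (reverse P₁)) ≡ length (blackOn col P₁)
    len = ≡.trans (cong length eq) (length-reverse (blackOn col P₁))
    empty : ∀ (xs : List Point) → length xs ≡ 0 → xs ≡ []
    empty [] _ = refl

  claim : ∀ {P₁ P₂} → BoundaryPair P₁ P₂ → Claim P₁ P₂
  claim {P₁} {P₂} s = at (factorization (adjW ss w) S (vertices ss) B₁ B₂ W (adjW-sym ss w) (BBtAt-gram ss col w)
      (vertices-unique ss) B₁! B₂! W! perm
      (λ i j → adjW-same-colour (≡.trans (black i) (≡.sym (black j))))
      (λ i j → adjW-same-colour (≡.trans (whiteCol i) (≡.sym (whiteCol j))))
      (λ i j → λ { refl → black-white i j }) (≡.trans (length-++ B₁) size)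
      (λ i j → λ { refl → disj₁₂ i j }) cross)
    , contFracClaim P₁ B₁! tri₁ ne₁ , contFracClaim P₂ B₂! tri₂ ne₂
    where
    open BoundaryPair s
    B₁ = blackOn col P₁
    B₂ = blackOn col P₂
    W = whiteVs ss col
    B₁! = filterᵇ-unique col P₁!
    B₂! = filterᵇ-unique col P₂!
    W! = filterᵇ-unique white (vertices-unique ss)
    black : ∀ {v} → v ∈ B₁ ++ B₂ → col v ≡ true
    black i = Sum.[ (λ j → proj₂ (∈-filterᵇ⁻ col {P₁} j)) , (λ j → proj₂ (∈-filterᵇ⁻ col {P₂} j)) ] (∈-++⁻ B₁ i)
    whiteCol : ∀ {v} → v ∈ W → col v ≡ false
    whiteCol {v} i = not-true (col v) (proj₂ (∈-filterᵇ⁻ white {vertices ss} i))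
      where not-true : ∀ b → not b ≡ true → b ≡ false
            not-true false _ = refl
            not-true true ()
    black-white : ∀ {v} → v ∈ B₁ ++ B₂ → v ∈ W → ⊥
    black-white i j with ≡.trans (≡.sym (black i)) (whiteCol j)
    ... | ()
    disj₁₂ : ∀ {v} → v ∈ B₁ → v ∈ B₂ → ⊥
    disj₁₂ i j = disj (proj₁ (∈-filterᵇ⁻ col {P₁} i)) (proj₁ (∈-filterᵇ⁻ col {P₂} j))
    place : ∀ {v} → v ∈ vertices ss → ∀ b → col v ≡ b → v ∈ (B₁ ++ B₂) ++ W
    place i false e = ∈-++⁺ʳ (B₁ ++ B₂) (∈-filterᵇ⁺ white i (cong not e))
    place {v} i true e = ∈-++⁺ˡ {xs = B₁ ++ B₂} (side (cover i))
      where
      side : v ∈ P₁ ⊎ v ∈ P₂ → v ∈ B₁ ++ B₂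
      side (inj₁ j) = ∈-++⁺ˡ {xs = B₁} (∈-filterᵇ⁺ col j e)
      side (inj₂ j) = ∈-++⁺ʳ B₁ (∈-filterᵇ⁺ col j e)
    perm : vertices ss ↭ (B₁ ++ B₂) ++ W
    perm = unique-↭ (vertices-unique ss)
      (Unique.++⁺ (Unique.++⁺ B₁! B₂! (λ { (i , j) → disj₁₂ i j })) W! (λ { (i , j) → black-white i j }))
      (λ {v} i → place i (col v) refl)
      back
      where
      back : ∀ {v} → v ∈ (B₁ ++ B₂) ++ W → v ∈ vertices ss
      back i with ∈-++⁻ (B₁ ++ B₂) i
      ... | inj₂ j = proj₁ (∈-filterᵇ⁻ white {vertices ss} j)
      ... | inj₁ j with ∈-++⁻ B₁ j
      ... | inj₁ k = P₁⊆ (proj₁ (∈-filterᵇ⁻ col {P₁} k))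
      ... | inj₂ k = P₂⊆ (proj₁ (∈-filterᵇ⁻ col {P₂} k))

  claims : ∀ {as bs P₁ P₂} → BoundaryPair as bs → P₁ ≡ as ⊎ P₁ ≡ reverse as → P₂ ≡ bs ⊎ P₂ ≡ reverse bs → Claim P₁ P₂
  claims p (inj₁ refl) (inj₁ refl) = claim p
  claims p (inj₂ refl) (inj₁ refl) = claim (sides-reverse p)
  claims p (inj₁ refl) (inj₂ refl) = claim (sides-swap (sides-reverse (sides-swap p)))
  claims p (inj₂ refl) (inj₂ refl) = claim (sides-reverse (sides-swap (sides-reverse (sides-swap p))))

  module FromState (turns : TurnsBlack ss col) (kast : ∀ t → t ∈ tiles ss → KastFace 4 (negCount w (sides t))) where
    open Growing ss col w proper turns kast hiding (white)
    open Ladder (adjW ss w)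

    -- Each path contains both ends of an edge of the first tile, and one of them is black; so
    -- neither continued fraction is empty.
    black-exists : ∀ P {u v} → u ∈ P → v ∈ P → col u ≡ not (col v) → blackOn col P ≢ []
    black-exists P {u} {v} i j e z = go′ (col v) refl
      where
      absurd : ∀ {x} → x ∈ P → col x ≡ true → ⊥
      absurd k c with ≡.subst (_ ∈_) z (∈-filterᵇ⁺ col k c)
      ... | ()
      go′ : ∀ b → col v ≡ b → ⊥
      go′ true  c = absurd j c
      go′ false c = absurd i (≡.trans e (cong not c))

    boundaryPair : ∀ {d e} → Opp d e → ∀ {as bs vs} → Paths d e (0 , 0) ss as bs vs →
      (0 , 0) ∈ tiles ss → go d (0 , 0) ∈ as → go e (go d (0 , 0)) ∈ bs → State (0 , 0) (go e (0 , 0)) as bs vs → BoundaryPair as bs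
    boundaryPair {d} {e} o {as} {bs} {vs} q t da db st = from st
      where
      open Split (split o q)
      vertices⊆ : ∀ {v} → v ∈ vertices ss → v ∈ vs
      vertices⊆ i = let (t , j , k) = ∈-vertices⁻ ss i in corner-vs o q j k
      ⊆vertices : ∀ {v} → v ∈ vs → v ∈ vertices ss
      ⊆vertices i = let (t , j , k) = vs-corner o q i in ∈-vertices⁺ ss j k
      -- `vs` follows the tiles while `vertices ss` comes from deduplication; the Gram sums do not
      -- depend on the order.
      whites : filterᵇ white vs ↭ whiteVs ss col
      whites = unique-↭ (filterᵇ-unique white vs!) (filterᵇ-unique white (vertices-unique ss))
        (λ i → let (j , c) = ∈-filterᵇ⁻ white {vs} i in ∈-filterᵇ⁺ white (⊆vertices j) c)
        (λ i → let (j , c) = ∈-filterᵇ⁻ white {vertices ss} i in ∈-filterᵇ⁺ white (vertices⊆ j) c)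
      S-vs : ∀ u v → S u v ≡ gram (adjW ss w) (filterᵇ white vs) u v
      S-vs u v = ≡.trans (BBtAt-gram ss col w u v) (≡.sym (sumQ-↭ (λ x → adjW ss w u x *ℚ adjW ss w v x) whites))
      open Tile o t
      ne-a : blackOn col as ≢ []
      ne-a = black-exists as (p∈as q) da col-d
      ne-b : blackOn col bs ≢ []
      ne-b = black-exists bs (e∈bs q) db (≡.subst (λ z → col (go e (0 , 0)) ≡ not (col z)) (go-comm o (0 , 0))
        (col-edge t d (∈-sides⁺ o far-d)))
      common : ∀ {bsW bsB α β} → (∀ {v} → v ∈ bsW → v ∈ vs) → (∀ {v} → v ∈ bsB → v ∈ vs) → Unique bsW → Unique bsB →
        (∀ {v} → v ∈ bsW → v ∈ bsB → ⊥) → (∀ {v} → v ∈ vs → v ∈ bsW ⊎ v ∈ bsB) →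
        blackOn col bsW ≢ [] → blackOn col bsB ≢ [] → Half β α bsW bsB vs → BoundaryPair bsW bsB
      common {bsW} {bsB} {α} {β} W⊆ B⊆ W! B! dis ei neW neB (_ , _ , bB , ws , eB , eW , s) = record
        { P₁! = W! ; P₂! = B! ; disj = dis ; cover = λ i → ei (vertices⊆ i)
        ; P₁⊆ = λ i → ⊆vertices (W⊆ i) ; P₂⊆ = λ i → ⊆vertices (B⊆ i)
        ; tri₁ = tridiagonal-≗ S-inv triW
        ; tri₂ = ≡.subst (Tridiagonal S) (≡.sym eB) (tridiagonal-≗ S-inv triB)
        ; cross = λ {u} {v} i j → ≡.trans (S-inv u v) (Invariant.cross inv i (≡.subst (_ ∈_) eB j))
        ; size = ≡.trans (cong (λ z → length (blackOn col bsW) ℕ.+ length z) eB)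
            (≡.trans (balanced s) (≡.trans (cong length (≡.sym eW)) (↭-length whites)))
        ; ne₁ = neW ; ne₂ = neB }
        where
        inv = invariant s
        open Invariant inv using (triW; triB)
        S-inv : ∀ u v → S u v ≡ gram (adjW ss w) (α ∷ ws) u v
        S-inv u v = ≡.trans (S-vs u v) (cong (λ z → gram (adjW ss w) z u v) eW)
      from : State (0 , 0) (go e (0 , 0)) as bs vs → BoundaryPair as bs
      from (inj₁ h) = sides-swap (common bs⊆ as⊆ bs! as! (λ i j → disj j i) (λ i → Sum.swap (either i)) ne-b ne-a h)
      from (inj₂ h) = common as⊆ bs⊆ as! bs! disj either ne-a ne-b h

-- Walks along the links of a path

data Next (u v : Point) : List Point → Set where
  here  : ∀ {xs} → Next u v (u ∷ v ∷ xs)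
  there : ∀ {x xs} → Next u v xs → Next u v (x ∷ xs)

next-∈ˡ : ∀ {u v xs} → Next u v xs → u ∈ xs
next-∈ˡ here      = here refl
next-∈ˡ (there n) = there (next-∈ˡ n)

next-∈ʳ : ∀ {u v x xs} → Next u v (x ∷ xs) → v ∈ xs
next-∈ʳ here                    = here refl
next-∈ʳ {xs = x ∷ xs} (there n) = there (next-∈ʳ n)

next-functionalˡ : ∀ {u u′ v xs} → Unique xs → Next u v xs → Next u′ v xs → u ≡ u′
next-functionalˡ (_ ∷ u) here      here      = refl
next-functionalˡ (_ ∷ (n ∷ _)) here (there m) = ⊥-elim (All.lookup n (next-∈ʳ m) refl)
next-functionalˡ (_ ∷ (n ∷ _)) (there m) here = ⊥-elim (All.lookup n (next-∈ʳ m) refl)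
next-functionalˡ (_ ∷ u) (there m) (there n) = next-functionalˡ u m n

Both : (Point → Point → Set) → Point → Point → Set
Both J u v = J u v ⊎ J v u

-- A link may be crossed either way, but a walk without repetition never turns back: a backward step
-- would lead to the predecessor of `x`, which does not exist at the start and has been left behind
-- later.
forward : ∀ {xs} → Unique xs → ∀ {x ys} → Unique (x ∷ ys) →
  (∀ {u v} → Next u v (x ∷ ys) → Both (λ u v → Next u v xs) u v) →
  (∀ {y} → ¬ Next y x xs) ⊎ (Σ Point λ z → Next z x xs × z ∉ ys) →
  ∀ {u v} → Next u v (x ∷ ys) → Next u v xs
forward {xs} u {x} {y ∷ ys} (n ∷ u′) f s = λ
  { here      → first
  ; (there m) → forward u u′ (λ m → f (there m)) (inj₂ (x , first , λ i → All.lookup n (there i) refl)) m }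
  where
  pick : Both (λ u v → Next u v xs) x y → (∀ {z} → ¬ Next z x xs) ⊎ (Σ Point λ z → Next z x xs × z ∉ y ∷ ys) → Next x y xs
  pick (inj₁ m) _ = m
  pick (inj₂ m) (inj₁ h) = ⊥-elim (h m)
  pick (inj₂ m) (inj₂ (z , k , z∉)) = ⊥-elim (z∉ (here (next-functionalˡ u k m)))
  first : Next x y xs
  first = pick (f here) s
forward u {x} {[]} u′ f s (there ())

-- From a common head, successors are forced, so `ys` is an initial segment of `xs`; the common last
-- point prevents it from stopping early.
same-list : ∀ {xs ys} → Unique xs → Unique ys → head xs ≡ head ys → last xs ≡ last ys →
  (∀ {u v} → Next u v ys → Next u v xs) → ys ≡ xs
same-list {[]} {[]} u u′ h l f = refl
same-list {x ∷ []} {.x ∷ []} u u′ refl l f = refl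
same-list {x ∷ []} {.x ∷ y ∷ ys} u u′ refl l f with f here
... | there ()
same-list {x ∷ x′ ∷ xs} {.x ∷ []} (n ∷ u) u′ refl l f = ⊥-elim (All.lookup n (last-∈ {x′ ∷ xs} l) refl)
same-list {x ∷ x′ ∷ xs} {.x ∷ y ∷ ys} (n ∷ u) (n′ ∷ u′) refl l f with f here
... | there m = ⊥-elim (All.lookup n (next-∈ˡ m) refl)
... | here    = cong (x ∷_) (same-list u u′ refl l (λ m → tail m (f (there m))))
  where
  tail : ∀ {u v} → Next u v (y ∷ ys) → Next u v (x ∷ y ∷ xs) → Next u v (y ∷ xs)
  tail m here      = ⊥-elim (All.lookup n′ (next-∈ˡ m) refl)
  tail m (there k) = k

-- A link lies within `A` or within `B`, and these are disjoint, so a walk started in `A` cannot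
-- leave it.
stays : ∀ (A B : List Point) → (∀ {v} → v ∈ A → v ∈ B → ⊥) → ∀ {x ys} → x ∈ A →
  (∀ {u v} → Next u v (x ∷ ys) → Both (λ u v → Next u v A) u v ⊎ Both (λ u v → Next u v B) u v) →
  (∀ {u v} → Next u v (x ∷ ys) → Both (λ u v → Next u v A) u v) × (∀ {v} → v ∈ x ∷ ys → v ∈ A)
stays A B dis {x} {[]} i f = (λ { (there ()) }) , (λ { (here refl) → i })
stays A B dis {x} {y ∷ ys} i f = (λ { here → first ; (there m) → proj₁ rest m }) , (λ { (here refl) → i ; (there j) → proj₂ rest j })
  where
  member : ∀ {u v} xs → Next u v xs → v ∈ xs
  member (_ ∷ _) m = there (next-∈ʳ m)
  first : Both (λ u v → Next u v A) x y
  first with f here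
  ... | inj₁ m        = m
  ... | inj₂ (inj₁ m) = ⊥-elim (dis i (next-∈ˡ m))
  ... | inj₂ (inj₂ m) = ⊥-elim (dis i (member B m))
  y∈ : y ∈ A
  y∈ = Sum.[ member A , next-∈ˡ ] first
  rest = stays A B dis y∈ (λ m → f (there m))

walk-is-path : ∀ (A B : List Point) {x as f P} → A ≡ x ∷ as → Unique A → (∀ {v} → v ∈ A → v ∈ B → ⊥) → Unique P →
  (∀ {u v} → Next u v P → Both (λ u v → Next u v A) u v ⊎ Both (λ u v → Next u v B) u v) →
  head P ≡ just x → last P ≡ just f → (last A ≡ just f ⊎ last B ≡ just f) → P ≡ A
walk-is-path A B {x} {as} {f} {P = .x ∷ P} refl A! dis P! j refl lP lAB =
  same-list A! P! refl (≡.trans (last-A lAB) (≡.sym lP)) (forward A! P! links (inj₁ no-pred))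
  where
  links = proj₁ (stays A B dis (here refl) j)
  f∈A : f ∈ A
  f∈A = proj₂ (stays A B dis (here refl) j) (last-∈ {x ∷ P} lP)
  last-A : (last A ≡ just f ⊎ last B ≡ just f) → last A ≡ just f
  last-A (inj₁ e) = e
  last-A (inj₂ e) = ⊥-elim (dis f∈A (last-∈ {B} e))
  no-pred : ∀ {y} → ¬ Next y x (x ∷ as)
  no-pred m = head-∉ A! (next-∈ʳ m)
    where
    head-∉ : Unique (x ∷ as) → x ∉ as
    head-∉ (n ∷ _) i = All.lookup n i refl

next-snoc : ∀ xs {y u v} → Next u v (xs ++ y ∷ []) → Next u v xs ⊎ (last xs ≡ just u × v ≡ y)
next-snoc []           (there ())
next-snoc (x ∷ [])     here      = inj₂ (refl , refl)
next-snoc (x ∷ [])     (there (there ()))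
next-snoc (x ∷ z ∷ xs) here      = inj₁ here
next-snoc (x ∷ z ∷ xs) (there m) = Sum.map₁ there (next-snoc (z ∷ xs) m)

last-snoc : ∀ (xs : List Point) y → last (xs ++ y ∷ []) ≡ just y
last-snoc []           y = refl
last-snoc (x ∷ [])     y = refl
last-snoc (x ∷ z ∷ xs) y = last-snoc (z ∷ xs) y

last-reverse : ∀ {x : Point} xs → last (reverse (x ∷ xs)) ≡ just x
last-reverse {x} xs = ≡.trans (cong last (unfold-reverse x xs)) (last-snoc (reverse xs) x)

next-reverse : ∀ xs {u v} → Next u v (reverse xs) → Next v u xs
next-reverse (x ∷ xs) {u} {v} m with next-snoc (reverse xs) (≡.subst (Next u v) (unfold-reverse x xs) m)
... | inj₁ k = there (next-reverse xs k)
next-reverse (x ∷ []) m | inj₂ (() , _)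
next-reverse (x ∷ y ∷ xs) m | inj₂ (e , refl) with just-injective (≡.trans (≡.sym e) (last-reverse {y} xs))
... | refl = here

last-split : ∀ (xs : List Point) {f} → last xs ≡ just f → Σ (List Point) λ ys → xs ≡ ys ++ f ∷ []
last-split (x ∷ [])     refl = [] , refl
last-split (x ∷ y ∷ xs) e    = let (ys , q) = last-split (y ∷ xs) e in x ∷ ys , cong (x ∷_) q

reverse-last : ∀ (xs : List Point) {f} → last xs ≡ just f → Σ (List Point) λ r → reverse xs ≡ f ∷ r
reverse-last xs {f} e = let (ys , q) = last-split xs e in reverse ys , ≡.trans (cong reverse q) (reverse-++ ys (f ∷ []))

-- The boundary paths

lastDir lastOpp : ∀ {d e p ss as bs vs} → Paths d e p ss as bs vs → Step
lastDir {d} end      = d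
lastDir (straight q) = lastDir q
lastDir (turn q)     = lastDir q
lastOpp {e = e} end  = e
lastOpp (straight q) = lastOpp q
lastOpp (turn q)     = lastOpp q

finalTile : ∀ {d e p ss as bs vs} → Paths d e p ss as bs vs → Point
finalTile {p = p} end  = p
finalTile (straight q) = finalTile q
finalTile (turn q)     = finalTile q

-- The side of the last tile opposite to the one through which it is entered.
endEdge : ∀ {d e p ss as bs vs} → Paths d e p ss as bs vs → Edge
endEdge q = edge (lastOpp q) (go (lastDir q) (finalTile q))

last-opp : ∀ {d e p ss as bs vs} → Opp d e → (q : Paths d e p ss as bs vs) → Opp (lastDir q) (lastOpp q)
last-opp o end          = o
last-opp o (straight q) = last-opp o q
last-opp o (turn q)     = last-opp (opp-sym o) q

finalTile-last : ∀ {d e p ss as bs vs} (q : Paths d e p ss as bs vs) → last (tilesFrom p ss) ≡ just (finalTile q)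
finalTile-last end = refl
finalTile-last {d} {p = p} (straight {ss = ss} q) = ≡.trans (tilesFrom-last d p ss) (finalTile-last q)
finalTile-last {e = e} {p} (turn {ss = ss} q) = ≡.trans (tilesFrom-last e p ss) (finalTile-last q)

finalTile-∈ : ∀ {d e p ss as bs vs} (q : Paths d e p ss as bs vs) → finalTile q ∈ tilesFrom p ss
finalTile-∈ {p = p} {ss} q = last-∈ {tilesFrom p ss} (finalTile-last q)

last-∷ : ∀ (x : Point) {xs y ys} → xs ≡ y ∷ ys → last (x ∷ xs) ≡ last xs
last-∷ x refl = refl

Ends : ∀ {d e p ss as bs vs} → Paths d e p ss as bs vs → List Point → List Point → Set
Ends q as bs = last as ≡ just (go (lastDir q) (finalTile q)) × last bs ≡ just (go (lastOpp q) (go (lastDir q) (finalTile q)))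

-- Every turn interchanges the two paths, so which of them reaches which end of the end edge depends
-- on the parity of the number of turns; hence the alternative.
path-ends : ∀ {d e p ss as bs vs} (q : Paths d e p ss as bs vs) → Ends q as bs ⊎ Ends q bs as
path-ends end = inj₁ (refl , refl)
path-ends {e = e} {p} (straight q) = Sum.map
  (λ { (x , y) → ≡.trans (last-∷ p (proj₂ (head-as q))) x , ≡.trans (last-∷ (go e p) (proj₂ (head-bs q))) y })
  (λ { (x , y) → ≡.trans (last-∷ (go e p) (proj₂ (head-bs q))) x , ≡.trans (last-∷ p (proj₂ (head-as q))) y }) (path-ends q)
path-ends {d} {p = p} (turn q) = Sum.map
  (λ { (x , y) → ≡.trans (last-∷ (go d p) (proj₂ (head-bs q))) x , y })
  (λ { (x , y) → x , ≡.trans (last-∷ (go d p) (proj₂ (head-bs q))) y }) (Sum.swap (path-ends q))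

edge-corner : ∀ {c u t} → edge c u ∈ sides t → u ∈ corners t × go c u ∈ corners t
edge-corner {c} {u} {t} i = corner _ refl (∈-sides⁻ RU i)
  where
  corner : ∀ x → x ≡ edge c u → Sides R U t x → u ∈ corners t × go c u ∈ corners t
  corner .(edge R t)        e near-d with edge-injective {R} {c} e
  ... | refl , refl = ∈-corners⁺ RU c₀ , ∈-corners⁺ RU c-d
  corner .(edge R (go U t)) e far-d with edge-injective {R} {c} e
  ... | refl , refl = ∈-corners⁺ RU c-e , ∈-corners⁺ RU c₁
  corner .(edge U t)        e near-e with edge-injective {U} {c} e
  ... | refl , refl = ∈-corners⁺ RU c₀ , ∈-corners⁺ RU c-e
  corner .(edge U (go R t)) e far-e with edge-injective {U} {c} e
  ... | refl , refl = ∈-corners⁺ RU c-d , ∈-corners⁺ RU c₁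

opp-≢ : ∀ {d e} → Opp d e → d ≢ e
opp-≢ RU ()
opp-≢ UR ()

record Outer (entry end : Edge) (ts : List Point) (u v : Point) : Set where
  field
    dir    : Step
    isStep : v ≡ go dir u
    tile   : Point
    tile∈  : tile ∈ ts
    side   : edge dir u ∈ sides tile
    only   : ∀ {t} → t ∈ ts → edge dir u ∈ sides t → t ≡ tile
    ≢entry : edge dir u ≢ entry
    ≢end   : edge dir u ≢ end

endEdge-> : ∀ {d e s p ss as bs vs} (q : Paths d e (go s p) ss as bs vs) c {u} →
  coord s u ≤ coord s p → edge c u ≢ endEdge q
endEdge-> {s = s} {p} {ss} q c {u} l x with edge-injective {c} {lastOpp q} x
... | _ , refl = ℕP.<⇒≱ (ℕP.<-≤-trans (tilesFrom-> s p ss (finalTile-∈ q)) (coord-≤-go (lastDir q) s (finalTile q))) l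

-- Later tiles lie strictly beyond `p` in the leaving direction `s`, so an edge based at a point not
-- beyond `p` belongs to none of them.
outer-new : ∀ {d e s p ss as bs vs} (q : Paths d e (go s p) ss as bs vs) {entry} c {u} → coord s u ≤ coord s p →
  edge c u ∈ sides p → edge c u ≢ entry → Outer entry (endEdge q) (tilesFrom p (s ∷ ss)) u (go c u)
outer-new {s = s} {p} {ss} q c {u} l i ne = record
  { dir = c ; isStep = refl ; tile = p ; tile∈ = ∈-tilesFrom-head p (s ∷ ss) ; side = i
  ; only = only ; ≢entry = ne ; ≢end = endEdge-> q c l }
  where
  only : ∀ {t} → t ∈ tilesFrom p (s ∷ ss) → edge c u ∈ sides t → t ≡ p
  only j k with ∈-tilesFrom⁻ s p ss j
  ... | inj₁ e  = e
  ... | inj₂ j′ = ⊥-elim (ℕP.<⇒≱ (tilesFrom-> s p ss j′) (ℕP.≤-trans (corner-≥ (proj₁ (edge-corner k)) s) l))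

-- s is the direction in which the tile p is left, c the other one.
outer-old : ∀ {s c p ss end entry u v} → Opp s c → coord s p < coord s u → (∀ {d} → edge d u ≢ entry) →
  Outer (edge c (go s p)) end (tilesFrom (go s p) ss) u v → Outer entry end (tilesFrom p (s ∷ ss)) u v
outer-old {s} {c} {p} {ss} {u = u} o l ne x = record
  { dir = dir ; isStep = isStep ; tile = tile ; tile∈ = ∈-tilesFrom-tail s p ss tile∈ ; side = side
  ; only = only′ ; ≢entry = ne ; ≢end = ≢end }
  where
  open Outer x
  not-p : ∀ x → x ≡ edge dir u → Sides s c p x → ⊥
  not-p _ e near-d with edge-injective {s} {dir} e
  ... | _ , refl = ℕP.<-irrefl refl l
  not-p _ e far-d with edge-injective {s} {dir} e
  ... | _ , refl = ℕP.<-irrefl (≡.sym (coord-go-opp (opp-sym o) p)) l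
  not-p _ e near-e with edge-injective {c} {dir} e
  ... | _ , refl = ℕP.<-irrefl refl l
  -- This is the side that `p` shares with the next tile, the entry edge of the rest; excluding it
  -- is what makes `≢entry` necessary in the induction.
  not-p _ e far-e = ≢entry (≡.sym e)
  only′ : ∀ {t} → t ∈ tilesFrom p (s ∷ ss) → edge dir u ∈ sides t → t ≡ tile
  only′ j k with ∈-tilesFrom⁻ s p ss j
  ... | inj₂ j′   = only j′ k
  ... | inj₁ refl = ⊥-elim (not-p _ refl (∈-sides⁻ o k))

edge-≢ : ∀ {c s p} u → coord s p < coord s u → ∀ {d} → edge d u ≢ edge c p
edge-≢ {c} u l {d} x with edge-injective {d} {c} x
... | _ , refl = ℕP.<-irrefl refl l

outer : ∀ {d e p ss as bs vs} → Opp d e → (q : Paths d e p ss as bs vs) → ∀ {u v} → Next u v as ⊎ Next u v bs →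
  Outer (edge e p) (endEdge q) (tilesFrom p ss) u v
outer {d} {e} {p} o end (inj₁ here) = record
  { dir = d ; isStep = refl ; tile = p ; tile∈ = here refl ; side = ∈-sides⁺ o near-d ; only = λ { (here r) _ → r }
  ; ≢entry = λ x → opp-≢ o (proj₁ (edge-injective {d} {e} x)) ; ≢end = λ x → opp-≢ o (proj₁ (edge-injective {d} {e} x)) }
outer o end (inj₁ (there (there ())))
outer {d} {e} {p} o end (inj₂ here) = record
  { dir = d ; isStep = ≡.sym (go-comm o p) ; tile = p ; tile∈ = here refl ; side = ∈-sides⁺ o far-d ; only = λ { (here r) _ → r }
  ; ≢entry = λ x → opp-≢ o (proj₁ (edge-injective {d} {e} x)) ; ≢end = λ x → opp-≢ o (proj₁ (edge-injective {d} {e} x)) }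
outer o end (inj₂ (there (there ())))
outer {d} {e} {p} o (straight q) {u} {v} n = cases n
  where
  old : Next u v _ ⊎ Next u v _ → Outer (edge e p) (endEdge q) (tilesFrom p (d ∷ _)) u v
  old m = outer-old o above (edge-≢ {s = d} u above) (outer o q m)
    where
    above : coord d p < coord d u
    above = vs-> q (Sum.[ (λ k → Split.as⊆ (split o q) (next-∈ˡ k)) , (λ k → Split.bs⊆ (split o q) (next-∈ˡ k)) ] m)
  cases : Next u v (p ∷ _) ⊎ Next u v (go e p ∷ _) → Outer (edge e p) (endEdge q) (tilesFrom p (d ∷ _)) u v
  cases (inj₁ (there m)) = old (inj₁ m)
  cases (inj₂ (there m)) = old (inj₂ m)
  cases (inj₁ here) with head-as q
  ... | _ , refl = outer-new q d ℕP.≤-refl (∈-sides⁺ o near-d) (λ x → opp-≢ o (proj₁ (edge-injective {d} {e} x)))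
  cases (inj₂ here) with head-bs q
  ... | _ , refl = ≡.subst (Outer _ _ _ _) (go-comm o p)
    (outer-new q d (ℕP.≤-reflexive (coord-go-opp (opp-sym o) p)) (∈-sides⁺ o far-d) (λ x → opp-≢ o (proj₁ (edge-injective {d} {e} x))))
outer {d} {e} {p} o (turn {ss = ss} {as} {bs} q) {u} {v} n = cases n
  where
  o′ = opp-sym o
  old : Next u v as ⊎ Next u v bs → Outer (edge e p) (endEdge q) (tilesFrom p (e ∷ ss)) u v
  old m = outer-old o′ above (edge-≢ {s = e} u above) (outer o′ q m)
    where
    above : coord e p < coord e u
    above = vs-> q (Sum.[ (λ k → Split.as⊆ (split o′ q) (next-∈ˡ k)) , (λ k → Split.bs⊆ (split o′ q) (next-∈ˡ k)) ] m)
  cases : Next u v (p ∷ go d p ∷ bs) ⊎ Next u v as → Outer (edge e p) (endEdge q) (tilesFrom p (e ∷ ss)) u v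
  cases (inj₂ m) = old (inj₁ m)
  cases (inj₁ (there (there m))) = old (inj₂ m)
  cases (inj₁ here) = outer-new q d ℕP.≤-refl (∈-sides⁺ o near-d) (λ x → opp-≢ o (proj₁ (edge-injective {d} {e} x)))
  cases (inj₁ (there here)) with head-bs q
  ... | _ , refl = ≡.subst (Outer _ _ _ _) (≡.sym (go-comm o p))
    (outer-new q e (ℕP.≤-reflexive (coord-go-opp o p)) (∈-sides⁺ o far-e) (λ x → go-≢ d (proj₂ (edge-injective {e} {e} x))))

-- Serves the converse of `outer`: a side of exactly one tile that is neither entry nor end edge can
-- only be `onPath`. `shared` absorbs the entry edge of the remaining snake once a tile is put in
-- front of it.
data Class (entry end : Edge) (ts as bs : List Point) : Edge → Set where
  onPath  : ∀ {c u} → Next u (go c u) as ⊎ Next u (go c u) bs → Class entry end ts as bs (edge c u)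
  isEntry : Class entry end ts as bs entry
  isEnd   : Class entry end ts as bs end
  shared  : ∀ {x t t′} → t ∈ ts → t′ ∈ ts → t ≢ t′ → x ∈ sides t → x ∈ sides t′ → Class entry end ts as bs x

classify : ∀ {d e p ss as bs vs} → Opp d e → (q : Paths d e p ss as bs vs) → ∀ {t x} → t ∈ tilesFrom p ss → x ∈ sides t →
  Class (edge e p) (endEdge q) (tilesFrom p ss) as bs x
classify {d} {e} {p} o end (here refl) i with ∈-sides⁻ o i
... | near-d = onPath {c = d} (inj₁ here)
... | far-d  = onPath {c = d} {go e p} (inj₂ (≡.subst (λ z → Next (go e p) (go d (go e p)) (go e p ∷ z ∷ [])) (go-comm o p) here))
... | near-e = isEntry
... | far-e  = isEnd
classify {d} {e} {p} o (straight {ss = ss} {as} {bs} q) {x = x} i j with ∈-tilesFrom⁻ d p ss i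
... | inj₂ i′ = lift (classify o q i′ j)
  where
  lift : ∀ {x} → Class (edge e (go d p)) (endEdge q) (tilesFrom (go d p) ss) as bs x →
    Class (edge e p) (endEdge q) (tilesFrom p (d ∷ ss)) (p ∷ as) (go e p ∷ bs) x
  lift (onPath {c} {u} n) = onPath {c = c} {u} (Sum.map there there n)
  lift isEntry = shared (∈-tilesFrom-head p (d ∷ ss)) (∈-tilesFrom-tail d p ss (∈-tilesFrom-head (go d p) ss))
    (λ r → go-≢ d (≡.sym r)) (∈-sides⁺ o far-e) (∈-sides⁺ o near-e)
  lift isEnd = isEnd
  lift (shared k l ne a b) = shared (∈-tilesFrom-tail d p ss k) (∈-tilesFrom-tail d p ss l) ne a b
... | inj₁ refl with ∈-sides⁻ o j | head-as q | head-bs q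
... | near-d | _ , refl | _ = onPath {c = d} (inj₁ here)
... | far-d  | _ | bs′ , refl = onPath {c = d} {go e p} (inj₂ (≡.subst (λ z → Next (go e p) (go d (go e p)) (go e p ∷ z ∷ bs′)) (go-comm o p) here))
... | near-e | _ | _ = isEntry
... | far-e  | _ | _ = shared (∈-tilesFrom-head p (d ∷ ss)) (∈-tilesFrom-tail d p ss (∈-tilesFrom-head (go d p) ss))
    (λ r → go-≢ d (≡.sym r)) (∈-sides⁺ o far-e) (∈-sides⁺ o near-e)
classify {d} {e} {p} o (turn {ss = ss} {as} {bs} q) {x = x} i j with ∈-tilesFrom⁻ e p ss i
... | inj₂ i′ = lift (classify (opp-sym o) q i′ j)
  where
  lift : ∀ {x} → Class (edge d (go e p)) (endEdge q) (tilesFrom (go e p) ss) as bs x →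
    Class (edge e p) (endEdge q) (tilesFrom p (e ∷ ss)) (p ∷ go d p ∷ bs) as x
  lift (onPath {c} {u} (inj₁ n)) = onPath {c = c} {u} (inj₂ n)
  lift (onPath {c} {u} (inj₂ n)) = onPath {c = c} {u} (inj₁ (there (there n)))
  lift isEntry = shared (∈-tilesFrom-head p (e ∷ ss)) (∈-tilesFrom-tail e p ss (∈-tilesFrom-head (go e p) ss))
    (λ r → go-≢ e (≡.sym r)) (∈-sides⁺ o far-d) (∈-sides⁺ o near-d)
  lift isEnd = isEnd
  lift (shared k l ne a b) = shared (∈-tilesFrom-tail e p ss k) (∈-tilesFrom-tail e p ss l) ne a b
... | inj₁ refl with ∈-sides⁻ o j | head-bs q
... | near-d | _ = onPath {c = d} (inj₁ here)
... | far-e  | bs′ , refl = onPath {c = e} {go d p} (inj₁ (≡.subst (λ z → Next (go d p) (go e (go d p)) (p ∷ go d p ∷ z ∷ bs′)) (≡.sym (go-comm o p)) (there here)))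
... | near-e | _ = isEntry
... | far-d  | _ = shared (∈-tilesFrom-head p (e ∷ ss)) (∈-tilesFrom-tail e p ss (∈-tilesFrom-head (go e p) ss))
    (λ r → go-≢ e (≡.sym r)) (∈-sides⁺ o far-d) (∈-sides⁺ o near-d)

-- Start edge, end edge and the edges of the unbounded face

before-last : ∀ {d e p s ss as bs vs} (q : Paths d e p (s ∷ ss) as bs vs) → coord (lastDir q) p < coord (lastDir q) (finalTile q)
before-last {d} {p = p} (straight end)                = ℕP.≤-reflexive (≡.sym (coord-go d p))
before-last {d} {p = p} (straight q@(straight _))     = ℕP.≤-<-trans (coord-≤-go d (lastDir q) p) (before-last q)
before-last {d} {p = p} (straight q@(turn _))         = ℕP.≤-<-trans (coord-≤-go d (lastDir q) p) (before-last q)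
before-last {e = e} {p} (turn end)                    = ℕP.≤-reflexive (≡.sym (coord-go e p))
before-last {e = e} {p} (turn q@(straight _))         = ℕP.≤-<-trans (coord-≤-go e (lastDir q) p) (before-last q)
before-last {e = e} {p} (turn q@(turn _))             = ℕP.≤-<-trans (coord-≤-go e (lastDir q) p) (before-last q)

-- The last step raises the coordinate `lastDir` and no step lowers any, so the last tile is alone
-- at its level in that direction.
last-or-before : ∀ {d e p ss as bs vs} (q : Paths d e p ss as bs vs) → ∀ {t} → t ∈ tilesFrom p ss →
  t ≡ finalTile q ⊎ coord (lastDir q) t < coord (lastDir q) (finalTile q)
last-or-before end (here r) = inj₁ r
last-or-before {d} {p = p} (straight {ss = ss} q) i with ∈-tilesFrom⁻ d p ss i
... | inj₁ refl = inj₂ (before-last (straight q))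
... | inj₂ j    = last-or-before q j
last-or-before {e = e} {p} (turn {ss = ss} q) i with ∈-tilesFrom⁻ e p ss i
... | inj₁ refl = inj₂ (before-last (turn q))
... | inj₂ j    = last-or-before q j

previous : ∀ {d e p s ss as bs vs} (q : Paths d e p (s ∷ ss) as bs vs) →
  Σ Point λ t → t ∈ tilesFrom p (s ∷ ss) × go (lastDir q) t ≡ finalTile q
previous {d} {p = p} (straight end) = p , ∈-tilesFrom-head p (d ∷ []) , refl
previous {d} {p = p} (straight {ss = ss} q@(straight _)) = let (t , i , r) = previous q in t , ∈-tilesFrom-tail d p ss i , r
previous {d} {p = p} (straight {ss = ss} q@(turn _))     = let (t , i , r) = previous q in t , ∈-tilesFrom-tail d p ss i , r
previous {e = e} {p} (turn end) = p , ∈-tilesFrom-head p (e ∷ []) , refl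
previous {e = e} {p} (turn {ss = ss} q@(straight _)) = let (t , i , r) = previous q in t , ∈-tilesFrom-tail e p ss i , r
previous {e = e} {p} (turn {ss = ss} q@(turn _))     = let (t , i , r) = previous q in t , ∈-tilesFrom-tail e p ss i , r

tilesFrom-unique : ∀ p ss → Unique (tilesFrom p ss)
tilesFrom-unique p []       = [] ∷ []
tilesFrom-unique p (s ∷ ss) = ≡.subst Unique (≡.sym (tilesFrom-∷ s p ss))
  (fresh (λ i → ℕP.<-irrefl refl (tilesFrom-> s p ss i)) ∷ tilesFrom-unique (go s p) ss)

otherThanLast-reverse : ∀ ss {t r} → reverse (tiles ss) ≡ t ∷ r → otherThanLast ss ≡ reverse r
otherThanLast-reverse ss e rewrite e = refl

otherThanLast⁺ : ∀ ss {t} → t ∈ tiles ss → t ≢ lastTile ss → t ∈ otherThanLast ss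
otherThanLast⁺ ss {t} i n with reverse-last (tiles ss) (lastTile-last ss)
... | r , e with ≡.subst (t ∈_) e (reverse⁺ i)
... | here q  = ⊥-elim (n q)
... | there j = ≡.subst (t ∈_) (≡.sym (otherThanLast-reverse ss e)) (reverse⁺ j)

otherThanLast⁻ : ∀ ss {t} → t ∈ otherThanLast ss → t ∈ tiles ss × t ≢ lastTile ss
otherThanLast⁻ ss {t} i with reverse-last (tiles ss) (lastTile-last ss)
... | r , e = reverse⁻ (≡.subst (t ∈_) (≡.sym e) (there t∈r)) , distinct (≡.subst Unique e (unique-reverse (tilesFrom-unique (0 , 0) ss)))
  where
  t∈r : t ∈ r
  t∈r = reverse⁻ (≡.subst (t ∈_) (otherThanLast-reverse ss e) i)
  distinct : Unique (lastTile ss ∷ r) → t ≢ lastTile ss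
  distinct (n ∷ _) q = All.lookup n t∈r (≡.sym q)

otherThanFirst-∷ : ∀ d ss → otherThanFirst (d ∷ ss) ≡ tilesFrom (go d (0 , 0)) ss
otherThanFirst-∷ R ss = refl
otherThanFirst-∷ U ss = refl

any-true : ∀ {A : Set} (b : A → Bool) {xs x} → x ∈ xs → b x ≡ true → any b xs ≡ true
any-true b (here refl) e rewrite e = refl
any-true b {y ∷ ys} (there i) e with b y
... | true  = refl
... | false = any-true b i e

any-false : ∀ {A : Set} (b : A → Bool) xs → (∀ {x} → x ∈ xs → b x ≡ false) → any b xs ≡ false
any-false b []       h = refl
any-false b (x ∷ xs) h rewrite h (here refl) = any-false b xs (λ i → h (there i))

any⁻ : ∀ {A : Set} (b : A → Bool) xs → any b xs ≡ true → Σ A λ x → x ∈ xs × b x ≡ true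
any⁻ b (x ∷ xs) e with b x in q
... | true  = x , here refl , q
... | false = let (y , i , r) = any⁻ b xs e in y , there i , r

memP⁺ : ∀ {v xs} → v ∈ xs → memP v xs ≡ true
memP⁺ {v} i = any-true (v ==P_) i (==P-refl v)

memP⁻ : ∀ {v} xs → memP v xs ≡ true → v ∈ xs
memP⁻ {v} xs e with any⁻ (v ==P_) xs e
... | x , i , q with ==P-≡ {v} {x} q
... | refl = i

privateCorner⁺ : ∀ {v t ts} → v ∈ corners t → (∀ {t′} → t′ ∈ ts → v ∉ corners t′) → T (memP v (privateCorners t ts))
privateCorner⁺ {v} {t} {ts} i h = Equivalence.from T-≡ (memP⁺ (∈-filterᵇ⁺ (λ v → not (any (λ t′ → memP v (corners t′)) ts)) i
  (cong not (any-false (λ t′ → memP v (corners t′)) ts (λ {t′} j → memP-≢ (corners t′) (λ { k refl → h j k }))))))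

privateCorner⁻ : ∀ {v t ts} → T (memP v (privateCorners t ts)) → ∀ {t′} → t′ ∈ ts → v ∉ corners t′
privateCorner⁻ {v} {t} {ts} p {t′} i j = absurd
  (proj₂ (∈-filterᵇ⁻ (λ v → not (any (λ t′ → memP v (corners t′)) ts)) {corners t} {v} (memP⁻ (privateCorners t ts) (Equivalence.to T-≡ p))))
  (any-true (λ t′ → memP v (corners t′)) i (memP⁺ j))
  where
  absurd : ∀ {b} → not b ≡ true → b ≡ true → ⊥
  absurd {true} () _

-- The common shape to which both `IsStartEdge` and `IsEndEdge` unfold.
Private : Point → List Point → Edge → Set
Private t ts x = x ∈ sides t × T (memP (proj₁ (endpoints x)) (privateCorners t ts)) × T (memP (proj₂ (endpoints x)) (privateCorners t ts))

private⁺ : ∀ {c u t ts} → edge c u ∈ sides t → (∀ {t′} → t′ ∈ ts → u ∉ corners t′) → (∀ {t′} → t′ ∈ ts → go c u ∉ corners t′) →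
  Private t ts (edge c u)
private⁺ {c} {u} {t} {ts} i f g = i ,
  ≡.subst (λ z → T (memP (proj₁ z) (privateCorners t ts))) (≡.sym (endpoints-edge c u)) (privateCorner⁺ (proj₁ (edge-corner i)) f) ,
  ≡.subst (λ z → T (memP (proj₂ z) (privateCorners t ts))) (≡.sym (endpoints-edge c u)) (privateCorner⁺ (proj₂ (edge-corner i)) g)

private⁻ : ∀ {c u t ts} → Private t ts (edge c u) → ∀ {t′} → t′ ∈ ts → u ∉ corners t′ × go c u ∉ corners t′
private⁻ {c} {u} {t} {ts} (_ , a , b) i =
  privateCorner⁻ {t = t} {ts} (≡.subst (λ z → T (memP (proj₁ z) (privateCorners t ts))) (endpoints-edge c u) a) i ,
  privateCorner⁻ {t = t} {ts} (≡.subst (λ z → T (memP (proj₂ z) (privateCorners t ts))) (endpoints-edge c u) b) i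

memE⁺ : ∀ {x xs} → x ∈ xs → memE x xs ≡ true
memE⁺ {x} i = any-true (x ==E_) i (==E-refl x)
  where
  ==E-refl : ∀ x → (x ==E x) ≡ true
  ==E-refl (hor p) = ==P-refl p
  ==E-refl (ver p) = ==P-refl p

memE⁻ : ∀ {x} xs → memE x xs ≡ true → x ∈ xs
memE⁻ {x} xs e with any⁻ (x ==E_) xs e
... | y , i , q with ==E-≡ x y q
  where
  ==E-≡ : ∀ x y → (x ==E y) ≡ true → x ≡ y
  ==E-≡ (hor p) (hor q) e = cong hor (==P-≡ e)
  ==E-≡ (ver p) (ver q) e = cong ver (==P-≡ e)
  ==E-≡ (hor p) (ver q) ()
  ==E-≡ (ver p) (hor q) ()
... | refl = i

tileCount-one : ∀ ss {x t} → t ∈ tiles ss → x ∈ sides t → (∀ {t′} → t′ ∈ tiles ss → x ∈ sides t′ → t′ ≡ t) → tileCount ss x ≡ 1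
tileCount-one ss {x} {t} i j only = ↭-length (unique-↭ {ys = t ∷ []} (filterᵇ-unique (λ t → memE x (sides t)) (tilesFrom-unique (0 , 0) ss)) ([] ∷ [])
  (λ k → let (l , m) = ∈-filterᵇ⁻ (λ t → memE x (sides t)) {tiles ss} k in here (only l (memE⁻ _ m)))
  (λ { (here refl) → ∈-filterᵇ⁺ (λ t → memE x (sides t)) i (memE⁺ j) }))

tileCount-two : ∀ ss {x t t′} → tileCount ss x ≡ 1 → t ∈ tiles ss → t′ ∈ tiles ss → x ∈ sides t → x ∈ sides t′ → t ≡ t′
tileCount-two ss {x} e i i′ j j′ = singleton (filterᵇ (λ t → memE x (sides t)) (tiles ss)) e
  (∈-filterᵇ⁺ (λ t → memE x (sides t)) i (memE⁺ j)) (∈-filterᵇ⁺ (λ t → memE x (sides t)) i′ (memE⁺ j′))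
  where
  singleton : ∀ xs {t t′ : Point} → length xs ≡ 1 → t ∈ xs → t′ ∈ xs → t ≡ t′
  singleton (y ∷ []) _ (here refl) (here refl) = refl

boundary⁺ : ∀ ss {x t} → t ∈ tiles ss → x ∈ sides t → tileCount ss x ≡ 1 → x ∈ boundaryEdges ss
boundary⁺ ss {x} i j e = ∈-filter⁺ (λ y → Bool.T? (tileCount ss y ℕ.≡ᵇ 1)) (∈-edges⁺ ss i j) (ℕP.≡⇒≡ᵇ _ 1 e)

boundary⁻ : ∀ ss {x} → x ∈ boundaryEdges ss → (Σ Point λ t → t ∈ tiles ss × x ∈ sides t) × tileCount ss x ≡ 1
boundary⁻ ss {x} i = let (j , e) = ∈-filter⁻ (λ y → Bool.T? (tileCount ss y ℕ.≡ᵇ 1)) {xs = edges ss} i in ∈-edges⁻ ss j , ℕP.≡ᵇ⇒≡ _ 1 e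

-- Uniqueness of the boundary traversals

Links : (Edge → Set) → Point → Point → Set
Links E u v = Σ Edge λ x → E x × T (joins x u v)

consec⁻ : ∀ {E P} → ConsecJoined E P → ∀ {u v} → Next u v P → Links E u v
consec⁻ (l ∷ c) here      = l
consec⁻ (l ∷ c) (there m) = consec⁻ c m
consec⁻ [ v ]   (there ())

consec⁺ : ∀ {E} P → (∀ {u v} → Next u v P → Links E u v) → ConsecJoined E P
consec⁺ []          h = []
consec⁺ (u ∷ [])    h = [ u ]
consec⁺ (u ∷ v ∷ P) h = h here ∷ consec⁺ (v ∷ P) (λ m → h (there m))

module Boundary {d e} (o : Opp d e) (ss′ : List Step) {as bs vs} (q′ : Paths d e (go d (0 , 0)) ss′ as bs vs) where

  private
    ss = d ∷ ss′
    p₀ : Point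
    p₀ = (0 , 0)
    As = p₀ ∷ as
    Bs = go e p₀ ∷ bs
    q : Paths d e p₀ ss As Bs (p₀ ∷ go e p₀ ∷ vs)
    q = straight q′
    d′ = lastDir q
    e′ = lastOpp q
    o′ = last-opp o q
    F = finalTile q
  open Split (split o q)

  lastTile-F : lastTile ss ≡ F
  lastTile-F = just-injective (≡.trans (≡.sym (lastTile-last ss)) (finalTile-last q))

  origin : ∀ c → coord c p₀ ≡ 0
  origin R = refl
  origin U = refl

  other-first : ∀ {t} → t ∈ otherThanFirst ss → 0 < coord d t
  other-first {t} i = ≡.subst (_< coord d t) (origin d)
    (tilesFrom-> d p₀ ss′ (≡.subst (t ∈_) (otherThanFirst-∷ d ss′) i))

  second : go d p₀ ∈ otherThanFirst ss
  second = ≡.subst (go d p₀ ∈_) (≡.sym (otherThanFirst-∷ d ss′)) (∈-tilesFrom-head (go d p₀) ss′)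

  start-edge : IsStartEdge ss (edge e p₀)
  start-edge = private⁺ {e} {p₀} (∈-sides⁺ o near-e)
    (λ i j → ℕP.<⇒≱ (ℕP.<-≤-trans (other-first i) (corner-≥ j d)) (ℕP.≤-reflexive (origin d)))
    (λ i j → ℕP.<⇒≱ (ℕP.<-≤-trans (other-first i) (corner-≥ j d)) (ℕP.≤-reflexive (≡.trans (coord-go-opp (opp-sym o) p₀) (origin d))))

  -- Each of the other three sides has an end on the second tile.
  start-edge-unique : ∀ {x} → IsStartEdge ss x → x ≡ edge e p₀
  start-edge-unique {x} s = view (∈-sides⁻ o (proj₁ s)) s
    where
    view : ∀ {x} → Sides d e p₀ x → IsStartEdge ss x → x ≡ edge e p₀
    view near-d s = ⊥-elim (proj₂ (private⁻ {d} {p₀} s second) (∈-corners⁺ o c₀))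
    view far-d  s = ⊥-elim (proj₂ (private⁻ {d} {go e p₀} s second) (≡.subst (_∈ corners (go d p₀)) (≡.sym (go-comm o p₀)) (∈-corners⁺ o c-e)))
    view near-e s = refl
    view far-e  s = ⊥-elim (proj₁ (private⁻ {e} {go d p₀} s second) (∈-corners⁺ o c₀))

  other-last : ∀ {t} → t ∈ otherThanLast ss → coord d′ t < coord d′ F
  other-last i with otherThanLast⁻ ss i
  ... | j , n with last-or-before q j
  ... | inj₁ refl = ⊥-elim (n (≡.sym lastTile-F))
  ... | inj₂ l    = l

  IsEnd : Edge → Set
  IsEnd = Private F (otherThanLast ss)

  penultimate : Σ Point λ t → t ∈ otherThanLast ss × go d′ t ≡ F
  penultimate with previous q
  ... | t , i , r = t , otherThanLast⁺ ss i (λ z → go-≢ d′ (≡.trans r (≡.sym (≡.trans z lastTile-F)))) , r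

  end-edge : IsEndEdge ss (endEdge q)
  end-edge = ≡.subst (λ z → Private z (otherThanLast ss) (endEdge q)) (≡.sym lastTile-F)
    (private⁺ {e′} {go d′ F} (∈-sides⁺ o′ far-e) (λ i j → high i (corner-≤ j d′) (coord-go d′ F))
      (λ i j → high i (corner-≤ j d′) (≡.trans (coord-go-opp (opp-sym o′) (go d′ F)) (coord-go d′ F))))
    where
    high : ∀ {t n} → t ∈ otherThanLast ss → n ≤ suc (coord d′ t) → n ≡ suc (coord d′ F) → ⊥
    high i l refl = ℕP.<⇒≱ (other-last i) (ℕ.s≤s⁻¹ l)

  -- The tile before the last contains an end of each of the other three sides.
  end-edge-unique : ∀ {x} → IsEndEdge ss x → x ≡ endEdge q
  end-edge-unique {x} s = let s′ = ≡.subst (λ z → Private z (otherThanLast ss) x) lastTile-F s in view (∈-sides⁻ o′ (proj₁ s′)) s′ penultimate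
    where
    view : ∀ {x} → Sides d′ e′ F x → IsEnd x → (Σ Point λ t → t ∈ otherThanLast ss × go d′ t ≡ F) → x ≡ endEdge q
    view near-d s (t , i , r) = ⊥-elim (proj₁ (private⁻ {d′} {F} s i) (≡.subst (_∈ corners t) r (∈-corners⁺ o′ c-d)))
    view far-d  s (t , i , r) = ⊥-elim (proj₁ (private⁻ {d′} {go e′ F} s i) (≡.subst (λ z → go e′ z ∈ corners t) r (∈-corners⁺ o′ c₁)))
    view near-e s (t , i , r) = ⊥-elim (proj₁ (private⁻ {e′} {F} s i) (≡.subst (_∈ corners t) r (∈-corners⁺ o′ c-d)))
    view far-e  s _ = refl

  E : Edge → Set
  E = IsBoundaryPathEdge ss

  link⁺ : ∀ {u v} → Next u v As ⊎ Next u v Bs → Links E u v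
  link⁺ {u} n with outer o q n
  ... | record { dir = c ; isStep = refl ; tile∈ = i ; side = j ; only = h ; ≢entry = ns ; ≢end = ne } =
    edge c u , (boundary⁺ ss i j (tileCount-one ss i j h) , (λ s → ns (start-edge-unique s)) , (λ s → ne (end-edge-unique s)))
    , Equivalence.from T-≡ (joins-edge c u)

  -- The joining edge falls under `classify`. The start and end edges are excluded by assumption,
  -- and a `shared` edge lies on two tiles, so it does not bound the unbounded face.
  link⁻ : ∀ {u v} → Links E u v → Both (λ u v → Next u v As) u v ⊎ Both (λ u v → Next u v Bs) u v
  link⁻ {u} {v} (x , (b , ns , ne) , j) = view (classify o q (proj₁ (proj₂ (proj₁ (boundary⁻ ss b)))) (proj₂ (proj₂ (proj₁ (boundary⁻ ss b)))))
    b ns ne (joins⁻ x u v (Equivalence.to T-≡ j))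
    where
    Goal = Both (λ u v → Next u v As) u v ⊎ Both (λ u v → Next u v Bs) u v
    match : ∀ {c u′ y} → Next u′ (go c u′) As ⊎ Next u′ (go c u′) Bs → y ≡ edge c u′ → Joined y u v → Goal
    match {c} n r (fwd {c′} r′ refl) with edge-injective {c} {c′} (≡.trans (≡.sym r) r′)
    ... | refl , refl = Sum.map inj₁ inj₁ n
    match {c} n r (bwd {c′} r′ refl) with edge-injective {c} {c′} (≡.trans (≡.sym r) r′)
    ... | refl , refl = Sum.map inj₂ inj₂ n
    view : ∀ {y} → Class (edge e p₀) (endEdge q) (tiles ss) As Bs y → y ∈ boundaryEdges ss → ¬ IsStartEdge ss y → ¬ IsEndEdge ss y →
      Joined y u v → Goal
    view (onPath {c} {u′} n) b ns ne j = match {c} {u′} n refl j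
    view isEntry b ns ne j = ⊥-elim (ns start-edge)
    view isEnd b ns ne j = ⊥-elim (ne end-edge)
    view (shared i i′ n k k′) b ns ne j = ⊥-elim (n (tileCount-two ss (proj₂ (boundary⁻ ss b)) i i′ k k′))

  start-ends : ∀ {s} → IsEndpointOf (IsStartEdge ss) s → s ≡ p₀ ⊎ s ≡ go e p₀
  start-ends (x , i , r) with start-edge-unique i
  ... | refl = ≡.subst (λ z → _ ≡ proj₁ z ⊎ _ ≡ proj₂ z) (endpoints-edge e p₀) r

  end-ends : ∀ {f} → IsEndpointOf (IsEndEdge ss) f → f ≡ go d′ F ⊎ f ≡ go e′ (go d′ F)
  end-ends (x , i , r) with end-edge-unique i
  ... | refl = ≡.subst (λ z → _ ≡ proj₁ z ⊎ _ ≡ proj₂ z) (endpoints-edge e′ (go d′ F)) r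

  endpoint : ∀ {S : Edge → Set} c {u v} → S (edge c u) → v ≡ u ⊎ v ≡ go c u → IsEndpointOf S v
  endpoint c {u} s r = edge c u , s , ≡.subst (λ z → _ ≡ proj₁ z ⊎ _ ≡ proj₂ z) (≡.sym (endpoints-edge c u)) r

  last-vertex : ∀ {f} → f ≡ go d′ F ⊎ f ≡ go e′ (go d′ F) → last As ≡ just f ⊎ last Bs ≡ just f
  last-vertex r with path-ends q | r
  ... | inj₁ (a , b) | inj₁ refl = inj₁ a
  ... | inj₁ (a , b) | inj₂ refl = inj₂ b
  ... | inj₂ (b , a) | inj₁ refl = inj₂ b
  ... | inj₂ (b , a) | inj₂ refl = inj₁ a

  traversal : ∀ {x ys} → Unique (x ∷ ys) → (∀ {u v} → Next u v (x ∷ ys) → Next u v As ⊎ Next u v Bs) → (x ≡ p₀ ⊎ x ≡ go e p₀) →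
    (Σ Point λ f → last (x ∷ ys) ≡ just f × (f ≡ go d′ F ⊎ f ≡ go e′ (go d′ F))) → IsBoundaryTraversal ss (x ∷ ys)
  traversal u n r (f , l , r′) = u , consec⁺ _ (λ m → link⁺ (n m)) , _ , f , refl , l ,
    inj₁ (endpoint e start-edge r , endpoint e′ end-edge r′)

  traversal-As : IsBoundaryTraversal ss As
  traversal-As = traversal as! inj₁ (inj₁ refl) (lasts (path-ends q))
    where
    lasts : Ends q As Bs ⊎ Ends q Bs As → Σ Point λ f → last As ≡ just f × (f ≡ go d′ F ⊎ f ≡ go e′ (go d′ F))
    lasts (inj₁ (a , b)) = _ , a , inj₁ refl
    lasts (inj₂ (b , a)) = _ , a , inj₂ refl

  traversal-Bs : IsBoundaryTraversal ss Bs
  traversal-Bs = traversal bs! inj₂ (inj₂ refl) (lasts (path-ends q))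
    where
    lasts : Ends q As Bs ⊎ Ends q Bs As → Σ Point λ f → last Bs ≡ just f × (f ≡ go d′ F ⊎ f ≡ go e′ (go d′ F))
    lasts (inj₁ (a , b)) = _ , b , inj₂ refl
    lasts (inj₂ (b , a)) = _ , b , inj₁ refl

  J : Point → Point → Set
  J u v = Both (λ u v → Next u v As) u v ⊎ Both (λ u v → Next u v Bs) u v

  J-sym : ∀ {u v} → J u v → J v u
  J-sym = Sum.map Sum.swap Sum.swap

  from-start : ∀ {P s f} → Unique P → (∀ {u v} → Next u v P → J u v) → head P ≡ just s → last P ≡ just f →
    s ≡ p₀ ⊎ s ≡ go e p₀ → f ≡ go d′ F ⊎ f ≡ go e′ (go d′ F) → P ≡ As ⊎ P ≡ Bs
  from-start P! j h l (inj₁ refl) r = inj₁ (walk-is-path As Bs refl as! disj P! j h l (last-vertex r))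
  from-start P! j h l (inj₂ refl) r = inj₂ (walk-is-path Bs As refl bs! (λ a b → disj b a) P! (λ m → Sum.swap (j m)) h l (Sum.swap (last-vertex r)))

  -- A traversal beginning at the end edge is reversed first, so that both cases are walks from a
  -- vertex of the start edge; that vertex decides which of the two paths is followed.
  traversal-unique : ∀ {P} → IsBoundaryTraversal ss P → (P ≡ As ⊎ P ≡ reverse As) ⊎ (P ≡ Bs ⊎ P ≡ reverse Bs)
  traversal-unique (P! , c , s , f , h , l , inj₁ (a , b)) =
    Sum.map inj₁ inj₁ (from-start P! (λ m → link⁻ (consec⁻ c m)) h l (start-ends a) (end-ends b))
  traversal-unique {P} (P! , c , s , f , h , l , inj₂ (b , a)) = Sum.map (λ r → inj₂ (back r)) (λ r → inj₂ (back r))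
    (from-start (unique-reverse P!) (λ m → J-sym (link⁻ (consec⁻ c (next-reverse P m)))) head-reverse (last-rev P h) (start-ends a) (end-ends b))
    where
    back : ∀ {Q} → reverse P ≡ Q → P ≡ reverse Q
    back r = ≡.trans (≡.sym (reverse-involutive P)) (cong reverse r)
    head-reverse : head (reverse P) ≡ just f
    head-reverse with reverse-last P l
    ... | r , z = cong head z
    last-rev : ∀ P {s} → head P ≡ just s → last (reverse P) ≡ just s
    last-rev (x ∷ xs) refl = last-reverse xs

  through : ∀ {P} → IsBoundaryTraversal ss P → p₀ ∈ P → P ≡ As ⊎ P ≡ reverse As
  through t i with traversal-unique t
  ... | inj₁ r           = r
  ... | inj₂ (inj₁ refl) = ⊥-elim (disj (here refl) i)
  ... | inj₂ (inj₂ refl) = ⊥-elim (disj (here refl) (reverse⁻ i))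

  avoiding : ∀ {P} → IsBoundaryTraversal ss P → p₀ ∉ P → P ≡ Bs ⊎ P ≡ reverse Bs
  avoiding t n with traversal-unique t
  ... | inj₂ r           = r
  ... | inj₁ (inj₁ refl) = ⊥-elim (n (here refl))
  ... | inj₁ (inj₂ refl) = ⊥-elim (n (reverse⁺ {xs = As} (here refl)))

  p₀∉Bs : p₀ ∉ Bs
  p₀∉Bs = disj (here refl)

-- Assembly for longer snakes and for the single tile

first-suffix : ∀ {d e} → Opp d e → ∀ ss col w proper turns kast →
  Growing.Suffix (d ∷ ss) col w proper turns kast d e (go d (0 , 0)) ss
first-suffix {d} {e} o ss col w proper turns kast = record
  { inside = ∈-tilesFrom-tail d (0 , 0) ss
  ; earlier = λ i → Sum.swap (Sum.map (λ { refl → ℕP.≤-reflexive (≡.sym (coord-go d (0 , 0))) , coord-≤-go d e (0 , 0) }) (λ j → j)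
      (∈-tilesFrom⁻ d (0 , 0) ss i))
  -- The suffix begins at the second tile, reached by the first step `d`, so its coordinate is
  -- already 1; the first tile is then added as a straight one.
  ; entered = ℕP.≤-trans (s≤s z≤n) (ℕP.≤-reflexive (≡.sym (coord-go d (0 , 0))))
  ; ends = ≡.sym (tilesFrom-last d (0 , 0) ss) }

module _ {d e} (o : Opp d e) (ss : List Step) (col : Colouring) (w : Weighting) (proper : ProperColouring (d ∷ ss) col)
  (turns : TurnsBlack (d ∷ ss) col) (kast : ∀ t → t ∈ tiles (d ∷ ss) → KastFace 4 (negCount w (sides t)))
  {as bs vs : List Point} (q : Paths d e (go d (0 , 0)) ss as bs vs) where
  open Conclusion (d ∷ ss) col w proper
  open FromState turns kast
  open Growing (d ∷ ss) col w proper turns kast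

  snakePair : BoundaryPair ((0 , 0) ∷ as) (go e (0 , 0) ∷ bs)
  snakePair = boundaryPair o (straight q) (∈-tilesFrom-head (0 , 0) (d ∷ ss)) (there (p∈as q)) (there (e∈bs q))
    (state-straight′ o (∈-tilesFrom-head (0 , 0) (d ∷ ss)) q (state o q (first-suffix o ss col w proper turns kast)))

  snakeClaim : ∀ {P P′} → IsBoundaryTraversal (d ∷ ss) P → (0 , 0) ∈ P → IsBoundaryTraversal (d ∷ ss) P′ → (0 , 0) ∉ P′ → Claim P P′
  snakeClaim t i t′ n = claims snakePair (Boundary.through o ss q t i) (Boundary.avoiding o ss q t′ n)

module _ (col : Colouring) (w : Weighting) (proper : ProperColouring [] col)
  (turns : TurnsBlack [] col) (kast : ∀ t → t ∈ tiles [] → KastFace 4 (negCount w (sides t))) where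
  open Conclusion [] col w proper
  open FromState turns kast
  open Growing [] col w proper turns kast

  -- For a single tile crossed to the right the constructed paths are bottom and top in this order,
  -- whereas the upper boundary comes first in the claim; hence the exchange.
  tilePair : BoundaryPair ((0 , 1) ∷ (1 , 1) ∷ []) ((0 , 0) ∷ (1 , 0) ∷ [])
  tilePair = sides-swap (boundaryPair RU end (here refl) (there (here refl)) (there (here refl)) (state-end RU (here refl)))

theorem6p4 : (ss : List Step) (col : Colouring) (w : Weighting) →
    ProperColouring ss col → TurnsBlack ss col → Kasteleyn ss w →
    Σ (List Point) (IsUpperBoundary ss) × Σ (List Point) (IsLowerBoundary ss) ×
    ((P₁ P₂ : List Point) → IsUpperBoundary ss P₁ → IsLowerBoundary ss P₂ →
    (charPoly (adjMatrix ss w) ≈P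
    compose (charPoly (boundaryMatrix ss col w P₁)) (X *P X) *P
    compose (charPoly (boundaryMatrix ss col w P₂)) (X *P X)) ×
    ContFracClaim ss col w P₁ × ContFracClaim ss col w P₂)
theorem6p4 [] col w proper turns (kast , _) = (_ , inj₁ refl) , (_ , inj₁ refl) ,
  λ P₁ P₂ u l → Conclusion.claims [] col w proper (tilePair col w proper turns kast) u l
theorem6p4 (R ∷ ss) col w proper turns (kast , _) =
  let (_ , _ , _ , q) = paths RU (1 , 0) ss in
  (_ , Boundary.traversal-Bs RU ss q , Boundary.p₀∉Bs RU ss q) , (_ , Boundary.traversal-As RU ss q , here refl) ,
  -- With the second tile on the right, the path through the origin is the lower boundary, so the
  -- claim arrives with its two paths in the opposite order.
  λ P₁ P₂ (t , n) (t′ , i) → Conclusion.claim-swap (R ∷ ss) col w proper {P₂} {P₁} (snakeClaim RU ss col w proper turns kast q t′ i t n)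
theorem6p4 (U ∷ ss) col w proper turns (kast , _) =
  let (_ , _ , _ , q) = paths UR (0 , 1) ss in
  (_ , Boundary.traversal-As UR ss q , here refl) , (_ , Boundary.traversal-Bs UR ss q , Boundary.p₀∉Bs UR ss q) ,
  λ P₁ P₂ (t , i) (t′ , n) → snakeClaim UR ss col w proper turns kast q t i t′ n
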